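{- Let $\mathcal{D}$ be a balanced quadriculated disk containing a domino $d$ such that $\mathcal{D}\smallsetminus d$ is not connected. Suppose that there exists a $2\times2$ square contained in $\mathcal{D}$ which contains $d$. If every connected component of $\mathcal{D}\smallsetminus d$ which intersects a $2\times2$ square that is contained in $\mathcal{D}$ and contains $d$ has size at most $\frac{|\mathcal{D}|-2}{2}$, then $\mathcal{D}$ is strongly irregular.
   Context: A quadriculated disk $\mathcal{D}\subset\mathbb{R}^2$ is a finite union of closed unit squares with vertices in $\mathbb{Z}^2$ that is homeomorphic to a closed disk. The unit square $[a,a+1]\times[b,b+1]$, $(a,b)\in\mathbb{Z}^2$, is white if $a+b$ is even and black if $a+b$ is odd. Two unit squares are adjacent if they share an edge; a (planar) domino is a union of two adjacent unit squares. A $2\times2$ square means a union of four unit squares of the form $[a,a+2]\times[b,b+2]$, $(a,b)\in\mathbb{Z}^2$. $\mathcal{D}$ is balanced if it contains equally many white and black unit squares. The size $|\cdot|$ of a union of unit squares is its number of unit squares. Connected components of $\mathcal{D}\smallsetminus d$ are identified with the corresponding sets of unit squares (connected via shared edges); such a component intersects a $2\times 2$ square if they have a unit square in common. Domino group. A plug is a union $p\subseteq\mathcal{D}$ of unit squares of $\mathcal{D}$ with equally many white and black squares; $\mathbf{p}_\circ=\emptyset$ is the empty plug. Two plugs are disjoint if their interiors are disjoint. The 2-complex $\mathcal{C}_{\mathcal{D}}$ is defined as follows. - Vertices: the plugs. - Edges: for every two distinct disjoint plugs $p_1,p_2$, one edge between $p_1$ and $p_2$ for each planar domino tiling of $\mathcal{D}\smallsetminus\mathrm{int}(p_1\cup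 p_2)$ (the empty region has exactly one tiling, the empty one); also one loop at $\mathbf{p}_\circ$ for each planar domino tiling of $\mathcal{D}$. - 2-cells: (i) for each loop $f$, a disk attached along $f*f$ (so that a projective plane results); (ii) for each two edges joining the same two distinct plugs whose tilings differ by a single planar flip (replacing two parallel dominoes forming a $2\times2$ square by the other two), a disk attached along the resulting bigon; (iii) for each four plugs $p_1,p_2,p_3,p_4$ with $p_2$ disjoint from $p_1$ and from $p_4$, and $p_2=p_3\cup d'$ where $d'$ is a domino whose two unit squares are not in $p_3$, and for each tiling $f_1^*$ of $\mathcal{D}\smallsetminus\mathrm{int}(p_1\cup p_2)$ and each tiling $f_2^*$ of $\mathcal{D}\smallsetminus\mathrm{int}(p_2\cup p_4)$, a disk attached along the quadrilateral $p_1\to p_2\to p_4\to p_3\to p_1$ with edges $f_1^*$, $f_2^*$, $f_2^*\cup\{d'\}$, $f_1^*\cup\{d'\}$. The domino group is $G_{\mathcal{D}}=\pi_1(\mathcal{C}_{\mathcal{D}},\mathbf{p}_\circ)$. The even domino group $G_{\mathcal{D}}^+$ is the kernel of the homomorphism $G_{\mathcal{D}}\to\mathbb{Z}/(2)$ sending a closed edge path of length $N$ to $N \bmod 2$. The disk $\mathcal{D}$ is strongly irregular if there exists a surjective homomorphism from $G_{\mathcal{D}}^+$ onto the free group $F_2$ of rank two. -}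

module Defs where

open import Algebra.Bundles using (Group)
open import Algebra.Morphism.Structures using (module GroupMorphisms)
open import Algebra.Properties.Group using (ε⁻¹≈ε)
open import Data.Fin.Base using (Fin)
open import Data.Fin.Subset
  using (Subset; ⊥; ⊤; ⁅_⁆; ∁; _∩_; _∪_; ⋃; ∣_∣; _∈_; _⊆_; Nonempty; Empty)
open import Data.Fin.Subset.Properties using (∪-comm; ∩-comm; ∩-zeroˡ)
open import Data.Integer.Base as ℤ using (ℤ; +_)
import Data.Integer.Divisibility.Signed as ℤ
open import Data.List.Base using (List; []; _∷_; _++_)
import Data.List.Properties as List
open import Data.List.Relation.Binary.Permutation.Propositional
  using (_↭_; ↭-refl; ↭-sym; ↭-trans)
open import Data.List.Relation.Unary.All using (All)
open import Data.List.Relation.Unary.AllPairs using (AllPairs)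
open import Data.Nat.Base as ℕ using (ℕ; suc; parity)
import Data.Nat.Properties as ℕ
open import Data.Parity.Base as ℙ using (0ℙ)
import Data.Parity.Properties as ℙ
open import Data.Product.Base using (∃; ∃₂; Σ-syntax; ∃-syntax; _×_; _,_; proj₁; proj₂)
open import Data.Rational.Base as ℚ using (ℚ; 0ℚ; 1ℚ)
open import Data.Sign.Base as Sign using (Sign)
import Data.Sign.Properties as Sign
open import Data.Sum.Base using (_⊎_)
open import Data.Vec.Base using (tabulate)
open import Function.Definitions using (Injective; Surjective)
open import Level using (0ℓ)
open import Relation.Binary.Construct.Closure.ReflexiveTransitive using (Star; ε; _◅_; _◅◅_)
open import Relation.Binary.Construct.Closure.ReflexiveTransitive.Properties using (◅◅-assoc)
open import Relation.Binary.PropositionalEquality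
  using (_≡_; _≢_; refl; sym; trans; cong; subst)
open import Relation.Binary.Structures using (IsEquivalence)
open import Relation.Nullary using (¬_; does; contradiction)
open import Relation.Unary using (Pred)

-- A closed planar set that is the closure of its rational points X is
-- represented by the Cauchy completion of X (in the maximum metric).

Within : ℚ → ℚ × ℚ → ℚ × ℚ → Set
Within r (x , y) (x′ , y′) = ℚ.∣ x ℚ.- x′ ∣ ℚ.< r × ℚ.∣ y ℚ.- y′ ∣ ℚ.< r

record Point (X : Pred (ℚ × ℚ) 0ℓ) : Set where
  field
    approx : ℕ → ℚ × ℚ
    inside : ∀ k → X (approx k)
    cauchy : ∀ r → 0ℚ ℚ.< r →
             ∃[ N ] (∀ k m → N ℕ.≤ k → N ℕ.≤ m → Within r (approx k) (approx m))

open Point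

Near : ∀ {X} → ℚ → Point X → Point X → Set
Near r x y = ∃[ N ] (∀ k → N ℕ.≤ k → Within r (approx x k) (approx y k))

SamePoint : ∀ {X} → Point X → Point X → Set
SamePoint x y = ∀ r → 0ℚ ℚ.< r → Near r x y

-- Only compact sets occur below.  On these continuity is, as usual
-- constructively, taken to be uniform (classically, Heine–Cantor).
Continuous : ∀ {X Y} → (Point X → Point Y) → Set
Continuous f = ∀ r → 0ℚ ℚ.< r →
  ∃[ s ] (0ℚ ℚ.< s × (∀ x x′ → Near s x x′ → Near r (f x) (f x′)))

record Homeomorphic (X Y : Pred (ℚ × ℚ) 0ℓ) : Set where
  field
    to              : Point X → Point Y
    from            : Point Y → Point X
    to-continuous   : Continuous to
    from-continuous : Continuous from
    from∘to         : ∀ x → SamePoint (from (to x)) x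
    to∘from         : ∀ y → SamePoint (to (from y)) y

ClosedDisk : Pred (ℚ × ℚ) 0ℓ
ClosedDisk (x , y) = x ℚ.* x ℚ.+ y ℚ.* y ℚ.≤ 1ℚ

-- (a , b) stands for the unit square [a , a+1] × [b , b+1].
Cell : Set
Cell = ℤ × ℤ

UnitSquare : Cell → Pred (ℚ × ℚ) 0ℓ
UnitSquare (a , b) (x , y) =
  (a ℚ./ 1 ℚ.≤ x × x ℚ.≤ ℤ.suc a ℚ./ 1) × (b ℚ./ 1 ℚ.≤ y × y ℚ.≤ ℤ.suc b ℚ./ 1)

Adjacent : Cell → Cell → Set
Adjacent (a , b) (a′ , b′) =
  (ℤ.∣ a ℤ.- a′ ∣ ≡ 1 × b ≡ b′) ⊎ (a ≡ a′ × ℤ.∣ b ℤ.- b′ ∣ ≡ 1)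

-- A finite union of closed unit squares and the closed unit disk are both
-- closures of their rational points, as Homeomorphic requires.
record QuadriculatedDisk : Set where
  field
    size     : ℕ
    cell     : Fin size → Cell
    distinct : Injective _≡_ _≡_ cell
    disk     : Homeomorphic (λ z → ∃[ i ] UnitSquare (cell i) z) ClosedDisk

module _ (G H : Group 0ℓ 0ℓ) where
  private
    module G = Group G
    module H = Group H
  open GroupMorphisms G.rawGroup H.rawGroup

  Kernel : (φ : G.Carrier → H.Carrier) → IsGroupHomomorphism φ → Group 0ℓ 0ℓ
  Kernel φ hom = record
    { Carrier = Σ[ g ∈ G.Carrier ] φ g H.≈ H.ε
    ; _≈_     = λ g h → proj₁ g G.≈ proj₁ h
    ; _∙_     = λ (g , g∈) (h , h∈) → g G.∙ h ,
        H.trans (homo g h) (H.trans (H.∙-cong g∈ h∈) (H.identityˡ H.ε))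
    ; ε       = G.ε , ε-homo
    ; _⁻¹     = λ (g , g∈) → g G.⁻¹ ,
        H.trans (⁻¹-homo g) (H.trans (H.⁻¹-cong g∈) (ε⁻¹≈ε H))
    ; isGroup = record
      { isMonoid = record
        { isSemigroup = record
          { isMagma = record
            { isEquivalence = record { refl = G.refl ; sym = G.sym ; trans = G.trans }
            ; ∙-cong        = G.∙-cong
            }
          ; assoc = λ g h k → G.assoc (proj₁ g) (proj₁ h) (proj₁ k)
          }
        ; identity = (λ g → G.identityˡ (proj₁ g)) , (λ g → G.identityʳ (proj₁ g))
        }
      ; inverse = (λ g → G.inverseˡ (proj₁ g)) , (λ g → G.inverseʳ (proj₁ g))
      ; ⁻¹-cong = G.⁻¹-cong
      }
    }
    where open IsGroupHomomorphism hom

  SurjectsOnto : Set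
  SurjectsOnto = Σ[ φ ∈ (G.Carrier → H.Carrier) ]
    (IsGroupHomomorphism φ × Surjective G._≈_ H._≈_ φ)

module FreeGroup (A : Set) where

  Letter : Set
  Letter = Sign × A

  flip : Letter → Letter
  flip (s , a) = Sign.opposite s , a

  Word : Set
  Word = List Letter

  infix 4 _≈_
  data _≈_ : Word → Word → Set where
    ≈-refl  : ∀ {w} → w ≈ w
    ≈-sym   : ∀ {w w′} → w ≈ w′ → w′ ≈ w
    ≈-trans : ∀ {w w′ w″} → w ≈ w′ → w′ ≈ w″ → w ≈ w″
    ∷-cong  : ∀ x {w w′} → w ≈ w′ → x ∷ w ≈ x ∷ w′
    cancel  : ∀ x w → x ∷ flip x ∷ w ≈ w

  inverse : Word → Word
  inverse []      = []
  inverse (x ∷ w) = inverse w ++ flip x ∷ []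

  private
    flip² : ∀ x → flip (flip x) ≡ x
    flip² (s , a) = cong (_, a) (Sign.opposite-involutive s)

    ≡⇒≈ : ∀ {w w′} → w ≡ w′ → w ≈ w′
    ≡⇒≈ refl = ≈-refl

    ++-congˡ : ∀ u {w w′} → w ≈ w′ → u ++ w ≈ u ++ w′
    ++-congˡ []      eq = eq
    ++-congˡ (x ∷ u) eq = ∷-cong x (++-congˡ u eq)

    ++-congʳ : ∀ {w w′} u → w ≈ w′ → w ++ u ≈ w′ ++ u
    ++-congʳ u ≈-refl          = ≈-refl
    ++-congʳ u (≈-sym eq)      = ≈-sym (++-congʳ u eq)
    ++-congʳ u (≈-trans eq eq′) = ≈-trans (++-congʳ u eq) (++-congʳ u eq′)
    ++-congʳ u (∷-cong x eq)   = ∷-cong x (++-congʳ u eq)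
    ++-congʳ u (cancel x w)    = cancel x (w ++ u)

    ++-cong : ∀ {w w′ u u′} → w ≈ w′ → u ≈ u′ → w ++ u ≈ w′ ++ u′
    ++-cong {w′ = w′} {u = u} eq eq′ = ≈-trans (++-congʳ u eq) (++-congˡ w′ eq′)

    inverseˡ : ∀ w → inverse w ++ w ≈ []
    inverseˡ []      = ≈-refl
    inverseˡ (x ∷ w) = ≈-trans
      (≡⇒≈ (List.++-assoc (inverse w) (flip x ∷ []) (x ∷ w)))
      (≈-trans (++-congˡ (inverse w)
        (subst (λ y → flip x ∷ y ∷ w ≈ w) (flip² x) (cancel (flip x) w))) (inverseˡ w))

    inverseʳ : ∀ w → w ++ inverse w ≈ []
    inverseʳ []      = ≈-refl
    inverseʳ (x ∷ w) = ≈-trans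
      (∷-cong x (≈-trans (≡⇒≈ (sym (List.++-assoc w (inverse w) (flip x ∷ []))))
        (++-congʳ (flip x ∷ []) (inverseʳ w))))
      (cancel x [])

    inverse-cong : ∀ {w w′} → w ≈ w′ → inverse w ≈ inverse w′
    inverse-cong {w} {w′} eq = ≈-trans
      (≈-trans (≡⇒≈ (sym (List.++-identityʳ (inverse w))))
        (≈-trans (++-congˡ (inverse w) (≈-sym (inverseʳ w′)))
          (≡⇒≈ (sym (List.++-assoc (inverse w) w′ (inverse w′))))))
      (++-congʳ (inverse w′) (≈-trans (++-congˡ (inverse w) (≈-sym eq)) (inverseˡ w)))

  group : Group 0ℓ 0ℓ
  group = record
    { Carrier = Word
    ; _≈_     = _≈_
    ; _∙_     = _++_
    ; ε       = []
    ; _⁻¹     = inverse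
    ; isGroup = record
      { isMonoid = record
        { isSemigroup = record
          { isMagma = record
            { isEquivalence = record { refl = ≈-refl ; sym = ≈-sym ; trans = ≈-trans }
            ; ∙-cong        = ++-cong
            }
          ; assoc = λ u v w → ≡⇒≈ (List.++-assoc u v w)
          }
        ; identity = (λ _ → ≈-refl) , (λ w → ≡⇒≈ (List.++-identityʳ w))
        }
      ; inverse = inverseˡ , inverseʳ
      ; ⁻¹-cong = inverse-cong
      }
    }

F₂ : Group 0ℓ 0ℓ
F₂ = FreeGroup.group (Fin 2)

-- Every geometric edge is represented by its two orientations, which rev
-- exchanges; a 2-cell is represented by a closed path along which it is
-- attached.
record TwoComplex : Set₁ where
  infix 4 _≈ₑ_
  field
    Vertex         : Set
    Edge           : Vertex → Vertex → Set
    _≈ₑ_           : ∀ {u v} → Edge u v → Edge u v → Set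
    isEquivalence  : ∀ {u v} → IsEquivalence (_≈ₑ_ {u} {v})
    rev            : ∀ {u v} → Edge u v → Edge v u
    rev-cong       : ∀ {u v} {e f : Edge u v} → e ≈ₑ f → rev e ≈ₑ rev f
    rev-involutive : ∀ {u v} (e : Edge u v) → rev (rev e) ≈ₑ e
    rev-free       : ∀ {v} (e : Edge v v) → ¬ rev e ≈ₑ e
    Attached       : ∀ {v} → Star Edge v v → Set

module EdgePaths (K : TwoComplex) where
  open TwoComplex K

  Path : Vertex → Vertex → Set
  Path = Star Edge

  length : ∀ {u v} → Path u v → ℕ
  length ε       = 0
  length (e ◅ γ) = suc (length γ)

  inverse : ∀ {u v} → Path u v → Path v u
  inverse ε       = ε
  inverse (e ◅ γ) = inverse γ ◅◅ (rev e ◅ ε)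

  infix 4 _≃_
  data _≃_ : ∀ {u v} → Path u v → Path u v → Set where
    ≃-refl    : ∀ {u v} {γ : Path u v} → γ ≃ γ
    ≃-sym     : ∀ {u v} {γ δ : Path u v} → γ ≃ δ → δ ≃ γ
    ≃-trans   : ∀ {u v} {γ δ η : Path u v} → γ ≃ δ → δ ≃ η → γ ≃ η
    ◅-cong    : ∀ {u v w} {e f : Edge u v} {γ δ : Path v w} →
                e ≈ₑ f → γ ≃ δ → e ◅ γ ≃ f ◅ δ
    backtrack : ∀ {u v w} (e : Edge u v) (γ : Path u w) → e ◅ rev e ◅ γ ≃ γ
    contract  : ∀ {u v} {c : Path u u} → Attached c → (γ : Path u v) → c ◅◅ γ ≃ γ

  private
    ≈ₑ-refl : ∀ {u v} {e : Edge u v} → e ≈ₑ e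
    ≈ₑ-refl = IsEquivalence.refl isEquivalence

    ≡⇒≃ : ∀ {u v} {γ δ : Path u v} → γ ≡ δ → γ ≃ δ
    ≡⇒≃ refl = ≃-refl

    ◅◅-identityʳ : ∀ {u v} (γ : Path u v) → γ ◅◅ ε ≡ γ
    ◅◅-identityʳ ε       = refl
    ◅◅-identityʳ (e ◅ γ) = cong (e ◅_) (◅◅-identityʳ γ)

    ◅◅-congˡ : ∀ {u v w} (γ : Path u v) {δ η : Path v w} → δ ≃ η → γ ◅◅ δ ≃ γ ◅◅ η
    ◅◅-congˡ ε       eq = eq
    ◅◅-congˡ (e ◅ γ) eq = ◅-cong ≈ₑ-refl (◅◅-congˡ γ eq)

    ◅◅-congʳ : ∀ {u v w} {γ δ : Path u v} (η : Path v w) → γ ≃ δ → γ ◅◅ η ≃ δ ◅◅ η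
    ◅◅-congʳ η ≃-refl            = ≃-refl
    ◅◅-congʳ η (≃-sym eq)        = ≃-sym (◅◅-congʳ η eq)
    ◅◅-congʳ η (≃-trans eq eq′)  = ≃-trans (◅◅-congʳ η eq) (◅◅-congʳ η eq′)
    ◅◅-congʳ η (◅-cong e eq)     = ◅-cong e (◅◅-congʳ η eq)
    ◅◅-congʳ η (backtrack e γ)   = backtrack e (γ ◅◅ η)
    ◅◅-congʳ η (contract {c = c} a γ) =
      ≃-trans (≡⇒≃ (◅◅-assoc c γ η)) (contract a (γ ◅◅ η))

    ◅◅-cong : ∀ {u v w} {γ γ′ : Path u v} {δ δ′ : Path v w} →
              γ ≃ γ′ → δ ≃ δ′ → γ ◅◅ δ ≃ γ′ ◅◅ δ′
    ◅◅-cong {γ′ = γ′} {δ = δ} eq eq′ = ≃-trans (◅◅-congʳ δ eq) (◅◅-congˡ γ′ eq′)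

    rev-backtrack : ∀ {u v w} (e : Edge u v) (γ : Path v w) → rev e ◅ e ◅ γ ≃ γ
    rev-backtrack e γ = ≃-trans
      (◅-cong ≈ₑ-refl (◅-cong (IsEquivalence.sym isEquivalence (rev-involutive e)) ≃-refl))
      (backtrack (rev e) γ)

    inverseˡ : ∀ {u v} (γ : Path u v) → inverse γ ◅◅ γ ≃ ε
    inverseˡ ε       = ≃-refl
    inverseˡ (e ◅ γ) = ≃-trans
      (≡⇒≃ (◅◅-assoc (inverse γ) (rev e ◅ ε) (e ◅ γ)))
      (≃-trans (◅◅-congˡ (inverse γ) (rev-backtrack e γ)) (inverseˡ γ))

    inverseʳ : ∀ {u v} (γ : Path u v) → γ ◅◅ inverse γ ≃ ε
    inverseʳ ε       = ≃-refl
    inverseʳ (e ◅ γ) = ≃-trans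
      (◅-cong ≈ₑ-refl (≃-trans (≡⇒≃ (sym (◅◅-assoc γ (inverse γ) (rev e ◅ ε))))
        (◅◅-congʳ (rev e ◅ ε) (inverseʳ γ))))
      (backtrack e ε)

    inverse-cong : ∀ {u v} {γ δ : Path u v} → γ ≃ δ → inverse γ ≃ inverse δ
    inverse-cong {γ = γ} {δ} eq = ≃-trans
      (≃-trans (≡⇒≃ (sym (◅◅-identityʳ (inverse γ))))
        (≃-trans (◅◅-congˡ (inverse γ) (≃-sym (inverseʳ δ)))
          (≡⇒≃ (sym (◅◅-assoc (inverse γ) δ (inverse δ))))))
      (◅◅-congʳ (inverse δ) (≃-trans (◅◅-congˡ (inverse γ) (≃-sym eq)) (inverseˡ γ)))

  π₁ : Vertex → Group 0ℓ 0ℓ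
  π₁ v = record
    { Carrier = Path v v
    ; _≈_     = _≃_
    ; _∙_     = _◅◅_
    ; ε       = ε
    ; _⁻¹     = inverse
    ; isGroup = record
      { isMonoid = record
        { isSemigroup = record
          { isMagma = record
            { isEquivalence = record { refl = ≃-refl ; sym = ≃-sym ; trans = ≃-trans }
            ; ∙-cong        = ◅◅-cong
            }
          ; assoc = ◅◅-assoc′
          }
        ; identity = (λ _ → ≃-refl) , (λ γ → ≡⇒≃ (◅◅-identityʳ γ))
        }
      ; inverse = inverseˡ , inverseʳ
      ; ⁻¹-cong = inverse-cong
      }
    }
    where
    ◅◅-assoc′ : (γ δ η : Path v v) → (γ ◅◅ δ) ◅◅ η ≃ γ ◅◅ (δ ◅◅ η)
    ◅◅-assoc′ γ δ η = ≡⇒≃ (◅◅-assoc γ δ η)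

  lengthMod2 : ∀ {v} → Path v v → ℙ.Parity
  lengthMod2 γ = parity (length γ)

  module _ (even : ∀ {v} {c : Path v v} → Attached c → parity (length c) ≡ 0ℙ) where
    private
      length-◅◅ : ∀ {u v w} (γ : Path u v) (δ : Path v w) →
                  length (γ ◅◅ δ) ≡ length γ ℕ.+ length δ
      length-◅◅ ε       δ = refl
      length-◅◅ (e ◅ γ) δ = cong suc (length-◅◅ γ δ)

      length-inverse : ∀ {u v} (γ : Path u v) → length (inverse γ) ≡ length γ
      length-inverse ε       = refl
      length-inverse (e ◅ γ) = trans (length-◅◅ (inverse γ) (rev e ◅ ε))
        (trans (ℕ.+-comm (length (inverse γ)) 1) (cong suc (length-inverse γ)))

      parity-◅◅ : ∀ {u v w} (γ : Path u v) (δ : Path v w) →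
                  parity (length (γ ◅◅ δ)) ≡ parity (length γ) ℙ.+ parity (length δ)
      parity-◅◅ γ δ = trans (cong parity (length-◅◅ γ δ)) (ℙ.+-homo-+ (length γ) (length δ))

      parity-suc : ∀ {m n} → parity m ≡ parity n → parity (suc m) ≡ parity (suc n)
      parity-suc {m} {n} eq =
        trans (ℙ.+-homo-+ 1 m) (trans (cong (ℙ.1ℙ ℙ.+_) eq) (sym (ℙ.+-homo-+ 1 n)))

      parity-cong : ∀ {u v} {γ δ : Path u v} → γ ≃ δ → parity (length γ) ≡ parity (length δ)
      parity-cong ≃-refl           = refl
      parity-cong (≃-sym eq)       = sym (parity-cong eq)
      parity-cong (≃-trans eq eq′) = trans (parity-cong eq) (parity-cong eq′)
      parity-cong (◅-cong {γ = γ} {δ} _ eq) = parity-suc {length γ} {length δ} (parity-cong eq)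
      parity-cong (backtrack e γ)  = refl
      parity-cong (contract {c = c} a γ) =
        trans (parity-◅◅ c γ) (cong (ℙ._+ parity (length γ)) (even a))

    lengthMod2-isGroupHomomorphism : ∀ v →
      GroupMorphisms.IsGroupHomomorphism
        (Group.rawGroup (π₁ v)) (Group.rawGroup ℙ.+-0-group) lengthMod2
    lengthMod2-isGroupHomomorphism v = record
      { isMonoidHomomorphism = record
        { isMagmaHomomorphism = record
          { isRelHomomorphism = record { cong = parity-cong }
          ; homo              = parity-◅◅
          }
        ; ε-homo = refl
        }
      ; ⁻¹-homo = λ γ → cong parity (length-inverse γ)
      }

-- Unions of unit squares of 𝒟 are encoded as subsets of Fin size; for these,
-- having disjoint interiors means having no unit square in common.
module _ (𝒟 : QuadriculatedDisk) where
  open QuadriculatedDisk 𝒟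

  Region : Set
  Region = Subset size

  white black : Region
  white = tabulate λ i → let (a , b) = cell i in does (+ 2 ℤ.∣? a ℤ.+ b)
  black = ∁ white

  Balanced : Region → Set
  Balanced R = ∣ R ∩ white ∣ ≡ ∣ R ∩ black ∣

  Disjoint : Region → Region → Set
  Disjoint R S = Empty (R ∩ S)

  Domino : Region → Set
  Domino d = ∃₂ λ i j → Adjacent (cell i) (cell j) × d ≡ ⁅ i ⁆ ∪ ⁅ j ⁆

  TwoByTwo : Region → Set
  TwoByTwo Q = ∃₂ λ a b → ∃₂ λ i j → ∃₂ λ k l →
    cell i ≡ (a , b) × cell j ≡ (ℤ.suc a , b) ×
    cell k ≡ (a , ℤ.suc b) × cell l ≡ (ℤ.suc a , ℤ.suc b) ×
    Q ≡ (⁅ i ⁆ ∪ ⁅ j ⁆) ∪ (⁅ k ⁆ ∪ ⁅ l ⁆)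

  Connected : Region → Set
  Connected R = ∀ {i j} → i ∈ R → j ∈ R →
    Star (λ k l → k ∈ R × l ∈ R × Adjacent (cell k) (cell l)) i j

  Component : Region → Region → Set
  Component R C = Nonempty C × C ⊆ R × Connected C ×
    (∀ C′ → C ⊆ C′ → C′ ⊆ R → Connected C′ → C′ ⊆ C)

  -- As a set of dominoes, a tiling is a list up to permutation.
  record Tiling (R : Region) : Set where
    field
      dominoes : List Region
      domino   : All Domino dominoes
      disjoint : AllPairs Disjoint dominoes
      covers   : ⋃ dominoes ≡ R

  open Tiling using (dominoes)

  retarget : ∀ {R S} → R ≡ S → Tiling R → Tiling S
  retarget eq T = record { Tiling T ; covers = trans (Tiling.covers T) eq }

  Flip : List Region → List Region → Set
  Flip T T′ = ∃₂ λ d₁ d₂ → ∃₂ λ e₁ e₂ → ∃ λ U →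
    T ↭ d₁ ∷ d₂ ∷ U × T′ ↭ e₁ ∷ e₂ ∷ U ×
    TwoByTwo (d₁ ∪ d₂) × e₁ ∪ e₂ ≡ d₁ ∪ d₂ ×
    ¬ (d₁ ∷ d₂ ∷ [] ↭ e₁ ∷ e₂ ∷ [])

  record Plug : Set where
    constructor plug
    field
      squares   : Region
      .balanced : Balanced squares

  open Plug

  p∘ : Plug
  p∘ = plug ⊥ (trans (cong ∣_∣ (∩-zeroˡ white)) (cong ∣_∣ (sym (∩-zeroˡ black))))

  -- The sign of a loop is its orientation.
  data PlugEdge (p q : Plug) : Set where
    join : p ≢ q → Disjoint (squares p) (squares q) →
           Tiling (∁ (squares p ∪ squares q)) → PlugEdge p q
    loop : p ≡ p∘ → q ≡ p∘ → Sign → Tiling ⊤ → PlugEdge p q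

  tiles : ∀ {p q} → PlugEdge p q → List Region
  tiles (join _ _ T)   = dominoes T
  tiles (loop _ _ _ T) = dominoes T

  data SameEdge {p q : Plug} : PlugEdge p q → PlugEdge p q → Set where
    join : ∀ {ne ne′ dj dj′ T T′} → dominoes T ↭ dominoes T′ →
           SameEdge (join ne dj T) (join ne′ dj′ T′)
    loop : ∀ {l l′ r r′ s T T′} → dominoes T ↭ dominoes T′ →
           SameEdge (loop l r s T) (loop l′ r′ s T′)

  reversed : ∀ {p q} → PlugEdge p q → PlugEdge q p
  reversed {p} {q} (join ne dj T) = join (λ eq → ne (sym eq))
    (subst Empty (∩-comm (squares p) (squares q)) dj)
    (retarget (cong ∁ (∪-comm (squares p) (squares q))) T)
  reversed (loop l r s T) = loop r l (Sign.opposite s) T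

  data DominoCell : ∀ {p} → Star PlugEdge p p → Set where
    projectivePlane : ∀ {p} (l r : p ≡ p∘) (T : Tiling ⊤) →
      let f = loop l r Sign.+ T in DominoCell (f ◅ f ◅ ε)
    bigon : ∀ {p q} → p ≢ q → (e f : PlugEdge p q) → Flip (tiles e) (tiles f) →
      DominoCell (e ◅ reversed f ◅ ε)
    -- f₃ is a loop if p₃ = p₄ = p∘, and f₄ is one if p₃ = p₁ = p∘.  Both of its
    -- orientations are then allowed; they are homotopic by projectivePlane.
    quadrilateral : ∀ {p₁ p₂ p₃ p₄} (d : Region) → Domino d →
      Disjoint d (squares p₃) → squares p₂ ≡ squares p₃ ∪ d →
      (f₁ : PlugEdge p₁ p₂) (f₂ : PlugEdge p₂ p₄)
      (f₃ : PlugEdge p₄ p₃) (f₄ : PlugEdge p₃ p₁) →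
      tiles f₃ ↭ d ∷ tiles f₂ → tiles f₄ ↭ d ∷ tiles f₁ →
      DominoCell (f₁ ◅ f₂ ◅ f₃ ◅ f₄ ◅ ε)

  private
    sameEdge-refl : ∀ {p q} {e : PlugEdge p q} → SameEdge e e
    sameEdge-refl {e = join _ _ _}   = join ↭-refl
    sameEdge-refl {e = loop _ _ _ _} = loop ↭-refl

    sameEdge-sym : ∀ {p q} {e f : PlugEdge p q} → SameEdge e f → SameEdge f e
    sameEdge-sym (join eq) = join (↭-sym eq)
    sameEdge-sym (loop eq) = loop (↭-sym eq)

    sameEdge-trans : ∀ {p q} {e f g : PlugEdge p q} → SameEdge e f → SameEdge f g → SameEdge e g
    sameEdge-trans (join eq) (join eq′) = join (↭-trans eq eq′)
    sameEdge-trans (loop eq) (loop eq′) = loop (↭-trans eq eq′)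

    reversed-cong : ∀ {p q} {e f : PlugEdge p q} → SameEdge e f →
                    SameEdge (reversed e) (reversed f)
    reversed-cong (join eq) = join eq
    reversed-cong (loop eq) = loop eq

    reversed-involutive : ∀ {p q} (e : PlugEdge p q) → SameEdge (reversed (reversed e)) e
    reversed-involutive (join _ _ _)          = join ↭-refl
    reversed-involutive (loop _ _ Sign.+ _) = loop ↭-refl
    reversed-involutive (loop _ _ Sign.- _) = loop ↭-refl

    reversed-free : ∀ {p} (e : PlugEdge p p) → ¬ SameEdge (reversed e) e
    reversed-free (join ne _ _)       _  = contradiction refl ne
    reversed-free (loop _ _ Sign.+ _) ()
    reversed-free (loop _ _ Sign.- _) ()

  𝒞 : TwoComplex
  𝒞 = record
    { Vertex         = Plug
    ; Edge           = PlugEdge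
    ; _≈ₑ_           = SameEdge
    ; isEquivalence  = record
      { refl = sameEdge-refl ; sym = sameEdge-sym ; trans = sameEdge-trans }
    ; rev            = reversed
    ; rev-cong       = reversed-cong
    ; rev-involutive = reversed-involutive
    ; rev-free       = reversed-free
    ; Attached       = DominoCell
    }

  open EdgePaths 𝒞

  G : Group 0ℓ 0ℓ
  G = π₁ p∘

  cells-even : ∀ {p} {c : Path p p} → DominoCell c → parity (length c) ≡ 0ℙ
  cells-even (projectivePlane _ _ _)             = refl
  cells-even (bigon _ _ _ _)                     = refl
  cells-even (quadrilateral _ _ _ _ _ _ _ _ _ _) = refl

  G⁺ : Group 0ℓ 0ℓ
  G⁺ = Kernel G ℙ.+-0-group lengthMod2 (lengthMod2-isGroupHomomorphism cells-even p∘)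

  StronglyIrregular : Set
  StronglyIrregular = SurjectsOnto G⁺ F₂

{-# OPTIONS --safe #-}
module Submission where

-- Let C₁ and C₂ be the components of D ∖ d on the two sides of d that carry a 2 × 2
-- square around d (C₂ is empty if there is only one of them, or if they coincide).
-- Call a plug extreme if it contains all the white and none of the black squares of
-- C₁, and all the black and none of the white squares of C₂, or conversely.  If a
-- floor between two plugs contains d and one of the plugs is extreme, then so is the
-- other, in the opposite way, and no domino of the floor lies in C₁ or C₂; hence d is
-- not involved in any flip of this floor.  Therefore the word formed by the crossings
-- of such floors, read in the direction from even to odd heights, with one generator
-- for each of the two ways of being extreme at the even end, is invariant under
-- homotopy.
--
-- For surjectivity, two plugs that differ by a domino are joined by an even path.  In
-- terms of the sum of the plug and the white squares modulo 2, such a path exchanges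
-- two different values at adjacent squares.  The exchange across d can also be made
-- along the three other sides of a 2 × 2 square containing d, with trivial word.  Since
-- D is connected through edges, all plugs are thus joined by even paths with trivial
-- word, and one crossing of d next to an extreme plug gives a generator; such plugs
-- exist by the bound on the sizes of C₁ and C₂.
--
-- Connectivity through edges is where the homeomorphism with the closed disk enters.
-- Otherwise the squares fall into two classes which meet only in corners.  Horizontal
-- and vertical chords of the disk that avoid the images of all corners lie in a single
-- class, and they connect the images of any two squares.

open import Defs
open import Algebra.Bundles using (Group)
open import Algebra.Morphism.Structures using (module GroupMorphisms)
import Algebra.Properties.Group as GroupProperties
open import Data.Bool.Base as Bool using (Bool; true; false; not; _xor_)
import Data.Bool.Properties as Bool
import Data.Empty as Empty
open import Data.Fin.Base as Fin using (Fin; toℕ)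
import Data.Fin.Properties as Fin
open import Data.Fin.Subset
  using (Subset; ⊥; ⊤; ⁅_⁆; ∁; _∩_; _∪_; ⋃; ∣_∣; _∈_; _∉_; _⊆_; Nonempty; Empty)
import Data.Fin.Subset.Properties as Subset
open import Data.Integer.Base as ℤ using (ℤ; +_; -[1+_])
import Data.Integer.DivMod as ℤ
import Data.Integer.Divisibility.Signed as ℤ
import Data.Integer.Properties as ℤ
open import Data.List.Base as List using (List; []; _∷_)
import Data.List.Membership.DecPropositional as DecMembership
import Data.List.Membership.Propositional as List using (_∈_)
open import Data.List.Membership.Propositional using (find)
import Data.List.Membership.Propositional.Properties as List
import Data.List.Properties as List
open import Data.List.Relation.Binary.Permutation.Propositional as Perm using
  (_↭_; ↭-sym; ↭-trans; ↭⇒↭ₛ)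
open import Data.List.Relation.Binary.Permutation.Propositional.Properties using (∈-resp-↭)
import Data.List.Relation.Binary.Permutation.Setoid.Properties as PermSetoid
open import Data.List.Relation.Unary.All as All using (All; []; _∷_)
import Data.List.Relation.Unary.All.Properties as All
open import Data.List.Relation.Unary.AllPairs using (AllPairs; []; _∷_)
open import Data.List.Relation.Unary.Any as Any using (Any; here; there)
import Data.List.Relation.Unary.Any.Properties as Any
open import Data.Nat.Base as ℕ using (ℕ; suc; zero; parity; _⊔_; _∸_; _≤_)
open import Data.Nat.DivMod as ℕ using (_/_)
import Data.Nat.Properties as ℕ
open import Data.Parity.Base as ℙ using (0ℙ; 1ℙ)
import Data.Parity.Properties as ℙ
open import Data.Product.Base using (∃₂; Σ-syntax; ∃-syntax; _×_; _,_; proj₁; proj₂)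
open import Data.Rational.Base as ℚ using (ℚ; 0ℚ; 1ℚ; ½)
import Data.Rational.Properties as ℚ
open import Data.Rational.Solver using (module +-*-Solver)
import Data.Rational.Unnormalised.Base as ℚᵘ
import Data.Rational.Unnormalised.Properties as ℚᵘ
open import Data.Sign.Base as Sign using (Sign)
open import Data.Sum.Base as Sum using (_⊎_; inj₁; inj₂; [_,_]′)
open import Data.Vec.Base as Vec using (lookup)
import Data.Vec.Properties as Vec
open import Function.Base using (_∘_; id)
open import Relation.Binary.Construct.Closure.ReflexiveTransitive as Star using (Star; ε; _◅_; _◅◅_)
open import Relation.Binary.Definitions using (tri<; tri≈; tri>)
open import Relation.Binary.PropositionalEquality
open import Relation.Nullary
  using (¬_; Dec; contradiction; yes; no; ¬?; does; _×-dec_; _⊎-dec_; _→-dec_)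
open import Relation.Nullary.Decidable using
  (dec-true; dec-false; decidable-stable; map′; recompute)
open +-*-Solver using (solve; _:+_; _:-_; _:*_; :-_; _:=_; con)

-- Rational arithmetic

-- Translating the known inequality gives the new one. The equality of differences is a ring
-- identity, so the inequalities below are left to the solver.
≤-by-difference : ∀ {p q p′ q′} → p′ ℚ.≤ q′ → q ℚ.- p ≡ q′ ℚ.- p′ → p ℚ.≤ q
≤-by-difference {p} {q} {p′} {q′} le eq = subst₂ ℚ._≤_
  (solve 2 (λ p′ p → (:- p′ :+ p) :+ p′ := p) refl p′ p)
  (trans (solve 3 (λ p p′ q′ → (:- p′ :+ p) :+ q′ := p :+ (q′ :- p′)) refl p p′ q′)
    (trans (cong (p ℚ.+_) (sym eq)) (solve 2 (λ p q → p :+ (q :- p) := q) refl p q)))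
  (ℚ.+-monoʳ-≤ (ℚ.- p′ ℚ.+ p) le)

<-by-difference : ∀ {p q p′ q′} → p′ ℚ.< q′ → q ℚ.- p ≡ q′ ℚ.- p′ → p ℚ.< q
<-by-difference {p} {q} {p′} {q′} le eq = subst₂ ℚ._<_
  (solve 2 (λ p′ p → (:- p′ :+ p) :+ p′ := p) refl p′ p)
  (trans (solve 3 (λ p p′ q′ → (:- p′ :+ p) :+ q′ := p :+ (q′ :- p′)) refl p p′ q′)
    (trans (cong (p ℚ.+_) (sym eq)) (solve 2 (λ p q → p :+ (q :- p) := q) refl p q)))
  (ℚ.+-monoʳ-< (ℚ.- p′ ℚ.+ p) le)

*-nonneg : ∀ {p q} → 0ℚ ℚ.≤ p → 0ℚ ℚ.≤ q → 0ℚ ℚ.≤ p ℚ.* q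
*-nonneg {p} {q} 0≤p 0≤q = ℚ.nonNegative⁻¹ (p ℚ.* q)
  {{ℚ.nonNeg*nonNeg⇒nonNeg p {{ℚ.nonNegative 0≤p}} q {{ℚ.nonNegative 0≤q}}}}

*-pos : ∀ {p q} → 0ℚ ℚ.< p → 0ℚ ℚ.< q → 0ℚ ℚ.< p ℚ.* q
*-pos {p} {q} 0<p 0<q = ℚ.positive⁻¹ (p ℚ.* q)
  {{ℚ.pos*pos⇒pos p {{ℚ.positive 0<p}} q {{ℚ.positive 0<q}}}}

p≤∣p∣ : ∀ p → p ℚ.≤ ℚ.∣ p ∣
p≤∣p∣ p with ℚ.≤-total 0ℚ p
... | inj₁ 0≤p = ℚ.≤-reflexive (sym (ℚ.0≤p⇒∣p∣≡p 0≤p))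
... | inj₂ p≤0 = ℚ.≤-trans p≤0 (ℚ.0≤∣p∣ p)

∣p-q∣≡∣q-p∣ : ∀ p q → ℚ.∣ p ℚ.- q ∣ ≡ ℚ.∣ q ℚ.- p ∣
∣p-q∣≡∣q-p∣ p q = trans (sym (ℚ.∣-p∣≡∣p∣ (p ℚ.- q)))
  (cong ℚ.∣_∣ (solve 2 (λ p q → :- (p :- q) := q :- p) refl p q))

∣p-q∣<r⇒p<q+r : ∀ p q {r} → ℚ.∣ p ℚ.- q ∣ ℚ.< r → p ℚ.< q ℚ.+ r
∣p-q∣<r⇒p<q+r p q {r} lt = <-by-difference
  (ℚ.≤-<-trans (p≤∣p∣ (p ℚ.- q)) lt)
  (solve 3 (λ p q r → (q :+ r) :- p := r :- (p :- q)) refl p q r)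

∣p-q∣<r⇒q<p+r : ∀ p q {r} → ℚ.∣ p ℚ.- q ∣ ℚ.< r → q ℚ.< p ℚ.+ r
∣p-q∣<r⇒q<p+r p q lt = ∣p-q∣<r⇒p<q+r q p (subst (ℚ._< _) (∣p-q∣≡∣q-p∣ p q) lt)

∣p-q∣<r : ∀ p q {r} → p ℚ.< q ℚ.+ r → q ℚ.< p ℚ.+ r → ℚ.∣ p ℚ.- q ∣ ℚ.< r
∣p-q∣<r p q {r} lt gt with ℚ.∣p∣≡p∨∣p∣≡-p (p ℚ.- q)
... | inj₁ eq = <-by-difference lt
  (trans (cong (λ z → r ℚ.- z) eq) (solve 3 (λ p q r → r :- (p :- q) := (q :+ r) :- p) refl p q r))
... | inj₂ eq = <-by-difference gt
  (trans (cong (λ z → r ℚ.- z) eq)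
    (solve 3 (λ p q r → r :- (:- (p :- q)) := (p :+ r) :- q) refl p q r))

∣-∣-triangle : ∀ p q s {r r′} → ℚ.∣ p ℚ.- q ∣ ℚ.< r → ℚ.∣ q ℚ.- s ∣ ℚ.< r′ →
               ℚ.∣ p ℚ.- s ∣ ℚ.< r ℚ.+ r′
∣-∣-triangle p q s lt lt′ = ℚ.≤-<-trans
  (subst (λ z → ℚ.∣ z ∣ ℚ.≤ ℚ.∣ p ℚ.- q ∣ ℚ.+ ℚ.∣ q ℚ.- s ∣)
    (solve 3 (λ p q s → (p :- q) :+ (q :- s) := p :- s) refl p q s)
    (ℚ.∣p+q∣≤∣p∣+∣q∣ (p ℚ.- q) (q ℚ.- s)))
  (ℚ.+-mono-< lt lt′)

half-pos : ∀ {r} → 0ℚ ℚ.< r → 0ℚ ℚ.< ½ ℚ.* r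
half-pos = *-pos (ℚ.positive⁻¹ ½)

halves : ∀ r → ½ ℚ.* r ℚ.+ ½ ℚ.* r ≡ r
halves = solve 1 (λ r → con ½ :* r :+ con ½ :* r := r) refl

fromℤ : ℤ → ℚ
fromℤ a = a ℚ./ 1

toℚᵘ-fromℤ : ∀ a → ℚ.toℚᵘ (fromℤ a) ℚᵘ.≃ ℚᵘ.mkℚᵘ a 0
toℚᵘ-fromℤ a = ℚ.toℚᵘ-fromℚᵘ (ℚᵘ.mkℚᵘ a 0)

fromℤ-mono-≤ : ∀ {a b} → a ℤ.≤ b → fromℤ a ℚ.≤ fromℤ b
fromℤ-mono-≤ {a} {b} le = ℚ.toℚᵘ-cancel-≤
  (ℚᵘ.≤-respˡ-≃ (ℚᵘ.≃-sym (toℚᵘ-fromℤ a)) (ℚᵘ.≤-respʳ-≃ (ℚᵘ.≃-sym (toℚᵘ-fromℤ b))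
    (ℚᵘ.*≤* (ℤ.*-monoʳ-≤-nonNeg (+ 1) le))))

fromℤ-suc : ∀ a → fromℤ (ℤ.suc a) ≡ 1ℚ ℚ.+ fromℤ a
fromℤ-suc a = ℚ.toℚᵘ-injective (ℚᵘ.≃-trans (toℚᵘ-fromℤ (ℤ.suc a)) (ℚᵘ.≃-sym
  (ℚᵘ.≃-trans (ℚ.toℚᵘ-homo-+ 1ℚ (fromℤ a))
    (ℚᵘ.≃-trans (ℚᵘ.+-congʳ (ℚ.toℚᵘ 1ℚ) (toℚᵘ-fromℤ a))
      (ℚᵘ.*≡* (cong (λ z → (+ 1 ℤ.+ z) ℤ.* + 1) (ℤ.*-identityʳ a)))))))

InUnit : ℤ → ℚ → Set
InUnit a x = fromℤ a ℚ.≤ x × x ℚ.≤ fromℤ (ℤ.suc a)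

-- The same bit names an end of a unit interval here and a column or row of a `2 × 2` square later.
shifted : ℤ → Bool → ℤ
shifted a false = a
shifted a true  = ℤ.suc a

-- Since `x ≤ a + 1 ≤ a′ ≤ x′`, a distance below `r ≤ 1` leaves no room for a whole unit between the
-- intervals, and their common endpoint lies between the two points.
touching : ∀ {a a′ x x′ r} → InUnit a x → InUnit a′ x′ → a ℤ.< a′ → r ℚ.≤ 1ℚ →
  ℚ.∣ x ℚ.- x′ ∣ ℚ.< r →
           a′ ≡ ℤ.suc a × (ℚ.∣ x ℚ.- fromℤ (ℤ.suc a) ∣ ℚ.< r × ℚ.∣ x′ ℚ.- fromℤ (ℤ.suc a) ∣ ℚ.< r)
touching {a} {a′} {x} {x′} {r} (a≤x , x≤a+1) (a′≤x′ , x′≤a′+1) a<a′ r≤1 lt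
  with ℤ.<-cmp (ℤ.suc a) a′
... | tri> ≰ _ a′<a+1 = contradiction (ℤ.<-≤-trans a′<a+1 (ℤ.i<j⇒suc[i]≤j a<a′)) (ℤ.<-irrefl refl)
... | tri≈ _ refl _ = refl ,
  ∣p-q∣<r x _ (ℚ.≤-<-trans x≤a+1 (r+ (fromℤ (ℤ.suc a))))
    (ℚ.≤-<-trans a′≤x′ (∣p-q∣<r⇒q<p+r x x′ lt)) ,
  ∣p-q∣<r x′ _ (ℚ.<-≤-trans (∣p-q∣<r⇒q<p+r x x′ lt) (ℚ.+-monoˡ-≤ r x≤a+1))
    (ℚ.≤-<-trans a′≤x′ (r+ x′))
  where
  0<r : 0ℚ ℚ.< r
  0<r = ℚ.≤-<-trans (ℚ.0≤∣p∣ _) lt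
  r+ : ∀ p → p ℚ.< p ℚ.+ r
  r+ p = subst (ℚ._< p ℚ.+ r) (ℚ.+-identityʳ p) (ℚ.+-monoʳ-< p 0<r)
... | tri< a+1<a′ _ _ = contradiction (ℚ.<-≤-trans (∣p-q∣<r⇒q<p+r x x′ lt) x+r≤x′) (ℚ.<-irrefl refl)
  where
  x+r≤x′ : x ℚ.+ r ℚ.≤ x′
  x+r≤x′ = ℚ.≤-trans (ℚ.+-mono-≤ x≤a+1 r≤1) (ℚ.≤-trans
    (ℚ.≤-reflexive (trans (ℚ.+-comm (fromℤ (ℤ.suc a)) 1ℚ) (sym (fromℤ-suc (ℤ.suc a)))))
    (ℚ.≤-trans (fromℤ-mono-≤ (ℤ.i<j⇒suc[i]≤j a+1<a′)) a′≤x′))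

∣suc-∣ : ∀ a → ℤ.∣ ℤ.suc a ℤ.- a ∣ ≡ 1
∣suc-∣ a = cong ℤ.∣_∣ (trans (ℤ.+-assoc (+ 1) a (ℤ.- a)) (cong ℤ.suc (ℤ.+-inverseʳ a)))

units-touch : ∀ {a a′ x x′ r} → InUnit a x → InUnit a′ x′ → r ℚ.≤ 1ℚ → ℚ.∣ x ℚ.- x′ ∣ ℚ.< r →
              a ≡ a′ ⊎ (ℤ.∣ a ℤ.- a′ ∣ ≡ 1 × ∃[ ι ] ℚ.∣ x ℚ.- fromℤ (shifted a ι) ∣ ℚ.< r)
units-touch {a} {a′} {x} {x′} {r} inx inx′ r≤1 lt with ℤ.<-cmp a a′
... | tri≈ _ eq _ = inj₁ eq
... | tri< a<a′ _ _ =
      inj₂ (trans (ℤ.∣i-j∣≡∣j-i∣ a a′) (trans (cong (λ z → ℤ.∣ z ℤ.- a ∣) (proj₁ t)) (∣suc-∣ a)) ,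
    true , proj₁ (proj₂ t))
  where t = touching {x = x} {x′} {r} inx inx′ a<a′ r≤1 lt
... | tri> _ _ a′<a = inj₂ (trans (cong (λ z → ℤ.∣ z ℤ.- a′ ∣) (proj₁ t)) (∣suc-∣ a′) ,
    false , subst (λ b → ℚ.∣ x ℚ.- fromℤ b ∣ ℚ.< r) (sym (proj₁ t)) (proj₂ (proj₂ t)))
  where t = touching {x = x′} {x} {r} inx′ inx a′<a r≤1 (subst (ℚ._< r) (∣p-q∣≡∣q-p∣ x x′) lt)

-- The open interval of radius 1/2 around a midpoint meets no other unit interval, not even in an
-- endpoint.
near-midpoint : ∀ {a a′ x} → InUnit a′ x → ℚ.∣ fromℤ a ℚ.+ ½ ℚ.- x ∣ ℚ.< ½ → a′ ≡ a
near-midpoint {a} {a′} {x} (a′≤x , x≤a′+1) near with ℤ.<-cmp a′ a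
... | tri≈ _ eq _ = eq
... | tri< a′<a _ _ =
      contradiction (ℚ.<-≤-trans a<x (ℚ.≤-trans x≤a′+1 (fromℤ-mono-≤ (ℤ.i<j⇒suc[i]≤j a′<a))))
        (ℚ.<-irrefl refl)
  where
  a<x : fromℤ a ℚ.< x
  a<x = <-by-difference (∣p-q∣<r⇒p<q+r (fromℤ a ℚ.+ ½) x near)
    (solve 2 (λ a x → x :- a := (x :+ con ½) :- (a :+ con ½)) refl (fromℤ a) x)
... | tri> _ _ a<a′ = contradiction (ℚ.<-≤-trans x<a+1
    (ℚ.≤-trans (ℚ.≤-reflexive (sym (fromℤ-suc a)))
      (ℚ.≤-trans (fromℤ-mono-≤ (ℤ.i<j⇒suc[i]≤j a<a′)) a′≤x))) (ℚ.<-irrefl refl)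
  where
  x<a+1 : x ℚ.< 1ℚ ℚ.+ fromℤ a
  x<a+1 = <-by-difference (∣p-q∣<r⇒q<p+r (fromℤ a ℚ.+ ½) x near)
    (solve 2 (λ a x → (con 1ℚ :+ a) :- x := ((a :+ con ½) :+ con ½) :- x) refl (fromℤ a) x)

square-nonneg : ∀ p → 0ℚ ℚ.≤ p ℚ.* p
square-nonneg p with ℚ.≤-total 0ℚ p
... | inj₁ 0≤p = *-nonneg 0≤p 0≤p
... | inj₂ p≤0 = subst (0ℚ ℚ.≤_) (solve 1 (λ p → (:- p) :* (:- p) := p :* p) refl p)
  (*-nonneg (ℚ.neg-antimono-≤ p≤0) (ℚ.neg-antimono-≤ p≤0))

+-nonneg : ∀ {p q} → 0ℚ ℚ.≤ p → 0ℚ ℚ.≤ q → 0ℚ ℚ.≤ p ℚ.+ q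
+-nonneg 0≤p 0≤q = ℚ.+-mono-≤ 0≤p 0≤q

p≤q⇒0≤q-p : ∀ {p q} → p ℚ.≤ q → 0ℚ ℚ.≤ q ℚ.- p
p≤q⇒0≤q-p {p} {q} le = ≤-by-difference le
  (solve 2 (λ p q → (q :- p) :- con 0ℚ := q :- p) refl p q)

0≤q-p⇒p≤q : ∀ {p q s} → 0ℚ ℚ.≤ s → q ℚ.- p ≡ s → p ℚ.≤ q
0≤q-p⇒p≤q {s = s} le eq = ≤-by-difference le (trans eq (sym (ℚ.+-identityʳ s)))

0<q-p⇒p<q : ∀ {p q s} → 0ℚ ℚ.< s → q ℚ.- p ≡ s → p ℚ.< q
0<q-p⇒p<q {s = s} le eq = <-by-difference le (trans eq (sym (ℚ.+-identityʳ s)))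

p<q⇒0<q-p : ∀ {p q} → p ℚ.< q → 0ℚ ℚ.< q ℚ.- p
p<q⇒0<q-p {p} {q} le = <-by-difference le
  (solve 2 (λ p q → (q :- p) :- con 0ℚ := q :- p) refl p q)

minimum : ∀ {a b} → 0ℚ ℚ.< a → 0ℚ ℚ.< b → ∃[ t ] (0ℚ ℚ.< t × t ℚ.≤ a × t ℚ.≤ b)
minimum {a} {b} 0<a 0<b with ℚ.≤-total a b
... | inj₁ a≤b = a , 0<a , ℚ.≤-refl , a≤b
... | inj₂ b≤a = b , 0<b , b≤a , ℚ.≤-refl

-- Recursive, unlike `fromℤ (+ n)`, so that `suc` unfolds to an addition of `1ℚ` that the ring
-- solver understands.
fromℕ : ℕ → ℚ
fromℕ zero    = 0ℚ
fromℕ (suc n) = 1ℚ ℚ.+ fromℕ n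

fromℕ-mono : ∀ {m n} → m ℕ.≤ n → fromℕ m ℚ.≤ fromℕ n
fromℕ-mono {zero}  {zero}  _ = ℚ.≤-refl
fromℕ-mono {zero}  {suc n} _ = +-nonneg (ℚ.nonNegative⁻¹ 1ℚ) (fromℕ-mono {zero} {n} ℕ.z≤n)
fromℕ-mono (ℕ.s≤s m≤n) = ℚ.+-monoʳ-≤ 1ℚ (fromℕ-mono m≤n)

fromℕ-pos : ∀ n → 0ℚ ℚ.< fromℕ (suc n)
fromℕ-pos n = ℚ.+-mono-<-≤ (ℚ.positive⁻¹ 1ℚ) (fromℕ-mono {zero} {n} ℕ.z≤n)

fromℕ≡fromℤ : ∀ n → fromℕ n ≡ fromℤ (+ n)
fromℕ≡fromℤ zero    = refl
fromℕ≡fromℤ (suc n) = trans (cong (1ℚ ℚ.+_) (fromℕ≡fromℤ n)) (sym (fromℤ-suc (+ n)))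

reciprocal : ∀ n → ∃[ τ ] (0ℚ ℚ.< τ × fromℕ (suc n) ℚ.* τ ≡ 1ℚ)
reciprocal n = ℚ.1/_ N {{N≢0}} , ℚ.positive⁻¹ _ {{ℚ.1/pos⇒pos N}} , ℚ.*-inverseʳ N {{N≢0}}
  where
  N = fromℕ (suc n)
  instance
    N>0 : ℚ.Positive N
    N>0 = ℚ.positive (fromℕ-pos n)
    N≢0 : ℚ.NonZero N
    N≢0 = ℚ.pos⇒nonZero N

archimedean : ∀ {s} → 0ℚ ℚ.< s → ∃[ n ] 1ℚ ℚ.≤ fromℕ (suc n) ℚ.* s
archimedean {s@(ℚ.mkℚ (ℤ.+_ zero) d _)} 0<s = contradiction (ℚ.positive 0<s) λ ()
archimedean {s@(ℚ.mkℚ ℤ.-[1+ _ ] d _)} 0<s = contradiction (ℚ.positive 0<s) λ ()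
-- The denominator `suc d` clears the fraction: `suc d` times `s` is the positive numerator `suc p`.
archimedean {s@(ℚ.mkℚ (ℤ.+_ (suc p)) d _)} 0<s = d ,
  subst (λ z → 1ℚ ℚ.≤ z ℚ.* s) (sym (fromℕ≡fromℤ (suc d)))
    (ℚ.toℚᵘ-cancel-≤ (ℚᵘ.≤-respʳ-≃
      (ℚᵘ.≃-sym (ℚᵘ.≃-trans (ℚ.toℚᵘ-homo-* (fromℤ (+ suc d)) s)
        (ℚᵘ.*-congʳ {ℚ.toℚᵘ s} (toℚᵘ-fromℤ (+ suc d)))))
      (ℚᵘ.*≤* (ℤ.+≤+ le))))
  where
  le : 1 ℕ.* (1 ℕ.* suc d) ℕ.≤ (suc d ℕ.* suc p) ℕ.* 1
  le = subst₂ ℕ._≤_ (sym (trans (ℕ.*-identityˡ (1 ℕ.* suc d)) (ℕ.*-identityˡ (suc d))))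
    (sym (ℕ.*-identityʳ (suc d ℕ.* suc p))) (ℕ.m≤m*n (suc d) (suc p))

-- Segments in the closed disk

mix : ℚ → ℚ → ℚ → ℚ
mix t p p′ = (1ℚ ℚ.- t) ℚ.* p ℚ.+ t ℚ.* p′

InDisk : ℚ → ℚ → Set
InDisk x y = x ℚ.* x ℚ.+ y ℚ.* y ℚ.≤ 1ℚ

-- `1 - ∣(1 - t) P + t P′∣² = (1 - t) (1 - ∣P∣²) + t (1 - ∣P′∣²) + t (1 - t) ∣P - P′∣²`, a sum of
-- nonnegative terms.
disk-convex : ∀ {t x y x′ y′} → 0ℚ ℚ.≤ t → t ℚ.≤ 1ℚ → InDisk x y → InDisk x′ y′ →
              InDisk (mix t x x′) (mix t y y′)
disk-convex {t} {x} {y} {x′} {y′} 0≤t t≤1 d d′ = 0≤q-p⇒p≤q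
  (+-nonneg (+-nonneg (*-nonneg 0≤1-t (p≤q⇒0≤q-p d)) (*-nonneg 0≤t (p≤q⇒0≤q-p d′)))
    (*-nonneg (*-nonneg 0≤t 0≤1-t)
      (+-nonneg (square-nonneg (x ℚ.- x′)) (square-nonneg (y ℚ.- y′)))))
  (solve 5 (λ t x y x′ y′ →
    let a = (con 1ℚ :- t) :* x :+ t :* x′ ; b = (con 1ℚ :- t) :* y :+ t :* y′ in
    con 1ℚ :- (a :* a :+ b :* b) :=
    ((con 1ℚ :- t) :* (con 1ℚ :- (x :* x :+ y :* y)) :+ t :* (con 1ℚ :- (x′ :* x′ :+ y′ :* y′)))
    :+ (t :* (con 1ℚ :- t)) :* ((x :- x′) :* (x :- x′) :+ (y :- y′) :* (y :- y′)))
    refl t x y x′ y′)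
  where
  0≤1-t : 0ℚ ℚ.≤ 1ℚ ℚ.- t
  0≤1-t = p≤q⇒0≤q-p t≤1

2ℚ : ℚ
2ℚ = 1ℚ ℚ.+ 1ℚ

-- The certificate is `2 (1 - x) = (1 - x² - y²) + y² + (x -
-- 1)²` together with its mirror image for `1 + x′`.
disk-width : ∀ x y x′ y′ → InDisk x y → InDisk x′ y′ → x ℚ.- x′ ℚ.≤ 2ℚ
disk-width x y x′ y′ d d′ = 0≤q-p⇒p≤q
  (*-nonneg {½} (ℚ.nonNegative⁻¹ ½) (+-nonneg
    (+-nonneg (+-nonneg (p≤q⇒0≤q-p d) (square-nonneg y)) (square-nonneg (x ℚ.- 1ℚ)))
    (+-nonneg (+-nonneg (p≤q⇒0≤q-p d′) (square-nonneg y′)) (square-nonneg (x′ ℚ.+ 1ℚ)))))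
  (solve 4 (λ x y x′ y′ →
    (con 1ℚ :+ con 1ℚ) :- (x :- x′) :=
    con ½ :* ((((con 1ℚ :- (x :* x :+ y :* y)) :+ y :* y) :+ (x :- con 1ℚ) :* (x :- con 1ℚ)) :+
    (((con 1ℚ :- (x′ :* x′ :+ y′ :* y′)) :+ y′ :* y′) :+ (x′ :+ con 1ℚ) :* (x′ :+ con 1ℚ))))
    refl x y x′ y′)

swap-disk : ∀ x y → InDisk x y → InDisk y x
swap-disk x y = subst (ℚ._≤ 1ℚ) (ℚ.+-comm (x ℚ.* x) (y ℚ.* y))

mix-close : ∀ {t τ s} p p′ → 0ℚ ℚ.≤ τ → τ ℚ.* 2ℚ ℚ.< s → p ℚ.- p′ ℚ.≤ 2ℚ → p′ ℚ.- p ℚ.≤ 2ℚ →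
            ℚ.∣ mix t p p′ ℚ.- mix (τ ℚ.+ t) p p′ ∣ ℚ.< s
mix-close {t} {τ} {s} p p′ 0≤τ small w w′ = ∣p-q∣<r (mix t p p′) (mix (τ ℚ.+ t) p p′)
  (0<q-p⇒p<q (ℚ.+-mono-<-≤ (p<q⇒0<q-p small) (*-nonneg 0≤τ (p≤q⇒0≤q-p w)))
    (solve 5 (λ t τ s p p′ →
      (((con 1ℚ :- (τ :+ t)) :* p :+ (τ :+ t) :* p′) :+ s) :- ((con 1ℚ :- t) :* p :+ t :* p′) :=
      (s :- τ :* (con 1ℚ :+ con 1ℚ)) :+ τ :* ((con 1ℚ :+ con 1ℚ) :- (p :- p′))) refl t τ s p p′))
  (0<q-p⇒p<q (ℚ.+-mono-<-≤ (p<q⇒0<q-p small) (*-nonneg 0≤τ (p≤q⇒0≤q-p w′)))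
    (solve 5 (λ t τ s p p′ →
      (((con 1ℚ :- t) :* p :+ t :* p′) :+ s) :- ((con 1ℚ :- (τ :+ t)) :* p :+ (τ :+ t) :* p′) :=
      (s :- τ :* (con 1ℚ :+ con 1ℚ)) :+ τ :* ((con 1ℚ :+ con 1ℚ) :- (p′ :- p))) refl t τ s p p′))

mix₀ : ∀ p p′ → mix 0ℚ p p′ ≡ p
mix₀ = solve 2 (λ p p′ → (con 1ℚ :- con 0ℚ) :* p :+ con 0ℚ :* p′ := p) refl

mix₁ : ∀ p p′ → mix 1ℚ p p′ ≡ p′
mix₁ = solve 2 (λ p p′ → (con 1ℚ :- con 1ℚ) :* p :+ con 1ℚ :* p′ := p′) refl

mix-idem : ∀ t p → mix t p p ≡ p
mix-idem = solve 2 (λ t p → (con 1ℚ :- t) :* p :+ t :* p := p) refl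

fine-subdivision : ∀ {s} → 0ℚ ℚ.< s → ∃₂ λ M τ →
  0ℚ ℚ.< τ × τ ℚ.* 2ℚ ℚ.< s × fromℕ (suc M) ℚ.* τ ≡ 1ℚ
fine-subdivision {s} 0<s = M , τ , 0<τ , 2τ<s , Mτ≡1
  where
  -- A quarter of `s`: `τ ≤ q` gives `2 τ ≤ s / 2`, and the other half of `s` makes the inequality
  -- strict.
  q = ½ ℚ.* (½ ℚ.* s)
  0<q : 0ℚ ℚ.< q
  0<q = half-pos (half-pos 0<s)
  M = proj₁ (archimedean 0<q)
  τ = proj₁ (reciprocal M)
  0<τ = proj₁ (proj₂ (reciprocal M))
  Mτ≡1 = proj₂ (proj₂ (reciprocal M))
  τ≤q : τ ℚ.≤ q
  τ≤q = 0≤q-p⇒p≤q (*-nonneg (ℚ.<⇒≤ 0<τ) (p≤q⇒0≤q-p (proj₂ (archimedean 0<q))))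
    (sym (trans (solve 3 (λ τ n q → τ :* (n :* q :- con 1ℚ) := (n :* τ) :* q :- τ) refl τ
      (fromℕ (suc M)) q)
      (cong (ℚ._- τ) (trans (cong (ℚ._* q) Mτ≡1) (ℚ.*-identityˡ q)))))
  2τ<s : τ ℚ.* 2ℚ ℚ.< s
  2τ<s = 0<q-p⇒p<q (ℚ.+-mono-<-≤ (half-pos 0<s)
    (*-nonneg {2ℚ} (ℚ.nonNegative⁻¹ 2ℚ) (p≤q⇒0≤q-p τ≤q)))
    (solve 2 (λ τ s → s :- τ :* (con 1ℚ :+ con 1ℚ) := con ½ :* s :+ (con 1ℚ :+ con 1ℚ) :*
      (con ½ :* (con ½ :* s) :- τ)) refl τ s)

-- A discrete substitute for the connectedness of a segment: `Holds` is carried along points so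
-- close together that `step` applies to neighbours, all of them in the disk by convexity.
segment-walk : ∀ {s} → 0ℚ ℚ.< s → (Holds Free : ℚ × ℚ → Set) →
  (∀ z z′ → ClosedDisk z → Within s z z′ → Free z → Holds z → Holds z′) →
  ∀ {x y x′ y′} → InDisk x y → InDisk x′ y′ →
  (∀ t → Free (mix t x x′ , mix t y y′)) →
  Holds (x , y) → Holds (x′ , y′)
segment-walk {s} 0<s Holds Free step {x} {y} {x′} {y′} d d′ free h =
  subst Holds (cong₂ _,_ (trans (cong (λ t → mix t x x′) Mτ≡1) (mix₁ x x′))
                         (trans (cong (λ t → mix t y y′) Mτ≡1) (mix₁ y y′)))
    (reach (suc M) ℕ.≤-refl)
  where
  M = proj₁ (fine-subdivision 0<s)
  τ = proj₁ (proj₂ (fine-subdivision 0<s))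
  0<τ = proj₁ (proj₂ (proj₂ (fine-subdivision 0<s)))
  2τ<s = proj₁ (proj₂ (proj₂ (proj₂ (fine-subdivision 0<s))))
  Mτ≡1 = proj₂ (proj₂ (proj₂ (proj₂ (fine-subdivision 0<s))))
  0≤τ = ℚ.<⇒≤ 0<τ
  at : ℚ → ℚ × ℚ
  at t = mix t x x′ , mix t y y′
  reach : ∀ k → k ℕ.≤ suc M → Holds (at (fromℕ k ℚ.* τ))
  reach zero _ = subst Holds (sym (cong₂ _,_
    (trans (cong (λ t → mix t x x′) (ℚ.*-zeroˡ τ)) (mix₀ x x′))
    (trans (cong (λ t → mix t y y′) (ℚ.*-zeroˡ τ)) (mix₀ y y′)))) h
  reach (suc k) k<M = step (at t) (at (fromℕ (suc k) ℚ.* τ)) (disk-convex 0≤t t≤1 d d′)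
    (subst (λ t′ → Within s (at t) (at t′))
      (solve 2 (λ τ k → τ :+ k :* τ := (con 1ℚ :+ k) :* τ) refl τ (fromℕ k))
      (mix-close {t} x x′ 0≤τ 2τ<s (disk-width x y x′ y′ d d′) (disk-width x′ y′ x y d′ d) ,
       mix-close {t} y y′ 0≤τ 2τ<s
         (disk-width y x y′ x′ (swap-disk x y d) (swap-disk x′ y′ d′))
         (disk-width y′ x′ y x (swap-disk x′ y′ d′) (swap-disk x y d))))
    (free t) (reach k (ℕ.<⇒≤ k<M))
    where
    t = fromℕ k ℚ.* τ
    0≤t : 0ℚ ℚ.≤ t
    0≤t = *-nonneg (fromℕ-mono {zero} {k} ℕ.z≤n) 0≤τ
    t≤1 : t ℚ.≤ 1ℚ
    t≤1 = subst (t ℚ.≤_) Mτ≡1 (ℚ.*-monoʳ-≤-nonNeg τ {{ℚ.nonNegative 0≤τ}} (fromℕ-mono (ℕ.<⇒≤ k<M)))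

-- Each obstacle blocks at most one of the points c + m η.
avoid : ∀ (L : List ℚ) c {η} → 0ℚ ℚ.< η →
        ∃[ m ] (m ℕ.≤ List.length L × All (λ F → ¬ ℚ.∣ (c ℚ.+ fromℕ m ℚ.* η) ℚ.- F ∣ ℚ.< ½ ℚ.* η) L)
avoid L c {η} 0<η with Fin.any?
  (λ (m : Fin (suc (List.length L))) → All.all? (λ F → ¬? (blocked? m F)) L)
  where
  blocked? : ∀ (m : Fin (suc (List.length L))) F →
    Dec (ℚ.∣ (c ℚ.+ fromℕ (toℕ m) ℚ.* η) ℚ.- F ∣ ℚ.< ½ ℚ.* η)
  blocked? m F = ℚ.∣ (c ℚ.+ fromℕ (toℕ m) ℚ.* η) ℚ.- F ∣ ℚ.<? ½ ℚ.* η
... | yes (m , free) = toℕ m , ℕ.s≤s⁻¹ (Fin.toℕ<n m) , free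
... | no none = contradiction
        (subst (λ F → ℚ.∣ point m′ ℚ.- F ∣ ℚ.< ½ ℚ.* η) (sym (cong (List.lookup L) same))
          (Any.lookup-index (hit m′)))
        (λ lt → apart (subst (ℚ.∣ point m ℚ.- point m′ ∣ ℚ.<_) (halves η)
          (∣-∣-triangle (point m) F (point m′) (Any.lookup-index (hit m))
            (subst (ℚ._< ½ ℚ.* η) (∣p-q∣≡∣q-p∣ (point m′) F) lt))))
  where
  point : Fin (suc (List.length L)) → ℚ
  point m = c ℚ.+ fromℕ (toℕ m) ℚ.* η
  hit : ∀ m → Any (λ F → ℚ.∣ point m ℚ.- F ∣ ℚ.< ½ ℚ.* η) L
  hit m = Any.map (λ {F} → decidable-stable (ℚ.∣ point m ℚ.- F ∣ ℚ.<? ½ ℚ.* η))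
    (All.¬All⇒Any¬ (λ F → ¬? (ℚ.∣ point m ℚ.- F ∣ ℚ.<? ½ ℚ.* η)) L (λ free → none (m , free)))
  collision = Fin.pigeonhole ℕ.≤-refl (λ m → Any.index (hit m))
  m = proj₁ collision
  m′ = proj₁ (proj₂ collision)
  m<m′ = proj₁ (proj₂ (proj₂ collision))
  same = proj₂ (proj₂ (proj₂ collision))
  F = List.lookup L (Any.index (hit m))
  apart : ¬ ℚ.∣ point m ℚ.- point m′ ∣ ℚ.< η
  apart lt = ℚ.<-irrefl refl (ℚ.<-≤-trans (∣p-q∣<r⇒q<p+r (point m) (point m′) lt)
    (0≤q-p⇒p≤q (*-nonneg (p≤q⇒0≤q-p (fromℕ-mono m<m′)) (ℚ.<⇒≤ 0<η))
      (solve 4 (λ c m m′ η → (c :+ m′ :* η) :- ((c :+ m :* η) :+ η) := (m′ :- (con 1ℚ :+ m)) :* η)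
        refl c (fromℕ (toℕ m)) (fromℕ (toℕ m′)) η)))

-- Connectivity of quadriculated disks

-- `χ` will be the indicator of a component under adjacency through edges. The aim is to show that
-- it is constant.
module Coloured (𝒟 : QuadriculatedDisk) (χ : Fin (QuadriculatedDisk.size 𝒟) → Bool)
  (χ-adjacent : ∀ {i j} → Adjacent (QuadriculatedDisk.cell 𝒟 i) (QuadriculatedDisk.cell 𝒟 j) →
                χ i ≡ χ j) where
  open QuadriculatedDisk 𝒟
  open Homeomorphic disk
  open Point

  Union : ℚ × ℚ → Set
  Union z = ∃[ i ] UnitSquare (cell i) z

  constant : ∀ {X : ℚ × ℚ → Set} z → X z → Point X
  constant z z∈X = record
    { approx = λ _ → z ; inside = λ _ → z∈X
    ; cauchy = λ r 0<r → 0 , λ _ _ _ _ → zero< r 0<r (proj₁ z) , zero< r 0<r (proj₂ z) }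
    where
    zero< : ∀ r → 0ℚ ℚ.< r → ∀ x → ℚ.∣ x ℚ.- x ∣ ℚ.< r
    zero< r 0<r x = subst (λ y → ℚ.∣ y ∣ ℚ.< r) (sym (ℚ.+-inverseʳ x)) 0<r

  Within-trans : ∀ {r s} x y z → Within r x y → Within s y z → Within (r ℚ.+ s) x z
  Within-trans (x , x′) (y , y′) (z , z′) (p , p′) (q , q′) =
    ∣-∣-triangle x y z p q , ∣-∣-triangle x′ y′ z′ p′ q′

  Within-sym : ∀ {r} x y → Within r x y → Within r y x
  Within-sym (x , x′) (y , y′) (p , p′) =
    subst (ℚ._< _) (∣p-q∣≡∣q-p∣ x y) p , subst (ℚ._< _) (∣p-q∣≡∣q-p∣ x′ y′) p′

  Within-mono : ∀ {r s} x y → r ℚ.≤ s → Within r x y → Within s x y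
  Within-mono _ _ r≤s (p , q) = ℚ.<-≤-trans p r≤s , ℚ.<-≤-trans q r≤s

  Corner : Set
  Corner = Fin size × Bool × Bool

  corner : Corner → ℚ × ℚ
  corner (i , ι , ι′) = fromℤ (shifted (proj₁ (cell i)) ι) , fromℤ (shifted (proj₂ (cell i)) ι′)

  shifted-in-unit : ∀ a ι → InUnit a (fromℤ (shifted a ι))
  shifted-in-unit a false = ℚ.≤-refl , fromℤ-mono-≤ (ℤ.i≤suc[i] a)
  shifted-in-unit a true  = fromℤ-mono-≤ (ℤ.i≤suc[i] a) , ℚ.≤-refl

  cornerPoint : Corner → Point Union
  cornerPoint v@(i , ι , ι′) = constant (corner v)
    (i , shifted-in-unit (proj₁ (cell i)) ι , shifted-in-unit (proj₂ (cell i)) ι′)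

  corners : List Corner
  corners = List.cartesianProduct (List.allFin size) (List.cartesianProduct bools bools)
    where bools = true ∷ false ∷ []

  ∈-corners : ∀ v → v List.∈ corners
  ∈-corners (i , ι , ι′) =
    List.∈-cartesianProduct⁺ (List.∈-allFin i) (List.∈-cartesianProduct⁺ (∈-bools ι) (∈-bools ι′))
    where
    ∈-bools : ∀ ι → ι List.∈ (true ∷ false ∷ [])
    ∈-bools true  = here refl
    ∈-bools false = there (here refl)

  -- Squares without a common edge come close to each other only at a corner.
  colour-jump : ∀ {r z z′ i j} → UnitSquare (cell i) z → UnitSquare (cell j) z′ → r ℚ.≤ 1ℚ →
                Within r z z′ → χ i ≡ χ j ⊎ ∃[ v ] Within r z (corner v)
  colour-jump {r} {x , y} {x′ , y′} {i} {j} (inx , iny) (inx′ , iny′) r≤1 (near , near′)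
    with units-touch {x = x} {x′} {r} inx inx′ r≤1 near | units-touch {x = y} {y′} {r} iny iny′ r≤1
      near′
  ... | inj₁ eq | inj₁ eq′ = inj₁ (cong χ (distinct (cong₂ _,_ eq eq′)))
  ... | inj₁ eq | inj₂ (one , _) = inj₁ (χ-adjacent (inj₂ (eq , one)))
  ... | inj₂ (one , _) | inj₁ eq = inj₁ (χ-adjacent (inj₁ (one , eq)))
  ... | inj₂ (_ , ι , close) | inj₂ (_ , ι′ , close′) = inj₂ ((i , ι , ι′) , close , close′)

  colourOf : Point Union → ℕ → Bool
  colourOf x k = χ (proj₁ (inside x k))

  diskPoint : ∀ z → ClosedDisk z → Point ClosedDisk
  diskPoint = constant

  -- The squares chosen for the approximations of the preimage may keep changing, so only their
  -- colour is asked to settle. Quantifying over `d` makes this a property of `z` alone.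
  HasColour : Bool → ℚ × ℚ → Set
  HasColour β z = ∀ d → ∃[ N ] (∀ k → N ℕ.≤ k → colourOf (from (diskPoint z d)) k ≡ β)

  centre : ∀ i → Point Union
  centre i = constant (fromℤ (proj₁ (cell i)) ℚ.+ ½ , fromℤ (proj₂ (cell i)) ℚ.+ ½)
    (i , midpoint (proj₁ (cell i)) , midpoint (proj₂ (cell i)))
    where
    midpoint : ∀ a → InUnit a (fromℤ a ℚ.+ ½)
    midpoint a =
      0≤q-p⇒p≤q {s = ½} (ℚ.nonNegative⁻¹ ½)
        (solve 1 (λ a → (a :+ con ½) :- a := con ½) refl (fromℤ a)) ,
      subst (fromℤ a ℚ.+ ½ ℚ.≤_) (sym (fromℤ-suc a)) (0≤q-p⇒p≤q {s = ½} (ℚ.nonNegative⁻¹ ½)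
        (solve 1 (λ a → (con 1ℚ :+ a) :- (a :+ con ½) := con ½) refl (fromℤ a)))

  -- Two errors of 1/4, one from the continuity of `from` and one from `from∘to`, leave the preimage
  -- within 1/2 of the centre, where the only square is `i`.
  coloured-near-centre : ∀ i → ∃[ s ] (0ℚ ℚ.< s × (∀ z (d : ClosedDisk z) →
    Near s (diskPoint z d) (to (centre i)) → HasColour (χ i) z))
  coloured-near-centre i = s , 0<s , λ z d near d′ →
    let x = from (diskPoint z d′)
        y = from (to (centre i))
        (N₁ , near₁) = continuous (diskPoint z d′) (to (centre i)) near
        (N₂ , near₂) = from∘to (centre i) (½ ℚ.* ½) (half-pos (ℚ.positive⁻¹ ½))
    in N₁ ⊔ N₂ , λ k le →
      let (close , close′) = Within-sym (approx x k) (approx (centre i) k)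
            (Within-trans (approx x k) (approx y k) (approx (centre i) k)
              (near₁ k (ℕ.≤-trans (ℕ.m≤m⊔n N₁ N₂) le)) (near₂ k (ℕ.≤-trans (ℕ.m≤n⊔m N₁ N₂) le)))
          (_ , inx , iny) = inside x k
      in cong χ (distinct (cong₂ _,_
        (near-midpoint {proj₁ (cell i)} {x = proj₁ (approx x k)} inx close)
        (near-midpoint {proj₂ (cell i)} {x = proj₂ (approx x k)} iny close′)))
    where
    modulus = from-continuous (½ ℚ.* ½) (half-pos (ℚ.positive⁻¹ ½))
    s = proj₁ modulus
    0<s = proj₁ (proj₂ modulus)
    continuous = proj₂ (proj₂ modulus)

  module Obstacles {δ} (0<δ : 0ℚ ℚ.< δ) where

    settled : Corner → ℕ
    settled v = proj₁ (cauchy (to (cornerPoint v)) δ 0<δ)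

    obstacle : Corner → ℚ × ℚ
    obstacle v = approx (to (cornerPoint v)) (settled v)

    -- One `δ` each for coming back from `to (from z)` to `z`, for the continuity of `to` at the
    -- corner, and for replacing the image of the corner by a rational approximation.
    3δ : ℚ
    3δ = δ ℚ.+ (δ ℚ.+ δ)

    Free : ℚ × ℚ → Set
    Free z = ∀ v → ¬ Within 3δ z (obstacle v)

    -- If the colour changed, the preimages of `z` and `z′` would be close to each other in squares
    -- without a common edge, hence close to a corner; applying `to` would put `z` within `3δ` of
    -- the obstacle of that corner.
    uniform-step : ∀ {s₁ r s} → 0ℚ ℚ.< s₁ → r ℚ.≤ ½ ℚ.* s₁ → r ℚ.≤ 1ℚ →
      (∀ x x′ → Near s₁ x x′ → Near δ (to x) (to x′)) →
      (∀ x x′ → Near s x x′ → Near r (from x) (from x′)) →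
      ∀ β z z′ → ClosedDisk z → Within s z z′ → Free z → HasColour β z → HasColour β z′
    uniform-step {s₁} {r} {s} 0<s₁ r≤½s₁ r≤1 to-uniform from-uniform β z z′ d near free col d′ =
      settle (col d) (from-uniform (diskPoint z d) (diskPoint z′ d′) (0 , λ _ _ → near))
        (cauchy x (½ ℚ.* s₁) (half-pos 0<s₁))
      where
      x = from (diskPoint z d)
      x′ = from (diskPoint z′ d′)
      settle : ∃[ N ] (∀ k → N ℕ.≤ k → colourOf x k ≡ β) → Near r x x′ →
        ∃[ N ] (∀ k m → N ℕ.≤ k → N ℕ.≤ m → Within (½ ℚ.* s₁) (approx x k) (approx x m)) →
        ∃[ N ] (∀ k → N ℕ.≤ k → colourOf x′ k ≡ β)
      settle (N₁ , coloured) (N₂ , close) (N₃ , cauchy-x) = N₁ ⊔ (N₂ ⊔ N₃) , same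
        where
        same : ∀ k → N₁ ⊔ (N₂ ⊔ N₃) ℕ.≤ k → colourOf x′ k ≡ β
        same k N≤k with colour-jump {r} {approx x k} {approx x′ k} (proj₂ (inside x k))
          (proj₂ (inside x′ k))
                          r≤1 (close k (ℕ.≤-trans (ℕ.≤-trans (ℕ.m≤m⊔n N₂ N₃) (ℕ.m≤n⊔m N₁ _)) N≤k))
        ... | inj₁ eq = trans (sym eq) (coloured k (ℕ.≤-trans (ℕ.m≤m⊔n N₁ _) N≤k))
        ... | inj₂ (v , at) = contradiction
            (collide (to-uniform x (cornerPoint v) near-corner) (to∘from (diskPoint z d) δ 0<δ))
              (free v)
          where
          -- Closeness to the corner is known at the index `k` only. The Cauchy property carries it
          -- to all later indices at the cost of the other half of `s₁`.
          near-corner : Near s₁ x (cornerPoint v)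
          near-corner = N₃ , λ m le → subst (λ t → Within t (approx x m) (corner v)) (halves s₁)
            (Within-trans (approx x m) (approx x k) (corner v)
              (cauchy-x m k le (ℕ.≤-trans (ℕ.≤-trans (ℕ.m≤n⊔m N₂ N₃) (ℕ.m≤n⊔m N₁ _)) N≤k))
              (Within-mono (approx x k) (corner v) r≤½s₁ at))
          collide : Near δ (to x) (to (cornerPoint v)) → Near δ (to x) (diskPoint z d) →
                    Within 3δ z (obstacle v)
          collide (M₁ , images) (M₂ , back) = Within-trans z (approx (to x) m) (obstacle v)
            (Within-sym (approx (to x) m) z (back m
              (ℕ.≤-trans (ℕ.m≤m⊔n M₂ _) (ℕ.m≤n⊔m M₁ _))))
            (Within-trans (approx (to x) m) (approx (to (cornerPoint v)) m) (obstacle v)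
              (images m (ℕ.m≤m⊔n M₁ _))
              (proj₂ (cauchy (to (cornerPoint v)) δ 0<δ) m (settled v)
                (ℕ.≤-trans (ℕ.m≤n⊔m M₂ _) (ℕ.m≤n⊔m M₁ _)) ℕ.≤-refl))
            where m = M₁ ⊔ (M₂ ⊔ settled v)

    colour-step : ∃[ s ] (0ℚ ℚ.< s × (∀ β z z′ → ClosedDisk z → Within s z z′ → Free z →
                  HasColour β z → HasColour β z′))
    colour-step =
      let (s₁ , 0<s₁ , to-uniform) = to-continuous δ 0<δ
          (r , 0<r , r≤½s₁ , r≤1) = minimum (half-pos 0<s₁) (ℚ.positive⁻¹ 1ℚ)
          (s , 0<s , from-uniform) = from-continuous r 0<r
      in s , 0<s , uniform-step {s₁} {r} {s} 0<s₁ r≤½s₁ r≤1 to-uniform from-uniform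

-- Chords that avoid the images of the corners

module Chords (𝒟 : QuadriculatedDisk) (χ : Fin (QuadriculatedDisk.size 𝒟) → Bool)
  (χ-adjacent : ∀ {i j} → Adjacent (QuadriculatedDisk.cell 𝒟 i) (QuadriculatedDisk.cell 𝒟 j) →
                χ i ≡ χ j) where
  open QuadriculatedDisk 𝒟
  open Homeomorphic disk
  open Point
  open Coloured 𝒟 χ χ-adjacent

  square≤¼ : ∀ {u} → 0ℚ ℚ.≤ u → u ℚ.≤ ½ → 0ℚ ℚ.≤ ½ ℚ.* ½ ℚ.- u ℚ.* u
  square≤¼ {u} 0≤u u≤½ = subst (0ℚ ℚ.≤_)
    (solve 1 (λ u → (con ½ :- u) :* (con ½ :+ u) := con ½ :* con ½ :- u :* u) refl u)
    (*-nonneg (p≤q⇒0≤q-p u≤½) (+-nonneg (ℚ.nonNegative⁻¹ ½) 0≤u))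

  in-disk : ∀ {u w} → 0ℚ ℚ.≤ u → u ℚ.≤ ½ → 0ℚ ℚ.≤ w → w ℚ.≤ ½ → InDisk u w
  in-disk {u} {w} 0≤u u≤½ 0≤w w≤½ = 0≤q-p⇒p≤q
    (+-nonneg (ℚ.nonNegative⁻¹ ½) (+-nonneg (square≤¼ 0≤u u≤½) (square≤¼ 0≤w w≤½)))
    (solve 2 (λ u w → con 1ℚ :- (u :* u :+ w :* w) :=
      con ½ :+ ((con ½ :* con ½ :- u :* u) :+ (con ½ :* con ½ :- w :* w))) refl u w)

  -- `s` bounds how far a point may be moved without losing its colour, `t` is the size of the
  -- perturbation, `τ` governs the spacing of the candidate chords, `3δ` is half of that spacing,
  -- and `σ` is the step length of a walk.
  module _ {s t τ δ σ} (0<s : 0ℚ ℚ.< s) (0<t : 0ℚ ℚ.< t) (t≤1 : t ℚ.≤ 1ℚ)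
    (2t<½s : t ℚ.* 2ℚ ℚ.< ½ ℚ.* s)
    (0<τ : 0ℚ ℚ.< τ) (Kτ≡1 : fromℕ (suc (List.length corners)) ℚ.* τ ≡ 1ℚ)
    (0<δ : 0ℚ ℚ.< δ) (3δ≡ : δ ℚ.+ (δ ℚ.+ δ) ≡ ½ ℚ.* (t ℚ.* (½ ℚ.* τ)))
    (0<σ : 0ℚ ℚ.< σ)
    (step : ∀ β z z′ → ClosedDisk z → Within σ z z′ → Obstacles.Free 0<δ z →
            HasColour β z → HasColour β z′)
    where
    open Obstacles 0<δ

    0≤t : 0ℚ ℚ.≤ t
    0≤t = ℚ.<⇒≤ 0<t

    -- `Within` asks for closeness in both coordinates, so missing every obstacle in one coordinate
    -- keeps a whole axis-parallel chord free.
    Clear : (ℚ × ℚ → ℚ) → ℚ → Set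
    Clear coordinate c = ∀ v → ¬ ℚ.∣ c ℚ.- coordinate (obstacle v) ∣ ℚ.< 3δ

    -- The values `u = m τ / 2` stay in `[0 , 1/2]` because `τ` is the reciprocal of one more than
    -- the number of corners. Mixing turns them into candidates spaced by `t τ / 2`, among which
    -- `avoid` finds a clear one.
    clear-line : ∀ (coordinate : ℚ × ℚ → ℚ) p →
                 ∃[ u ] (0ℚ ℚ.≤ u × u ℚ.≤ ½ × Clear coordinate (mix t p u))
    clear-line coordinate p = let (m , m≤ , clear) = avoid obstacles ((1ℚ ℚ.- t) ℚ.* p) 0<η in
      fromℕ m ℚ.* (½ ℚ.* τ) ,
      *-nonneg (fromℕ-mono {0} {m} ℕ.z≤n) 0≤½τ ,
      bounded m (ℕ.m≤n⇒m≤1+n (subst (m ℕ.≤_) (List.length-map _ corners) m≤)) ,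
      λ v lt → All.lookup (All.map⁻ clear) (∈-corners v)
        (subst₂ (λ x y → ℚ.∣ x ℚ.- coordinate (obstacle v) ∣ ℚ.< y)
          (solve 4 (λ t p m h →
            (con 1ℚ :- t) :* p :+ t :* (m :* h) := (con 1ℚ :- t) :* p :+ m :* (t :* h))
            refl t p (fromℕ m) (½ ℚ.* τ)) 3δ≡ lt)
      where
      obstacles = List.map (λ v → coordinate (obstacle v)) corners
      0≤½τ : 0ℚ ℚ.≤ ½ ℚ.* τ
      0≤½τ = ℚ.<⇒≤ (half-pos 0<τ)
      0<η : 0ℚ ℚ.< t ℚ.* (½ ℚ.* τ)
      0<η = *-pos 0<t (half-pos 0<τ)
      bounded : ∀ m → m ℕ.≤ suc (List.length corners) → fromℕ m ℚ.* (½ ℚ.* τ) ℚ.≤ ½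
      bounded m m≤K = 0≤q-p⇒p≤q (*-nonneg 0≤½τ (p≤q⇒0≤q-p (fromℕ-mono m≤K)))
        (trans (cong (λ z → ½ ℚ.* z ℚ.- fromℕ m ℚ.* (½ ℚ.* τ)) (sym Kτ≡1))
          (solve 3 (λ τ n m → con ½ :* (n :* τ) :- m :* (con ½ :* τ) := (con ½ :* τ) :* (n :- m))
            refl τ (fromℕ (suc (List.length corners))) (fromℕ m)))

    walk : ∀ β {x y x′ y′} → InDisk x y → InDisk x′ y′ → (∀ t → Free (mix t x x′ , mix t y y′)) →
           HasColour β (x , y) → HasColour β (x′ , y′)
    walk β = segment-walk 0<σ (HasColour β) Free (step β)

    vertical-walk : ∀ β {x y y′} → InDisk x y → InDisk x y′ → Clear proj₁ x →
                    HasColour β (x , y) → HasColour β (x , y′)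
    vertical-walk β {x} d d′ clear = walk β d d′
      (λ λ′ v within → clear v
        (subst (λ x → ℚ.∣ x ℚ.- proj₁ (obstacle v) ∣ ℚ.< 3δ) (mix-idem λ′ x) (proj₁ within)))

    horizontal-walk : ∀ β {x x′ y} → InDisk x y → InDisk x′ y → Clear proj₂ y →
                      HasColour β (x , y) → HasColour β (x′ , y)
    horizontal-walk β {y = y} d d′ clear = walk β d d′
      (λ λ′ v within → clear v
        (subst (λ y → ℚ.∣ y ℚ.- proj₂ (obstacle v) ∣ ℚ.< 3δ) (mix-idem λ′ y) (proj₂ within)))

    moved : ∀ p p′ → p ℚ.- p′ ℚ.≤ 2ℚ → p′ ℚ.- p ℚ.≤ 2ℚ → ℚ.∣ mix t p p′ ℚ.- p ∣ ℚ.< ½ ℚ.* s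
    moved p p′ le le′ = subst (ℚ._< ½ ℚ.* s) (∣p-q∣≡∣q-p∣ p (mix t p p′))
      (subst₂ (λ x y → ℚ.∣ x ℚ.- y ∣ ℚ.< ½ ℚ.* s) (mix₀ p p′)
        (cong (λ t → mix t p p′) (ℚ.+-identityʳ t))
        (mix-close {0ℚ} {t} p p′ 0≤t 2t<½s le le′))

    -- An approximation P of y is replaced by (1 - t) P + t (u , 0), which stays in
    -- the disk by convexity, and u ∈ [0 , 1/2] makes its vertical chord clear.
    reach-chord : ∀ {β s′ w} (y : Point ClosedDisk) → s ℚ.≤ s′ →
      (∀ z (d : ClosedDisk z) → Near s′ (diskPoint z d) y → HasColour β z) →
      0ℚ ℚ.≤ w → w ℚ.≤ ½ → let b = mix t 0ℚ w in ∃[ a ] (InDisk a b × HasColour β (a , b))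
    reach-chord {β} {s′} {w} y s≤s′ coloured 0≤w w≤½ =
      let (N , settled-y) = cauchy y (½ ℚ.* s) (half-pos 0<s)
          (u , 0≤u , u≤½ , clear) = clear-line proj₁ (proj₁ (approx y N))
      in along N settled-y (proj₁ (approx y N)) (proj₂ (approx y N)) refl
        (inside y N) u 0≤u u≤½ clear
      where
      b = mix t 0ℚ w
      along : ∀ N → (∀ k m → N ℕ.≤ k → N ℕ.≤ m → Within (½ ℚ.* s) (approx y k) (approx y m)) →
        ∀ px py → (px , py) ≡ approx y N → InDisk px py → ∀ u → 0ℚ ℚ.≤ u → u ℚ.≤ ½ →
          Clear proj₁ (mix t px u) →
        ∃[ a ] (InDisk a b × HasColour β (a , b))
      along N settled-y px py eq P∈ u 0≤u u≤½ clear =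
        c , on-chord , vertical-walk β start on-chord clear
          (coloured (c , mix t py 0ℚ) start near-y)
        where
        c = mix t px u
        U∈ : InDisk u 0ℚ
        U∈ = in-disk 0≤u u≤½ ℚ.≤-refl (ℚ.nonNegative⁻¹ ½)
        start : InDisk c (mix t py 0ℚ)
        start = disk-convex {t} {px} {py} {u} {0ℚ} 0≤t t≤1 P∈ U∈
        px∈ : InDisk px 0ℚ
        px∈ = 0≤q-p⇒p≤q (+-nonneg (p≤q⇒0≤q-p P∈) (square-nonneg py))
          (solve 2 (λ x y → con 1ℚ :- (x :* x :+ con 0ℚ :* con 0ℚ) :=
            (con 1ℚ :- (x :* x :+ y :* y)) :+ y :* y) refl px py)
        -- The vertical line at `c` reaches the height `b` at a mixture of `(px , 0)` and `(u , w)`,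
        -- so that point is in the disk as well.
        on-chord : InDisk c b
        on-chord = disk-convex {t} {px} {0ℚ} {u} {w} 0≤t t≤1 px∈ (in-disk 0≤u u≤½ 0≤w w≤½)
        near-y : Near s′ (diskPoint (c , mix t py 0ℚ) start) y
        near-y = N , λ m N≤m → Within-mono (c , mix t py 0ℚ) (approx y m) s≤s′
          (subst (λ r → Within r (c , mix t py 0ℚ) (approx y m)) (halves s)
            (Within-trans (c , mix t py 0ℚ) (px , py) (approx y m)
              (moved px u (disk-width px py u 0ℚ P∈ U∈) (disk-width u 0ℚ px py U∈ P∈) ,
               moved py 0ℚ (disk-width py px 0ℚ u (swap-disk px py P∈) (swap-disk u 0ℚ U∈))
                 (disk-width 0ℚ u py px (swap-disk u 0ℚ U∈) (swap-disk px py P∈)))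
              (subst (λ P → Within (½ ℚ.* s) P (approx y m)) (sym eq)
                (settled-y N m ℕ.≤-refl N≤m))))

    -- Both points reach the same clear horizontal chord along vertical ones; a walk on it brings
    -- the two colours to a single point, where they agree at a late index.
    same-colour : ∀ {β β′ s₁ s₂} (y y′ : Point ClosedDisk) → s ℚ.≤ s₁ → s ℚ.≤ s₂ →
      (∀ z (d : ClosedDisk z) → Near s₁ (diskPoint z d) y → HasColour β z) →
      (∀ z (d : ClosedDisk z) → Near s₂ (diskPoint z d) y′ → HasColour β′ z) → β ≡ β′
    same-colour {β} y y′ s≤s₁ s≤s₂ near near′ =
      let (w , 0≤w , w≤½ , clear) = clear-line proj₂ 0ℚ
          (a , ab∈ , coloured) = reach-chord y s≤s₁ near 0≤w w≤½
          (a′ , a′b∈ , coloured′) = reach-chord y′ s≤s₂ near′ 0≤w w≤½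
          (N , eq) = horizontal-walk β {a} {a′} {mix t 0ℚ w} ab∈ a′b∈ clear coloured a′b∈
          (N′ , eq′) = coloured′ a′b∈
      in trans (sym (eq (N ⊔ N′) (ℕ.m≤m⊔n N N′))) (eq′ (N ⊔ N′) (ℕ.m≤n⊔m N N′))

  ⅓ : ℚ
  ⅓ = + 1 ℚ./ 3

  constant-colour : ∀ i j → χ i ≡ χ j
  constant-colour i j =
    let (s₁ , 0<s₁ , near₁) = coloured-near-centre i
        (s₂ , 0<s₂ , near₂) = coloured-near-centre j
        (s , 0<s , s≤s₁ , s≤s₂) = minimum 0<s₁ 0<s₂
        -- With `t` at most an eighth of `s`, the displacement `2 t` is at most `s / 4`, strictly
        -- below `s / 2`.
        (t , 0<t , t≤ , t≤1) = minimum (half-pos (half-pos (half-pos 0<s))) (ℚ.positive⁻¹ 1ℚ)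
        (τ , 0<τ , Kτ≡1) = reciprocal (List.length corners)
        -- `δ` is a third of half the spacing `t τ / 2`, which is the distance that `avoid`
        -- guarantees.
        0<δ = *-pos (ℚ.positive⁻¹ ⅓) (half-pos (*-pos 0<t (half-pos 0<τ)))
        (σ , 0<σ , step) = Obstacles.colour-step 0<δ
    in same-colour {s} {t} 0<s 0<t t≤1 (2t<½s s t 0<s t≤) 0<τ Kτ≡1 0<δ
      (thirds (½ ℚ.* (t ℚ.* (½ ℚ.* τ)))) 0<σ step
         (to (centre i)) (to (centre j)) s≤s₁ s≤s₂ near₁ near₂
    where
    2t<½s : ∀ s t → 0ℚ ℚ.< s → t ℚ.≤ ½ ℚ.* (½ ℚ.* (½ ℚ.* s)) → t ℚ.* 2ℚ ℚ.< ½ ℚ.* s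
    2t<½s s t 0<s t≤ = 0<q-p⇒p<q (ℚ.+-mono-<-≤ (half-pos (half-pos 0<s))
      (*-nonneg {2ℚ} (ℚ.nonNegative⁻¹ 2ℚ) (p≤q⇒0≤q-p t≤)))
      (solve 2 (λ t s → con ½ :* s :- t :* (con 1ℚ :+ con 1ℚ) :=
        con ½ :* (con ½ :* s) :+ (con 1ℚ :+ con 1ℚ) :* (con ½ :* (con ½ :* (con ½ :* s)) :- t))
          refl t s)
    thirds : ∀ x → ⅓ ℚ.* x ℚ.+ (⅓ ℚ.* x ℚ.+ ⅓ ℚ.* x) ≡ x
    thirds = solve 1 (λ x → con ⅓ :* x :+ (con ⅓ :* x :+ con ⅓ :* x) := x) refl

-- The adjacency graph of the unit squares

∈⇒true : ∀ {n} {R : Subset n} {i} → i ∈ R → lookup R i ≡ true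
∈⇒true = Vec.[]=⇒lookup

true⇒∈ : ∀ {n} {R : Subset n} {i} → lookup R i ≡ true → i ∈ R
true⇒∈ {R = R} {i} = Vec.lookup⇒[]= i R

∉⇒false : ∀ {n} {R : Subset n} {i} → i ∉ R → lookup R i ≡ false
∉⇒false i∉R = Bool.¬-not (i∉R ∘ true⇒∈)

false⇒∉ : ∀ {n} {R : Subset n} {i} → lookup R i ≡ false → i ∉ R
false⇒∉ eq i∈R = contradiction (trans (sym (∈⇒true i∈R)) eq) λ ()

∣i-j∣≡1⇒successive : ∀ a a′ → ℤ.∣ a ℤ.- a′ ∣ ≡ 1 → a ≡ ℤ.suc a′ ⊎ a′ ≡ ℤ.suc a
∣i-j∣≡1⇒successive a a′ eq with a ℤ.- a′ in diff
... | + m = inj₁ (trans (sym (ℤ.+-identityʳ a))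
      (trans (cong (λ z → a ℤ.+ z) (sym (ℤ.+-inverseˡ a′)))
        (trans (sym (ℤ.+-assoc a (ℤ.- a′) a′)) (cong (ℤ._+ a′) (trans diff (cong +_ eq))))))
... | -[1+ m ] = inj₂
      (trans (sym (ℤ.+-identityʳ a′)) (trans (cong (λ z → a′ ℤ.+ z) (sym (ℤ.+-inverseˡ a)))
        (trans (sym (ℤ.+-assoc a′ (ℤ.- a) a)) (cong (ℤ._+ a)
          (trans (trans (sym (cong (λ z → z ℤ.- a) (ℤ.neg-involutive a′)))
            (trans (sym (ℤ.neg-distrib-+ (ℤ.- a′) a))
              (cong ℤ.-_ (trans (ℤ.+-comm (ℤ.- a′) a) diff))))
            (cong +_ eq))))))

even : ℤ → Bool
even m = does (+ 2 ℤ.∣? m)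

even-suc : ∀ m → even (ℤ.suc m) ≡ not (even m)
even-suc m = by-cases (+ 2 ℤ.∣? m)
  where
  odd : ¬ (+ 2 ℤ.∣ m) → ∀ r q → r ℕ.< 2 → m ≡ + r ℤ.+ q ℤ.* + 2 → + 2 ℤ.∣ ℤ.suc m
  odd ¬2∣m 0 q _ eq = contradiction (ℤ.divides q (trans eq (ℤ.+-identityˡ (q ℤ.* + 2)))) ¬2∣m
  odd _ 1 q _ eq = ℤ.divides (+ 1 ℤ.+ q) (trans (cong ℤ.suc eq)
    (trans (sym (ℤ.+-assoc (+ 1) (+ 1) (q ℤ.* + 2))) (sym (ℤ.*-distribʳ-+ (+ 2) (+ 1) q))))
  odd _ (suc (suc _)) q (ℕ.s≤s (ℕ.s≤s ()))
  by-cases : Dec (+ 2 ℤ.∣ m) → even (ℤ.suc m) ≡ not (even m)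
  by-cases (yes 2∣m) = trans (dec-false (+ 2 ℤ.∣? ℤ.suc m) λ 2∣1+m →
        contradiction (ℤ.∣m+n∣m⇒∣n {+ 2} {m} {+ 1} (subst (+ 2 ℤ.∣_) (ℤ.+-comm (+ 1) m) 2∣1+m) 2∣m)
          (λ { (ℤ.divides (+ zero) ()) ; (ℤ.divides (+ suc q) ()) ; (ℤ.divides -[1+ q ] ()) }))
        (sym (cong not (dec-true (+ 2 ℤ.∣? m) 2∣m)))
  by-cases (no ¬2∣m) = trans (dec-true (+ 2 ℤ.∣? ℤ.suc m)
        (odd ¬2∣m (m ℤ.% + 2) (m ℤ./ + 2) (ℤ.n%d<d m (+ 2)) (ℤ.a≡a%n+[a/n]*n m (+ 2))))
        (sym (cong not (dec-false (+ 2 ℤ.∣? m) ¬2∣m)))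

module Graph (𝒟 : QuadriculatedDisk) where
  open QuadriculatedDisk 𝒟

  W : Region 𝒟
  W = white 𝒟

  Adj : Fin size → Fin size → Set
  Adj i j = Adjacent (cell i) (cell j)

  adjacent? : ∀ i j → Dec (Adj i j)
  adjacent? i j with cell i | cell j
  ... | a , b | a′ , b′ =
        (ℤ.∣ a ℤ.- a′ ∣ ℕ.≟ 1 ×-dec b ℤ.≟ b′) ⊎-dec (a ℤ.≟ a′ ×-dec ℤ.∣ b ℤ.- b′ ∣ ℕ.≟ 1)

  adjacent-sym : ∀ {c c′} → Adjacent c c′ → Adjacent c′ c
  adjacent-sym {a , b} {a′ , b′} (inj₁ (one , eq)) = inj₁ (trans (ℤ.∣i-j∣≡∣j-i∣ a′ a) one , sym eq)
  adjacent-sym {a , b} {a′ , b′} (inj₂ (eq , one)) = inj₂ (sym eq , trans (ℤ.∣i-j∣≡∣j-i∣ b′ b) one)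

  white-even : ∀ i → lookup W i ≡ even (proj₁ (cell i) ℤ.+ proj₂ (cell i))
  white-even i = Vec.lookup∘tabulate _ i

  adjacent-white : ∀ {i j} → Adj i j → lookup W i ≡ not (lookup W j)
  adjacent-white {i} {j} adj rewrite white-even i | white-even j = alternates adj
    where
    alternate : ∀ m m′ → m ≡ ℤ.suc m′ ⊎ m′ ≡ ℤ.suc m → even m ≡ not (even m′)
    alternate m m′ (inj₁ refl) = even-suc m′
    alternate m m′ (inj₂ refl) = sym (trans (cong not (even-suc m)) (Bool.not-involutive (even m)))
    shift : ∀ a b → a ℤ.+ ℤ.suc b ≡ ℤ.suc (a ℤ.+ b)
    shift a b = trans (sym (ℤ.+-assoc a (+ 1) b))
      (trans (cong (ℤ._+ b) (ℤ.+-comm a (+ 1))) (ℤ.+-assoc (+ 1) a b))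
    alternates : ∀ {c c′} → Adjacent c c′ →
                 even (proj₁ c ℤ.+ proj₂ c) ≡ not (even (proj₁ c′ ℤ.+ proj₂ c′))
    alternates {a , b} {a′ , .b} (inj₁ (one , refl)) with ∣i-j∣≡1⇒successive a a′ one
    ... | inj₁ refl = alternate (a ℤ.+ b) (a′ ℤ.+ b) (inj₁ (ℤ.+-assoc (+ 1) a′ b))
    ... | inj₂ refl = alternate (a ℤ.+ b) (a′ ℤ.+ b) (inj₂ (ℤ.+-assoc (+ 1) a b))
    alternates {a , b} {.a , b′} (inj₂ (refl , one)) with ∣i-j∣≡1⇒successive b b′ one
    ... | inj₁ refl = alternate (a ℤ.+ b) (a ℤ.+ b′) (inj₁ (shift a b′))
    ... | inj₂ refl = alternate (a ℤ.+ b) (a ℤ.+ b′) (inj₂ (shift a b))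

  adjacent-distinct : ∀ {i j} → Adj i j → i ≢ j
  adjacent-distinct adj refl = Bool.not-¬ refl (adjacent-white adj)

  Inside : Region 𝒟 → Fin size → Fin size → Set
  Inside R k l = k ∈ R × l ∈ R × Adj k l

  -- For `C ⊆ R` this says that `C` is a union of components of `R`. Unlike `Component` it admits
  -- the empty region, which serves for a missing side of `d`.
  Closed : Region 𝒟 → Region 𝒟 → Set
  Closed R C = ∀ {x y} → x ∈ C → y ∈ R → Adj x y → y ∈ C

  closed-path : ∀ {R C x y} → Closed R C → x ∈ C → Star (Inside R) x y → y ∈ C
  closed-path closed x∈C ε = x∈C
  closed-path closed x∈C ((_ , y∈R , adj) ◅ path) = closed-path closed (closed x∈C y∈R adj) path

  -- The set grows from `i` by one boundary square at a time, and `fuel` bounds the number of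
  -- squares still outside `S`. A set that can no longer grow is closed, hence maximal among
  -- connected ones.
  component-of : ∀ R {i} → i ∈ R → ∃[ C ] (i ∈ C × Component 𝒟 R C × Closed R C)
  component-of R {i} i∈R = grow size ⁅ i ⁆ (ℕ.m≤n+m size _) (Subset.x∈⁅x⁆ i)
      (λ x∈ → subst (_∈ R) (sym (Subset.x∈⁅y⁆⇒x≡y i x∈)) i∈R)
      (λ k∈ → subst (Star (Inside ⁅ i ⁆) i) (sym (Subset.x∈⁅y⁆⇒x≡y i k∈)) ε)
    where
    grow : ∀ fuel S → size ℕ.≤ ∣ S ∣ ℕ.+ fuel → i ∈ S → S ⊆ R →
      (∀ {k} → k ∈ S → Star (Inside S) i k) →
           ∃[ C ] (i ∈ C × Component 𝒟 R C × Closed R C)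
    grow fuel S enough i∈S S⊆R reach with
      Fin.any? (λ x → Fin.any?
        (λ y → (x Subset.∈? S ×-dec y Subset.∈? R) ×-dec (¬? (y Subset.∈? S) ×-dec adjacent? x y)))
    ... | no none = S , i∈S , ((i , i∈S) , S⊆R , connected , maximal) , closed
      where
      closed : Closed R S
      closed {x} {y} x∈S y∈R adj = decidable-stable (y Subset.∈? S)
        λ y∉S → none (x , y , (x∈S , y∈R) , y∉S , adj)
      connected : Connected 𝒟 S
      connected k∈S l∈S =
        Star.reverse (λ (k∈ , l∈ , adj) → l∈ , k∈ , adjacent-sym adj) (reach k∈S) ◅◅ reach l∈S
      maximal : ∀ C′ → S ⊆ C′ → C′ ⊆ R → Connected 𝒟 C′ → C′ ⊆ S
      maximal C′ S⊆C′ C′⊆R connected′ x∈C′ = closed-path closed i∈S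
        (Star.map (λ (k∈ , l∈ , adj) → C′⊆R k∈ , C′⊆R l∈ , adj) (connected′ (S⊆C′ i∈S) x∈C′))
    ... | yes (x , y , (x∈S , y∈R) , y∉S , adj) with fuel
    ...   | zero = contradiction (ℕ.≤-trans enough (ℕ.≤-reflexive (ℕ.+-identityʳ ∣ S ∣)))
              (ℕ.<⇒≱ (subst (∣ S ∣ ℕ.<_) (Subset.∣⊤∣≡n size)
                (Subset.p⊂q⇒∣p∣<∣q∣ (Subset.⊆⊤ , y , Subset.∈⊤ , y∉S))))
    ...   | suc fuel′ = grow fuel′ S′
              (ℕ.≤-trans enough (subst (ℕ._≤ ∣ S′ ∣ ℕ.+ fuel′) (sym (ℕ.+-suc ∣ S ∣ fuel′))
                (ℕ.+-monoˡ-≤ fuel′ (Subset.p⊂q⇒∣p∣<∣q∣ (S⊆S′ , y , y∈S′ , y∉S)))))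
              (S⊆S′ i∈S) S′⊆R reach′
      where
      S′ = S ∪ ⁅ y ⁆
      S⊆S′ : S ⊆ S′
      S⊆S′ = Subset.p⊆p∪q ⁅ y ⁆
      y∈S′ : y ∈ S′
      y∈S′ = Subset.q⊆p∪q S ⁅ y ⁆ (Subset.x∈⁅x⁆ y)
      S′⊆R : S′ ⊆ R
      S′⊆R z∈ with Subset.x∈p∪q⁻ S ⁅ y ⁆ z∈
      ... | inj₁ z∈S = S⊆R z∈S
      ... | inj₂ z∈y = subst (_∈ R) (sym (Subset.x∈⁅y⁆⇒x≡y y z∈y)) y∈R
      widen : ∀ {k} → Star (Inside S) i k → Star (Inside S′) i k
      widen = Star.map λ (k∈ , l∈ , adj) → S⊆S′ k∈ , S⊆S′ l∈ , adj
      reach′ : ∀ {k} → k ∈ S′ → Star (Inside S′) i k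
      reach′ k∈ with Subset.x∈p∪q⁻ S ⁅ y ⁆ k∈
      ... | inj₁ k∈S = widen (reach k∈S)
      ... | inj₂ k∈y = subst (Star (Inside S′) i) (sym (Subset.x∈⁅y⁆⇒x≡y y k∈y))
              (widen (reach x∈S) ◅◅ ((S⊆S′ x∈S , y∈S′ , adj) ◅ ε))

  -- The indicator of the component of `i` does not change across a common edge, so
  -- `constant-colour` shows that this component contains `j`.
  disk-connected : ∀ i j → Star Adj i j
  disk-connected i j with component-of ⊤ (Subset.∈⊤ {x = i})
  ... | C , i∈C , (_ , _ , connected , _) , closed =
    Star.map (proj₂ ∘ proj₂)
      (connected i∈C (true⇒∈ (trans (sym (constant-colour i j)) (∈⇒true i∈C))))
    where
    invariant : ∀ {k l} → Adj k l → lookup C k ≡ lookup C l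
    invariant {k} {l} adj with k Subset.∈? C | l Subset.∈? C
    ... | yes k∈ | yes l∈ = trans (∈⇒true k∈) (sym (∈⇒true l∈))
    ... | yes k∈ | no l∉ = contradiction (closed k∈ Subset.∈⊤ adj) l∉
    ... | no k∉ | yes l∈ = contradiction (closed l∈ Subset.∈⊤ (adjacent-sym adj)) k∉
    ... | no k∉ | no l∉ = trans (∉⇒false k∉) (sym (∉⇒false l∉))
    open Chords 𝒟 (lookup C) invariant using (constant-colour)

-- The homomorphism onto the free group

∈-⋃⁻ : ∀ {n} {i : Fin n} (Rs : List (Subset n)) → i ∈ ⋃ Rs → Any (i ∈_) Rs
∈-⋃⁻ []       i∈ = contradiction i∈ Subset.∉⊥
∈-⋃⁻ (R ∷ Rs) i∈ with Subset.x∈p∪q⁻ R (⋃ Rs) i∈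
... | inj₁ i∈R  = here i∈R
... | inj₂ i∈Rs = there (∈-⋃⁻ Rs i∈Rs)

∈-⋃⁺ : ∀ {n} {i : Fin n} {Rs : List (Subset n)} → Any (i ∈_) Rs → i ∈ ⋃ Rs
∈-⋃⁺ {Rs = R ∷ Rs} (here i∈R)  = Subset.p⊆p∪q (⋃ Rs) i∈R
∈-⋃⁺ {Rs = R ∷ Rs} (there i∈Rs) = Subset.q⊆p∪q R (⋃ Rs) (∈-⋃⁺ i∈Rs)

module Tilings (𝒟 : QuadriculatedDisk) where
  open QuadriculatedDisk 𝒟 using (size)
  open Graph 𝒟
  open Plug
  open Tiling

  Edge : Plug 𝒟 → Plug 𝒟 → Set
  Edge = PlugEdge 𝒟

  edge-disjoint : ∀ {p q i} → Edge p q → i ∈ squares p → i ∉ squares q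
  edge-disjoint (join _ disjoint _) i∈p i∈q = disjoint (_ , Subset.x∈p∩q⁺ (i∈p , i∈q))
  edge-disjoint (loop refl refl _ _) i∈p _ = contradiction i∈p Subset.∉⊥

  -- A loop tiles `⊤`, which is `∁ (⊥ ∪ ⊥)`; this lets loops and joins be treated alike.
  edge-tiling : ∀ {p q} (e : Edge p q) →
    Σ[ T ∈ Tiling 𝒟 (∁ (squares p ∪ squares q)) ] dominoes T ≡ tiles 𝒟 e
  edge-tiling (join _ _ T) = T , refl
  edge-tiling (loop refl refl _ T) = retarget 𝒟 ⊤≡ T , refl
    where
    ⊤≡ : ⊤ ≡ ∁ (⊥ ∪ ⊥)
    ⊤≡ = Subset.⊆-antisym
      (λ _ → Subset.x∉p⇒x∈∁p λ i∈ → [ Subset.∉⊥ , Subset.∉⊥ ]′ (Subset.x∈p∪q⁻ ⊥ ⊥ i∈)) Subset.⊆⊤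

  tile-outside : ∀ {p q D i} (e : Edge p q) → D List.∈ tiles 𝒟 e → i ∈ D →
    i ∉ squares p × i ∉ squares q
  tile-outside {p} {q} e D∈ i∈D with edge-tiling e
  ... | T , refl = (λ i∈p → outside′ (inj₁ i∈p)) , (λ i∈q → outside′ (inj₂ i∈q))
    where
    outside′ = λ i∈ → Subset.x∈∁p⇒x∉p
      (subst (_ ∈_) (covers T) (∈-⋃⁺ (Any.map (λ { refl → i∈D }) D∈)))
                 (Subset.x∈p∪q⁺ {p = squares p} i∈)

  covered : ∀ {p q i} (e : Edge p q) → i ∉ squares p → i ∉ squares q →
    ∃[ D ] (D List.∈ tiles 𝒟 e × i ∈ D)
  covered {p} {q} {i} e i∉p i∉q with edge-tiling e
  ... | T , refl = find (∈-⋃⁻ (dominoes T) (subst (i ∈_) (sym (covers T))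
          (Subset.x∉p⇒x∈∁p λ i∈ → [ i∉p , i∉q ]′ (Subset.x∈p∪q⁻ (squares p) (squares q) i∈))))

  tile-domino : ∀ {p q D} (e : Edge p q) → D List.∈ tiles 𝒟 e → Domino 𝒟 D
  tile-domino e D∈ with edge-tiling e
  ... | T , refl = All.lookup (domino T) D∈

  disjoint-sym : ∀ {R S} → Disjoint 𝒟 R S → Disjoint 𝒟 S R
  disjoint-sym {R} {S} = subst Empty (Subset.∩-comm R S)

  same-or-disjoint : ∀ {L D E i} → AllPairs (Disjoint 𝒟) L → D List.∈ L → E List.∈ L → i ∈ D →
    i ∈ E → D ≡ E
  same-or-disjoint _ (here refl) (here refl) _ _ = refl
  same-or-disjoint (D# ∷ _) (here refl) (there E∈) i∈D i∈E =
    contradiction (_ , Subset.x∈p∩q⁺ (i∈D , i∈E)) (All.lookup D# E∈)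
  same-or-disjoint (E# ∷ _) (there D∈) (here refl) i∈D i∈E =
    contradiction (_ , Subset.x∈p∩q⁺ (i∈E , i∈D)) (All.lookup E# D∈)
  same-or-disjoint (_ ∷ pairs) (there D∈) (there E∈) i∈D i∈E = same-or-disjoint pairs D∈ E∈ i∈D i∈E

  tiles-same : ∀ {p q D E i} (e : Edge p q) → D List.∈ tiles 𝒟 e → E List.∈ tiles 𝒟 e → i ∈ D →
    i ∈ E → D ≡ E
  tiles-same e D∈ E∈ with edge-tiling e
  ... | T , refl = same-or-disjoint (disjoint T) D∈ E∈

  tiles-reversed : ∀ {p q} (e : Edge p q) → tiles 𝒟 (reversed 𝒟 e) ≡ tiles 𝒟 e
  tiles-reversed (join _ _ _)   = refl
  tiles-reversed (loop _ _ _ _) = refl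

  sameEdge-tiles : ∀ {p q} {e f : Edge p q} → SameEdge 𝒟 e f → tiles 𝒟 e ↭ tiles 𝒟 f
  sameEdge-tiles (join eq) = eq
  sameEdge-tiles (loop eq) = eq

  -- In this twisted form a domino disjoint from or contained in p sees two different
  -- values, and adding or removing it exchanges them.
  config : Plug 𝒟 → Fin size → Bool
  config p i = lookup (squares p) i xor lookup W i

  -- For `b = true` the plug has all black and no white squares of `X`; for `b = false` all white
  -- and no black ones.
  Constant : Region 𝒟 → Bool → Plug 𝒟 → Set
  Constant X b p = ∀ i → i ∈ X → config p i ≡ b

  config-∉ : ∀ p {i} → i ∉ squares p → config p i ≡ lookup W i
  config-∉ p i∉p rewrite ∉⇒false i∉p = refl

  config-∈ : ∀ p {i} → i ∈ squares p → config p i ≡ not (lookup W i)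
  config-∈ p i∈p rewrite ∈⇒true i∈p = refl

  -- Outside the plug `config` is the colour, and adjacent squares have opposite colours. Thus no
  -- domino next to a plug constant on `X` can lie in `X`.
  domino-not-constant : ∀ {X b} p {i j} → Constant X b p → Adj i j → i ∈ X → j ∈ X →
                        i ∉ squares p → ¬ j ∉ squares p
  domino-not-constant p const adj i∈X j∈X i∉p j∉p = Bool.not-¬
    (trans (trans (sym (config-∉ p i∉p)) (const _ i∈X))
      (trans (sym (const _ j∈X)) (config-∉ p j∉p)))
    (adjacent-white adj)

  -- Extreme plugs and the word of a path

  module Weights (d : Region 𝒟) (d-domino : Domino 𝒟 d)
    (C₁ C₂ : Region 𝒟) (C₁⊆∁d : C₁ ⊆ ∁ d) (C₂⊆∁d : C₂ ⊆ ∁ d)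
    (closed₁ : Closed (∁ d) C₁) (closed₂ : Closed (∁ d) C₂)
    (flanks : ∀ {Q} → TwoByTwo 𝒟 Q → d ⊆ Q → ∀ {i} → i ∈ Q → i ∉ d → i ∈ C₁ ⊎ i ∈ C₂) where

    -- A tile meeting `X` is not `d`, so it avoids `d` and lies in `X` by closedness, which
    -- `domino-not-constant` excludes. Hence on `X` the plug `q` is the complement of `p`.
    saturated : ∀ {X b p q} → X ⊆ ∁ d → Closed (∁ d) X → (e : Edge p q) → d List.∈ tiles 𝒟 e →
                Constant X b p → Constant X (not b) q
    saturated {X} {b} {p} {q} X⊆ closed e d∈ const i i∈X with i Subset.∈? squares p
    ... | yes i∈p = trans (config-∉ q (edge-disjoint e i∈p)) (trans (sym (Bool.not-involutive _))
            (cong not (trans (sym (config-∈ p i∈p)) (const i i∈X))))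
    ... | no i∉p with i Subset.∈? squares q
    ...   | yes i∈q = trans (config-∈ q i∈q) (cong not (trans (sym (config-∉ p i∉p)) (const i i∈X)))
    ...   | no i∉q with covered e i∉p i∉q
    ...     | D , D∈ , i∈D with tile-domino e D∈
    ...       | k , l , adj , refl = Empty.⊥-elim (both (Subset.x∈p∪q⁻ ⁅ k ⁆ ⁅ l ⁆ i∈D))
      where
      k∈D : k ∈ ⁅ k ⁆ ∪ ⁅ l ⁆
      k∈D = Subset.p⊆p∪q ⁅ l ⁆ (Subset.x∈⁅x⁆ k)
      l∈D : l ∈ ⁅ k ⁆ ∪ ⁅ l ⁆
      l∈D = Subset.q⊆p∪q ⁅ k ⁆ ⁅ l ⁆ (Subset.x∈⁅x⁆ l)
      off-d : ∀ {z} → z ∈ ⁅ k ⁆ ∪ ⁅ l ⁆ → z ∈ ∁ d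
      off-d {z} z∈D = Subset.x∉p⇒x∈∁p λ z∈d → Subset.x∈∁p⇒x∉p (X⊆ i∈X)
        (subst (i ∈_) (tiles-same e D∈ d∈ z∈D z∈d) i∈D)
      both : i ∈ ⁅ k ⁆ ⊎ i ∈ ⁅ l ⁆ → Empty.⊥
      both (inj₁ i∈k) with refl ← Subset.x∈⁅y⁆⇒x≡y k i∈k = domino-not-constant p const adj i∈X
        (closed i∈X (off-d l∈D) adj) i∉p (proj₁ (tile-outside e D∈ l∈D))
      both (inj₂ i∈l) with refl ← Subset.x∈⁅y⁆⇒x≡y l i∈l =
        domino-not-constant p const (adjacent-sym adj) i∈X
        (closed i∈X (off-d k∈D) (adjacent-sym adj)) i∉p (proj₁ (tile-outside e D∈ k∈D))

    Extreme : Region 𝒟 → Region 𝒟 → Plug 𝒟 → Set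
    Extreme X Y p = Constant X true p × Constant Y false p

    constant? : ∀ X b p → Dec (Constant X b p)
    constant? X b p = Fin.all? λ i → (i Subset.∈? X) →-dec (config p i Bool.≟ b)

    extreme? : ∀ X Y p → Dec (Extreme X Y p)
    extreme? X Y p = constant? X true p ×-dec constant? Y false p

    open FreeGroup (Fin 2) using (Word) renaming (_≈_ to _≈ʷ_)
    open Group F₂ using (_∙_; _⁻¹) renaming (ε to 1ʷ)

    generator : Fin 2 → Word
    generator x = (Sign.+ , x) ∷ []

    pick : ∀ {A B : Set} → Dec A → Dec B → Word
    pick (yes _) _       = generator Fin.zero
    pick (no _)  (yes _) = generator (Fin.suc Fin.zero)
    pick (no _)  (no _)  = 1ʷ

    pick-cong : ∀ {A A′ B B′ : Set} (a : Dec A) (b : Dec B) (a′ : Dec A′) (b′ : Dec B′) →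
                (A → A′) → (A′ → A) → (B → B′) → (B′ → B) → pick a b ≡ pick a′ b′
    pick-cong (yes x) _       (yes _) _       _ _ _ _ = refl
    pick-cong (yes x) _       (no ¬x) _       f _ _ _ = contradiction (f x) ¬x
    pick-cong (no ¬x) _       (yes x) _       _ f _ _ = contradiction (f x) ¬x
    pick-cong (no _)  (yes _) (no _)  (yes _) _ _ _ _ = refl
    pick-cong (no _)  (yes y) (no _)  (no ¬y) _ _ g _ = contradiction (g y) ¬y
    pick-cong (no _)  (no ¬y) (no _)  (yes y) _ _ _ g = contradiction (g y) ¬y
    pick-cong (no _)  (no _)  (no _)  (no _)  _ _ _ _ = refl

    pick-none : ∀ {A B : Set} (a : Dec A) (b : Dec B) → ¬ A → ¬ B → pick a b ≡ 1ʷ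
    pick-none (yes x) _       ¬x _ = contradiction x ¬x
    pick-none (no _)  (yes y) _ ¬y = contradiction y ¬y
    pick-none (no _)  (no _)  _ _  = refl

    pick-first : ∀ {A B : Set} (a : Dec A) (b : Dec B) → A → pick a b ≡ generator Fin.zero
    pick-first (yes _) _ _ = refl
    pick-first (no ¬x) _ x = contradiction x ¬x

    pick-second : ∀ {A B : Set} (a : Dec A) (b : Dec B) → ¬ A → B →
      pick a b ≡ generator (Fin.suc Fin.zero)
    pick-second (yes x) _       ¬x _ = contradiction x ¬x
    pick-second (no _)  (yes _) _  _ = refl
    pick-second (no _)  (no ¬y) _  y = contradiction y ¬y

    -- `weight` is read at the even end of a floor. `coweight` expresses the same word through the
    -- odd end, where the roles of `C₁` and `C₂` are exchanged.
    weight coweight : Plug 𝒟 → Word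
    weight p   = pick (extreme? C₁ C₂ p) (extreme? C₂ C₁ p)
    coweight p = pick (extreme? C₂ C₁ p) (extreme? C₁ C₂ p)

    swap-extreme₁₂ : ∀ {p q} (e : Edge p q) → d List.∈ tiles 𝒟 e → Extreme C₁ C₂ p → Extreme C₂ C₁ q
    swap-extreme₁₂ e d∈ (one , two) =
      saturated C₂⊆∁d closed₂ e d∈ two , saturated C₁⊆∁d closed₁ e d∈ one

    swap-extreme₂₁ : ∀ {p q} (e : Edge p q) → d List.∈ tiles 𝒟 e → Extreme C₂ C₁ p → Extreme C₁ C₂ q
    swap-extreme₂₁ e d∈ (two , one) =
      saturated C₁⊆∁d closed₁ e d∈ one , saturated C₂⊆∁d closed₂ e d∈ two

    weight-coweight : ∀ {p q} (e : Edge p q) → d List.∈ tiles 𝒟 e → weight p ≡ coweight q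
    weight-coweight {p} {q} e d∈ =
      pick-cong (extreme? C₁ C₂ p) (extreme? C₂ C₁ p) (extreme? C₂ C₁ q) (extreme? C₁ C₂ q)
      (swap-extreme₁₂ e d∈) (swap-extreme₂₁ (reversed 𝒟 e) d∈′)
      (swap-extreme₂₁ e d∈) (swap-extreme₁₂ (reversed 𝒟 e) d∈′)
      where d∈′ = subst (d List.∈_) (sym (tiles-reversed e)) d∈

    -- The partner `d′` of `d` avoids `d`, so by `flanks` and closedness it lies in `C₁` or in `C₂`;
    -- a plug constant on both leaves no room for it.
    no-flip : ∀ {p q d′ T} (e : Edge p q) → tiles 𝒟 e ↭ d ∷ d′ ∷ T → TwoByTwo 𝒟 (d ∪ d′) →
              ¬ Extreme C₁ C₂ p × ¬ Extreme C₂ C₁ p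
    no-flip {p} {q} {d′} e perm square =
      (λ (one , two) → absurd one two) , (λ (two , one) → absurd one two)
      where
      d∈ : d List.∈ tiles 𝒟 e
      d∈ = ∈-resp-↭ (↭-sym perm) (here refl)
      d′∈ : d′ List.∈ tiles 𝒟 e
      d′∈ = ∈-resp-↭ (↭-sym perm) (there (here refl))
      disjoint-d : ∀ {i} → i ∈ d′ → i ∉ d
      disjoint-d i∈d′ i∈d with edge-tiling e
      ... | T , refl with (d#d′ ∷ _) ∷ _ ← PermSetoid.AllPairs-resp-↭
            (setoid (Region 𝒟)) disjoint-sym
            ((λ { refl → id }) , (λ { refl → id })) (↭⇒↭ₛ perm) (disjoint T) =
        d#d′ (_ , Subset.x∈p∩q⁺ (i∈d , i∈d′))
      absurd : ∀ {b c} → Constant C₁ b p → ¬ Constant C₂ c p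
      absurd one two with tile-domino e d′∈
      ... | k , l , adj , refl =
            go (flanks square (Subset.p⊆p∪q d′) (Subset.q⊆p∪q d d′ k∈) (disjoint-d k∈))
        where
        k∈ : k ∈ ⁅ k ⁆ ∪ ⁅ l ⁆
        k∈ = Subset.p⊆p∪q ⁅ l ⁆ (Subset.x∈⁅x⁆ k)
        l∈ : l ∈ ⁅ k ⁆ ∪ ⁅ l ⁆
        l∈ = Subset.q⊆p∪q ⁅ k ⁆ ⁅ l ⁆ (Subset.x∈⁅x⁆ l)
        l∈∁d = Subset.x∉p⇒x∈∁p (disjoint-d l∈)
        k∉p = proj₁ (tile-outside e d′∈ k∈)
        l∉p = proj₁ (tile-outside e d′∈ l∈)
        go : k ∈ C₁ ⊎ k ∈ C₂ → Empty.⊥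
        go (inj₁ k∈C) = domino-not-constant p one adj k∈C (closed₁ k∈C l∈∁d adj) k∉p l∉p
        go (inj₂ k∈C) = domino-not-constant p two adj k∈C (closed₂ k∈C l∈∁d adj) k∉p l∉p

    _∈ᵗ?_ : ∀ D (L : List (Region 𝒟)) → Dec (D List.∈ L)
    _∈ᵗ?_ = DecMembership._∈?_ (Vec.≡-dec Bool._≟_)

    restrict : ∀ {A : Set} → Dec A → Word → Word
    restrict (yes _) w = w
    restrict (no _)  w = 1ʷ

    restrict-cong : ∀ {A A′ : Set} (a : Dec A) (a′ : Dec A′) {w w′} → (A → A′) → (A′ → A) →
      (A → w ≡ w′) →
                    restrict a w ≡ restrict a′ w′
    restrict-cong (yes x) (yes _) _ _ eq = eq x
    restrict-cong (yes x) (no ¬x) f _ _  = contradiction (f x) ¬x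
    restrict-cong (no ¬x) (yes x) _ g _  = contradiction (g x) ¬x
    restrict-cong (no _)  (no _)  _ _ _  = refl

    restrict-no : ∀ {A : Set} (a : Dec A) {w} → (A → w ≡ 1ʷ) → restrict a w ≡ 1ʷ
    restrict-no (yes x) f = f x
    restrict-no (no _)  _ = refl

    value : ∀ {p q} → Edge p q → Word
    value {p} e = restrict (d ∈ᵗ? tiles 𝒟 e) (weight p)

    value-cong : ∀ {p p′ q q′} (e : Edge p q) (f : Edge p′ q′) →
                 (d List.∈ tiles 𝒟 e → d List.∈ tiles 𝒟 f) →
                 (d List.∈ tiles 𝒟 f → d List.∈ tiles 𝒟 e) →
                 (d List.∈ tiles 𝒟 e → weight p ≡ weight p′) → value e ≡ value f
    value-cong e f = restrict-cong (d ∈ᵗ? tiles 𝒟 e) (d ∈ᵗ? tiles 𝒟 f)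

    sameEdge-value : ∀ {p q} {e f : Edge p q} → SameEdge 𝒟 e f → value e ≡ value f
    sameEdge-value {e = e} {f} eq =
      value-cong e f (∈-resp-↭ (sameEdge-tiles eq)) (∈-resp-↭ (↭-sym (sameEdge-tiles eq))) λ _ →
        refl

    flip-weight : ∀ {p q T d₁ d₂} (e : Edge p q) → tiles 𝒟 e ↭ d₁ ∷ d₂ ∷ T → TwoByTwo 𝒟 (d₁ ∪ d₂) →
                  d List.∈ tiles 𝒟 e → weight p ≡ 1ʷ ⊎ d List.∈ T
    flip-weight {p} {d₁ = d₁} {d₂} e perm square d∈ with ∈-resp-↭ perm d∈
    ... | here refl = inj₁ (pick-none (extreme? C₁ C₂ p) _ (proj₁ none) (proj₂ none))
      where none = no-flip e perm square
    ... | there (here refl) = inj₁ (pick-none (extreme? C₁ C₂ p) _ (proj₁ none) (proj₂ none))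
      where none = no-flip e (↭-trans perm (Perm.swap d₁ d₂ Perm.refl)) (subst (TwoByTwo 𝒟) (Subset.∪-comm d₁ d₂) square)
    ... | there (there d∈T) = inj₂ d∈T

    -- Either the flip keeps `d`, or `d` is one of the dominoes it moves, and then the weight is
    -- trivial by `no-flip`.
    flip-value : ∀ {p q} (e f : Edge p q) → Flip 𝒟 (tiles 𝒟 e) (tiles 𝒟 f) → value e ≡ value f
    flip-value {p} e f (d₁ , d₂ , e₁ , e₂ , T , perm , perm′ , square , same , _)
      with d ∈ᵗ? tiles 𝒟 e | d ∈ᵗ? tiles 𝒟 f
    ... | yes _  | yes _  = refl
    ... | no _   | no _   = refl
    ... | yes d∈ | no d∉ with flip-weight e perm square d∈
    ...   | inj₁ eq  = eq
    ...   | inj₂ d∈T = contradiction (∈-resp-↭ (↭-sym perm′) (there (there d∈T))) d∉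
    flip-value {p} e f (d₁ , d₂ , e₁ , e₂ , T , perm , perm′ , square , same , _)
        | no d∉ | yes d∈ with flip-weight f perm′ (subst (TwoByTwo 𝒟) (sym same) square) d∈
    ...   | inj₁ eq  = sym eq
    ...   | inj₂ d∈T = contradiction (∈-resp-↭ (↭-sym perm) (there (there d∈T))) d∉

    -- A floor traversed from odd to even height is read backwards and inverted, so that the weight
    -- is always taken at the even end.
    step : ∀ {p q} → ℙ.Parity → Edge p q → Word
    step 0ℙ e = value e
    step 1ℙ e = value (reversed 𝒟 e) ⁻¹

    -- The parity records whether the current vertex is at an even height.
    eval : ∀ {p q} → ℙ.Parity → Star Edge p q → Word
    eval s ε       = 1ʷ
    eval s (e ◅ γ) = step s e ∙ eval (s ℙ.⁻¹) γ

    module F₂ = Group F₂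

    -- Both weights are equal to `coweight q`.
    same-height : ∀ {p p′ q} (e : Edge p q) (f : Edge p′ q) →
                  d List.∈ tiles 𝒟 e → d List.∈ tiles 𝒟 f → weight p ≡ weight p′
    same-height e f d∈e d∈f = trans (weight-coweight e d∈e) (sym (weight-coweight f d∈f))

    ∈-reversed : ∀ {p q D} (e : Edge p q) → D List.∈ tiles 𝒟 e → D List.∈ tiles 𝒟 (reversed 𝒟 e)
    ∈-reversed e = subst (_ List.∈_) (sym (tiles-reversed e))

    ∈-reversed⁻ : ∀ {p q D} (e : Edge p q) → D List.∈ tiles 𝒟 (reversed 𝒟 e) → D List.∈ tiles 𝒟 e
    ∈-reversed⁻ e = subst (_ List.∈_) (tiles-reversed e)

    module F₂ₚ = GroupProperties F₂

    -- The word around a quadrilateral started at even height. If its domino is not `d`, the first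
    -- edge cancels the fourth and the second cancels the third; if it is `d`, only the third and
    -- the fourth contribute.
    cancel₀ : ∀ {x y z t} → x ≡ t × y ≡ z ⊎ (x ≡ 1ʷ × y ≡ 1ʷ) × z ≡ t →
              x ∙ (y ⁻¹ ∙ (z ∙ (t ⁻¹ ∙ 1ʷ))) ≈ʷ 1ʷ
    cancel₀ {x} {y} (inj₁ (refl , refl)) =
      F₂.trans (F₂.∙-congˡ {x} (F₂ₚ.\\-leftDividesʳ y (x ⁻¹ ∙ 1ʷ)))
      (F₂ₚ.\\-leftDividesˡ x 1ʷ)
    cancel₀ {t = t} (inj₂ ((refl , refl) , refl)) = F₂ₚ.\\-leftDividesˡ t 1ʷ

    cancel₁ : ∀ {x y z t} → x ≡ t × y ≡ z ⊎ (x ≡ 1ʷ × y ≡ 1ʷ) × z ≡ t →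
              x ⁻¹ ∙ (y ∙ (z ⁻¹ ∙ (t ∙ 1ʷ))) ≈ʷ 1ʷ
    cancel₁ {x} {y} (inj₁ (refl , refl)) =
      F₂.trans (F₂.∙-congˡ {x ⁻¹} (F₂ₚ.\\-leftDividesˡ y (x ∙ 1ʷ)))
      (F₂ₚ.\\-leftDividesʳ x 1ʷ)
    cancel₁ {t = t} (inj₂ ((refl , refl) , refl)) = F₂ₚ.\\-leftDividesʳ t 1ʷ

    ≡⇒≈ʷ : ∀ {x y} → x ≡ y → x ≈ʷ y
    ≡⇒≈ʷ refl = F₂.refl

    value-reversed : ∀ {p q} (e : Edge p q) → value (reversed 𝒟 (reversed 𝒟 e)) ≡ value e
    value-reversed e = value-cong (reversed 𝒟 (reversed 𝒟 e)) e
      (∈-reversed⁻ e ∘ ∈-reversed⁻ (reversed 𝒟 e)) (∈-reversed (reversed 𝒟 e) ∘ ∈-reversed e)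
        (λ _ → refl)

    value-there-and-back : ∀ {p q} (e f : Edge p q) → value e ≡ value f →
      value (reversed 𝒟 e) ≡ value (reversed 𝒟 f) → ∀ s x →
        step s e ∙ (step (s ℙ.⁻¹) (reversed 𝒟 f) ∙ x) ≈ʷ x
    value-there-and-back e f eq _ 0ℙ x rewrite value-reversed f | eq =
      F₂ₚ.\\-leftDividesˡ (value f) x
    value-there-and-back e f _ eq 1ℙ x rewrite eq = F₂ₚ.\\-leftDividesʳ (value (reversed 𝒟 f)) x

    domino-nonempty : ∀ {D} → Domino 𝒟 D → ∃[ i ] i ∈ D
    domino-nonempty (k , l , _ , refl) = k , Subset.p⊆p∪q ⁅ l ⁆ (Subset.x∈⁅x⁆ k)

    eval-cell : ∀ {p} {c : Star Edge p p} → DominoCell 𝒟 c → ∀ s → eval s c ≈ʷ 1ʷ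
    -- Reversing a loop changes only its sign, so its two passages have the same value and one of
    -- them is inverted.
    eval-cell (projectivePlane refl refl T) 0ℙ =
      F₂ₚ.\\-leftDividesˡ (value (loop {q = p∘ 𝒟} refl refl Sign.+ T)) 1ʷ
    eval-cell (projectivePlane refl refl T) 1ℙ =
      F₂ₚ.\\-leftDividesʳ (value (loop {q = p∘ 𝒟} refl refl Sign.+ T)) 1ʷ
    eval-cell (bigon _ e f flip) s = value-there-and-back e f (flip-value e f flip)
      (flip-value (reversed 𝒟 e) (reversed 𝒟 f)
        (subst₂ (Flip 𝒟) (sym (tiles-reversed e)) (sym (tiles-reversed f)) flip)) s 1ʷ
    eval-cell {p₁} (quadrilateral {p₂ = p₂} {p₃} {p₄} D D-domino D#p₃ p₂≡ f₁ f₂ f₃ f₄ perm₃ perm₄) =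
      λ { 0ℙ → cancel₀ even-heights ; 1ℙ → cancel₁ odd-heights }
      where
      r₁ = reversed 𝒟 f₁
      r₂ = reversed 𝒟 f₂
      r₃ = reversed 𝒟 f₃
      r₄ = reversed 𝒟 f₄
      D⊆p₂ : D ⊆ Plug.squares p₂
      D⊆p₂ i∈D = subst (_ ∈_) (sym p₂≡) (Subset.q⊆p∪q (Plug.squares p₃) D i∈D)
      nonempty : ∃[ i ] i ∈ D
      nonempty = domino-nonempty D-domino
      -- `D` lies in `p₂`, so no floor ending or starting at `p₂` contains it: if `D` is `d`, then
      -- `f₁` and `f₂` contribute nothing.
      D∉f₁ : ¬ D List.∈ tiles 𝒟 f₁
      D∉f₁ D∈ = proj₂ (tile-outside f₁ D∈ (proj₂ nonempty)) (D⊆p₂ (proj₂ nonempty))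
      D∉f₂ : ¬ D List.∈ tiles 𝒟 f₂
      D∉f₂ D∈ = proj₁ (tile-outside f₂ D∈ (proj₂ nonempty)) (D⊆p₂ (proj₂ nonempty))
      D∈f₃ : D List.∈ tiles 𝒟 f₃
      D∈f₃ = ∈-resp-↭ (↭-sym perm₃) (here refl)
      D∈f₄ : D List.∈ tiles 𝒟 f₄
      D∈f₄ = ∈-resp-↭ (↭-sym perm₄) (here refl)
      value-1 : ∀ {p q} (e : Edge p q) → ¬ d List.∈ tiles 𝒟 e → value e ≡ 1ʷ
      value-1 e d∉ = restrict-no (d ∈ᵗ? tiles 𝒟 e) (λ d∈ → contradiction d∈ d∉)
      other : ∀ {L L′} → D ≢ d → L′ ↭ D ∷ L → d List.∈ L′ → d List.∈ L
      other D≢d perm d∈ with ∈-resp-↭ perm d∈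
      ... | here eq   = contradiction (sym eq) D≢d
      ... | there d∈L = d∈L
      more : ∀ {L L′} → L′ ↭ D ∷ L → d List.∈ L → d List.∈ L′
      more perm d∈ = ∈-resp-↭ (↭-sym perm) (there d∈)
      even-heights : value f₁ ≡ value r₄ × value r₂ ≡ value f₃ ⊎
                     (value f₁ ≡ 1ʷ × value r₂ ≡ 1ʷ) × value f₃ ≡ value r₄
      even-heights with Vec.≡-dec Bool._≟_ D d
      ... | yes refl = inj₂ ((value-1 f₁ D∉f₁ , value-1 r₂ (D∉f₂ ∘ ∈-reversed⁻ f₂)) ,
        value-cong f₃ r₄ (λ _ → ∈-reversed f₄ D∈f₄) (λ _ → D∈f₃)
          -- Here `p₁` and `p₄` are the even ends of the two floors through `d`, which share the odd
          -- end `p₃`.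
          λ _ → same-height f₃ r₄ D∈f₃ (∈-reversed f₄ D∈f₄))
      ... | no D≢d = inj₁
        ( value-cong f₁ r₄ (∈-reversed f₄ ∘ more perm₄) (other D≢d perm₄ ∘ ∈-reversed⁻ f₄)
          (λ _ → refl)
        , value-cong r₂ f₃ (more perm₃ ∘ ∈-reversed⁻ f₂) (∈-reversed f₂ ∘ other D≢d perm₃)
          (λ _ → refl))
      odd-heights : value r₁ ≡ value f₄ × value f₂ ≡ value r₃ ⊎
                    (value r₁ ≡ 1ʷ × value f₂ ≡ 1ʷ) × value r₃ ≡ value f₄
      odd-heights with Vec.≡-dec Bool._≟_ D d
      ... | yes refl = inj₂ ((value-1 r₁ (D∉f₁ ∘ ∈-reversed⁻ f₁) , value-1 f₂ D∉f₂) ,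
        value-cong r₃ f₄ (λ _ → D∈f₄) (λ _ → ∈-reversed f₃ D∈f₃) (λ _ → refl))
      ... | no D≢d = inj₁
        ( value-cong r₁ f₄ (more perm₄ ∘ ∈-reversed⁻ f₁) (∈-reversed f₁ ∘ other D≢d perm₄)
            (λ d∈ → same-height r₁ f₄ d∈ (more perm₄ (∈-reversed⁻ f₁ d∈)))
        , value-cong f₂ r₃ (∈-reversed f₃ ∘ more perm₃) (other D≢d perm₃ ∘ ∈-reversed⁻ f₃)
            (λ d∈ → same-height f₂ r₃ d∈ (∈-reversed f₃ (more perm₃ d∈))))

    open EdgePaths (𝒞 𝒟)

    -- A first path of even length hands the starting parity on to the second; for this reason the
    -- homomorphism is defined on `G⁺`.
    eval-◅◅ : ∀ {p q r} s (γ : Path p q) (δ : Path q r) → parity (length γ) ≡ 0ℙ →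
              eval s (γ ◅◅ δ) ≡ eval s γ ∙ eval s δ
    eval-◅◅ s ε δ _ = refl
    eval-◅◅ s (e ◅ ε) δ ()
    eval-◅◅ s (e ◅ f ◅ γ) δ even =
      trans (cong (step s e ∙_) (trans (cong (step (s ℙ.⁻¹) f ∙_) (trans
        (cong (λ s → eval s (γ ◅◅ δ)) (ℙ.⁻¹-involutive s))
        (trans (eval-◅◅ s γ δ even)
          (cong (λ s′ → eval s′ γ ∙ eval s δ) (sym (ℙ.⁻¹-involutive s))))))
        (sym (List.++-assoc (step (s ℙ.⁻¹) f) _ (eval s δ)))))
      (sym (List.++-assoc (step s e) _ (eval s δ)))

    eval-cong : ∀ {p q} s {γ δ : Path p q} → γ ≃ δ → eval s γ ≈ʷ eval s δ
    eval-cong s ≃-refl = F₂.refl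
    eval-cong s (≃-sym eq) = F₂.sym (eval-cong s eq)
    eval-cong s (≃-trans eq eq′) = F₂.trans (eval-cong s eq) (eval-cong s eq′)
    eval-cong s (◅-cong {e = e} {f} eq eq′) =
      F₂.∙-cong (≡⇒≈ʷ (step-cong s)) (eval-cong (s ℙ.⁻¹) eq′)
      where
      step-cong : ∀ s → step s e ≡ step s f
      step-cong 0ℙ = sameEdge-value eq
      step-cong 1ℙ = cong _⁻¹ (sameEdge-value (TwoComplex.rev-cong (𝒞 𝒟) eq))
    eval-cong s (backtrack e γ) =
      F₂.trans (value-there-and-back e e refl refl s (eval ((s ℙ.⁻¹) ℙ.⁻¹) γ))
      (≡⇒≈ʷ (cong (λ s → eval s γ) (ℙ.⁻¹-involutive s)))
    eval-cong s (contract {c = c} a γ) = F₂.trans (≡⇒≈ʷ (eval-◅◅ s c γ (cells-even 𝒟 a)))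
      (F₂.∙-congʳ (eval-cell a s))

    eval-hom : GroupMorphisms.IsGroupHomomorphism (Group.rawGroup (G⁺ 𝒟)) (Group.rawGroup F₂)
      (λ g → eval 0ℙ (proj₁ g))
    eval-hom = record
      { isMonoidHomomorphism = record
        { isMagmaHomomorphism = record
          { isRelHomomorphism = record { cong = eval-cong 0ℙ }
          ; homo = λ g h → ≡⇒≈ʷ (eval-◅◅ 0ℙ (proj₁ g) (proj₁ h) (proj₂ g))
          }
        ; ε-homo = F₂.refl
        }
      ; ⁻¹-homo = λ g → F₂ₚ.inverseˡ-unique (eval 0ℙ (proj₁ (g ⁻¹⁺))) (eval 0ℙ (proj₁ g))
          (F₂.trans (F₂.sym (≡⇒≈ʷ (eval-◅◅ 0ℙ (proj₁ (g ⁻¹⁺)) (proj₁ g) (proj₂ (g ⁻¹⁺)))))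
            (eval-cong 0ℙ (Group.inverseˡ (G⁺ 𝒟) g)))
      }
      where _⁻¹⁺ = Group._⁻¹ (G⁺ 𝒟)

-- Connectivity of the complex

xorS : ∀ {n} → Subset n → Subset n → Subset n
xorS = Vec.zipWith _xor_

lookup-ext : ∀ {n} {R S : Subset n} → (∀ i → lookup R i ≡ lookup S i) → R ≡ S
lookup-ext {R = R} {S} eq =
  trans (sym (Vec.tabulate∘lookup R)) (trans (Vec.tabulate-cong eq) (Vec.tabulate∘lookup S))

-- Both sides count `c ∪ w`. Consequently `xorS c W` is balanced as soon as `c` has the size of `W`.
xor-count : ∀ {n} (c w : Subset n) → ∣ c ∣ ℕ.+ ∣ xorS c w ∩ w ∣ ≡ ∣ w ∣ ℕ.+ ∣ xorS c w ∩ ∁ w ∣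
xor-count Vec.[] Vec.[] = refl
xor-count (false Vec.∷ c) (false Vec.∷ w) = xor-count c w
xor-count (false Vec.∷ c) (true Vec.∷ w) = trans (ℕ.+-suc ∣ c ∣ _) (cong suc (xor-count c w))
xor-count (true Vec.∷ c) (false Vec.∷ w) = trans (cong suc (xor-count c w)) (sym (ℕ.+-suc ∣ w ∣ _))
xor-count (true Vec.∷ c) (true Vec.∷ w) = cong suc (xor-count c w)

∁-count : ∀ {n} (R w : Subset n) → ∣ R ∩ w ∣ ℕ.+ ∣ ∁ R ∩ w ∣ ≡ ∣ w ∣
∁-count Vec.[] Vec.[] = refl
∁-count (false Vec.∷ R) (false Vec.∷ w) = ∁-count R w
∁-count (false Vec.∷ R) (true Vec.∷ w) = trans (ℕ.+-suc ∣ R ∩ w ∣ _) (cong suc (∁-count R w))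
∁-count (true Vec.∷ R) (false Vec.∷ w) = ∁-count R w
∁-count (true Vec.∷ R) (true Vec.∷ w) = cong suc (∁-count R w)

∪-count : ∀ {n} (R S : Subset n) → ∣ R ∪ S ∣ ℕ.≤ ∣ R ∣ ℕ.+ ∣ S ∣
∪-count Vec.[] Vec.[] = ℕ.z≤n
∪-count (false Vec.∷ R) (false Vec.∷ S) = ∪-count R S
∪-count (false Vec.∷ R) (true Vec.∷ S) =
  ℕ.≤-trans (ℕ.s≤s (∪-count R S)) (ℕ.≤-reflexive (sym (ℕ.+-suc ∣ R ∣ ∣ S ∣)))
∪-count (true Vec.∷ R) (false Vec.∷ S) = ℕ.s≤s (∪-count R S)
∪-count (true Vec.∷ R) (true Vec.∷ S) =
  ℕ.s≤s (ℕ.≤-trans (∪-count R S) (ℕ.+-monoʳ-≤ ∣ R ∣ (ℕ.n≤1+n ∣ S ∣)))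

clear-count : ∀ {n} (R : Subset n) i → lookup R i ≡ true → suc ∣ R Vec.[ i ]≔ false ∣ ≡ ∣ R ∣
clear-count (true Vec.∷ R) Fin.zero _ = refl
clear-count (false Vec.∷ R) (Fin.suc i) eq = clear-count R i eq
clear-count (true Vec.∷ R) (Fin.suc i) eq = cong suc (clear-count R i eq)

set-count : ∀ {n} (R : Subset n) i → lookup R i ≡ false → ∣ R Vec.[ i ]≔ true ∣ ≡ suc ∣ R ∣
set-count (false Vec.∷ R) Fin.zero _ = refl
set-count (false Vec.∷ R) (Fin.suc i) eq = set-count R i eq
set-count (true Vec.∷ R) (Fin.suc i) eq = cong suc (set-count R i eq)

lookup-clear : ∀ {n} (R : Subset n) i j → lookup R j ≡ false → lookup (R Vec.[ i ]≔ false) j ≡ false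
lookup-clear R i j eq with j Fin.≟ i
... | yes refl = Vec.lookup∘update i R false
... | no j≢i = trans (Vec.lookup∘update′ j≢i R false) eq

lookup-⁅⁆ : ∀ {n} (i k : Fin n) → lookup ⁅ i ⁆ k ≡ does (k Fin.≟ i)
lookup-⁅⁆ i k with k Fin.≟ i
... | yes refl = ∈⇒true (Subset.x∈⁅x⁆ i)
... | no k≢i = ∉⇒false (Subset.x≢y⇒x∉⁅y⁆ k≢i)

-- A square of `T` outside `S` is skipped as long as the rest of `T` can still supply `k` squares;
-- otherwise `k` equals the size of all that is left of `T`, and everything is taken.
interpolate : ∀ {n} (S T : Subset n) k → S ⊆ T → ∣ S ∣ ℕ.≤ k → k ℕ.≤ ∣ T ∣ →
  ∃[ c ] (S ⊆ c × c ⊆ T × ∣ c ∣ ≡ k)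
interpolate Vec.[] Vec.[] .0 _ _ ℕ.z≤n = Vec.[] , id , id , refl
interpolate (true Vec.∷ S) (false Vec.∷ T) k S⊆T _ _ = contradiction (S⊆T Vec.here) λ ()
interpolate (false Vec.∷ S) (false Vec.∷ T) k S⊆T S≤k k≤T with interpolate S T k
  (Subset.drop-∷-⊆ S⊆T) S≤k k≤T
... | c , S⊆c , c⊆T , eq = false Vec.∷ c , Subset.s⊆s S⊆c , Subset.s⊆s c⊆T , eq
interpolate (true Vec.∷ S) (true Vec.∷ T) (suc k) S⊆T (ℕ.s≤s S≤k) (ℕ.s≤s k≤T)
  with interpolate S T k (Subset.drop-∷-⊆ S⊆T) S≤k k≤T
... | c , S⊆c , c⊆T , eq = true Vec.∷ c , Subset.s⊆s S⊆c , Subset.s⊆s c⊆T , cong suc eq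
interpolate (false Vec.∷ S) (true Vec.∷ T) k S⊆T S≤k k≤T with k ℕ.≤? ∣ T ∣
... | yes k≤T′ with c , S⊆c , c⊆T , eq ← interpolate S T k (Subset.drop-∷-⊆ S⊆T) S≤k k≤T′ =
  false Vec.∷ c , Subset.s⊆s S⊆c , Subset.out⊆ c⊆T , eq
... | no k≰T = T′ k≤T k≰T
  where
  S⊆T′ : S ⊆ T
  S⊆T′ = Subset.drop-∷-⊆ S⊆T
  T′ : ∀ {k} → k ℕ.≤ suc ∣ T ∣ → ¬ k ℕ.≤ ∣ T ∣ →
    ∃[ c ] ((false Vec.∷ S) ⊆ c × c ⊆ (true Vec.∷ T) × ∣ c ∣ ≡ k)
  T′ k≤1+T k≰T = true Vec.∷ T , Subset.out⊆ S⊆T′ , id , ℕ.≤-antisym (ℕ.≰⇒> k≰T) k≤1+T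

module Configurations (𝒟 : QuadriculatedDisk) (balanced : Balanced 𝒟 ⊤) where
  open QuadriculatedDisk 𝒟 using (size)
  open Graph 𝒟
  open Tilings 𝒟
  open Plug using (squares)

  plug-≡ : ∀ {p q : Plug 𝒟} → squares p ≡ squares q → p ≡ q
  plug-≡ refl = refl

  ∣W∣≡∣∁W∣ : ∣ W ∣ ≡ ∣ ∁ W ∣
  ∣W∣≡∣∁W∣ = trans (cong ∣_∣ (sym (Subset.∩-identityˡ W)))
    (trans balanced (cong ∣_∣ (Subset.∩-identityˡ (∁ W))))

  complement-balanced : ∀ R → Balanced 𝒟 R → Balanced 𝒟 (∁ R)
  complement-balanced R eq = ℕ.+-cancelˡ-≡ ∣ R ∩ W ∣ _ _ (trans (∁-count R W) (trans ∣W∣≡∣∁W∣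
    (trans (sym (∁-count R (∁ W))) (cong (ℕ._+ ∣ ∁ R ∩ ∁ W ∣) (sym eq)))))

  complement : Plug 𝒟 → Plug 𝒟
  complement (plug R eq) = plug (∁ R) (complement-balanced R eq)

  -- A plug in the twisted form of `config`: balance becomes a fixed cardinality, and adding or
  -- removing a domino moves one element to an adjacent square. The irrelevant field makes equality
  -- a matter of bits.
  record Configuration : Set where
    constructor configuration
    field
      bits   : Region 𝒟
      .count : ∣ bits ∣ ≡ ∣ W ∣
  open Configuration

  _!_ : Configuration → Fin size → Bool
  c ! i = lookup (bits c) i

  configuration-≡ : ∀ {c c′} → (∀ i → c ! i ≡ c′ ! i) → c ≡ c′
  configuration-≡ {c} {c′} eq = same (lookup-ext eq)
    where
    same : ∀ {c c′} → bits c ≡ bits c′ → c ≡ c′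
    same refl = refl

  xor-balanced : ∀ c → ∣ c ∣ ≡ ∣ W ∣ → Balanced 𝒟 (xorS c W)
  xor-balanced c eq = ℕ.+-cancelˡ-≡ ∣ W ∣ _ _
    (trans (cong (ℕ._+ ∣ xorS c W ∩ W ∣) (sym eq)) (xor-count c W))

  plugOf : Configuration → Plug 𝒟
  plugOf (configuration c eq) = plug (xorS c W) (xor-balanced c eq)

  lookup-plugOf : ∀ c i → lookup (squares (plugOf c)) i ≡ (c ! i) xor lookup W i
  lookup-plugOf c i = Vec.lookup-zipWith _xor_ i (bits c) W

  config-plugOf : ∀ c i → config (plugOf c) i ≡ c ! i
  config-plugOf c i = trans (cong (_xor lookup W i) (lookup-plugOf c i))
    (trans (Bool.xor-assoc (c ! i) (lookup W i) (lookup W i))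
      (trans (cong ((c ! i) xor_) (Bool.xor-same (lookup W i))) (Bool.xor-identityʳ (c ! i))))

  exchange : ∀ (c : Configuration) i j → .(c ! i ≡ true) → .(c ! j ≡ false) → Configuration
  exchange (configuration c eq) i j hi lo = configuration (c Vec.[ i ]≔ false Vec.[ j ]≔ true)
    (trans (set-count (c Vec.[ i ]≔ false) j (lookup-clear c i j lo))
      (trans (clear-count c i hi) eq))

  exchanged : (Fin size → Bool) → Fin size → Fin size → Fin size → Bool
  exchanged f i j k = Bool.if does (k Fin.≟ j) then true else Bool.if does
    (k Fin.≟ i) then false else f k

  exchange-! : ∀ c i j .(hi : c ! i ≡ true) .(lo : c ! j ≡ false) k →
               exchange c i j hi lo ! k ≡ exchanged (c !_) i j k
  exchange-! (configuration c _) i j hi lo k with k Fin.≟ j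
  ... | yes refl = Vec.lookup∘update k (c Vec.[ i ]≔ false) true
  ... | no k≢j with k Fin.≟ i
  ...   | yes refl = trans (Vec.lookup∘update′ k≢j (c Vec.[ k ]≔ false) true)
        (Vec.lookup∘update k c false)
  ...   | no k≢i = trans (Vec.lookup∘update′ k≢j (c Vec.[ i ]≔ false) true)
        (Vec.lookup∘update′ k≢i c false)

  p∘-plugOf : p∘ 𝒟 ≡ plugOf (configuration W refl)
  p∘-plugOf = plug-≡ (lookup-ext λ i → trans (Vec.lookup-replicate i false)
    (sym (trans (lookup-plugOf (configuration W refl) i) (Bool.xor-same (lookup W i)))))

-- What surjectivity needs from the geometry: `x′` and `y′` give a way around `d`, and the strict
-- bounds leave room for extreme plugs next to which `d` can be crossed.
record Bottleneck (𝒟 : QuadriculatedDisk) (d : Region 𝒟) : Set where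
  open QuadriculatedDisk 𝒟 using (size)
  open Graph 𝒟
  field
    x y x′ y′    : Fin size
    xy           : Adj x y
    xx′          : Adj x x′
    x′y′         : Adj x′ y′
    y′y          : Adj y′ y
    d≡           : d ≡ ⁅ x ⁆ ∪ ⁅ y ⁆
    x′∉d         : x′ ∉ d
    y′∉d         : y′ ∉ d
    x-white      : lookup W x ≡ true
    C₁ C₂        : Region 𝒟
    C₁⊆∁d        : C₁ ⊆ ∁ d
    C₂⊆∁d        : C₂ ⊆ ∁ d
    closed₁      : Closed (∁ d) C₁
    closed₂      : Closed (∁ d) C₂
    C₁-nonempty  : Nonempty C₁
    C₁#C₂        : ∀ {i} → i ∈ C₁ → i ∉ C₂
    flanks       : ∀ {Q} → TwoByTwo 𝒟 Q → d ⊆ Q → ∀ {i} → i ∈ Q → i ∉ d → i ∈ C₁ ⊎ i ∈ C₂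
    small₁       : ∣ C₁ ∣ ℕ.< ∣ W ∣
    small₂       : ∣ C₂ ∣ ℕ.< ∣ W ∣

  d-domino : Domino 𝒟 d
  d-domino = x , y , xy , d≡

-- Even paths with a prescribed word

module Surjectivity (𝒟 : QuadriculatedDisk) (balanced : Balanced 𝒟 ⊤) {d : Region 𝒟}
  (bottleneck : Bottleneck 𝒟 d) where
  open QuadriculatedDisk 𝒟 using (size)
  open Graph 𝒟
  open Tilings 𝒟
  open Configurations 𝒟 balanced
  open Configuration
  open Bottleneck bottleneck
  open Weights d d-domino C₁ C₂ C₁⊆∁d C₂⊆∁d closed₁ closed₂ flanks
  open Plug using (squares)
  open EdgePaths (𝒞 𝒟)
  open FreeGroup (Fin 2) using (Word; Letter) renaming (_≈_ to _≈ʷ_)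
  open Group F₂ using (_∙_; _⁻¹) renaming (ε to 1ʷ)

  Linked : Plug 𝒟 → Plug 𝒟 → Word → Set
  Linked p q w = Σ[ γ ∈ Path p q ] (parity (length γ) ≡ 0ℙ × eval 0ℙ γ ≈ʷ w)

  parity-◅◅ : ∀ {p q r} (γ : Path p q) (δ : Path q r) → parity (length γ) ≡ 0ℙ →
              parity (length (γ ◅◅ δ)) ≡ parity (length δ)
  parity-◅◅ ε δ _ = refl
  parity-◅◅ (e ◅ ε) δ ()
  parity-◅◅ (e ◅ f ◅ γ) δ even = parity-◅◅ γ δ even

  link-trans : ∀ {p q r w w′} → Linked p q w → Linked q r w′ → Linked p r (w ∙ w′)
  link-trans (γ , even , eq) (δ , even′ , eq′) = γ ◅◅ δ , trans (parity-◅◅ γ δ even) even′ ,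
    F₂.trans (≡⇒≈ʷ (eval-◅◅ 0ℙ γ δ even)) (F₂.∙-cong eq eq′)

  d⊆ : ∀ {i} → i ∈ d → i ≡ x ⊎ i ≡ y
  d⊆ i∈d = Sum.map (Subset.x∈⁅y⁆⇒x≡y x) (Subset.x∈⁅y⁆⇒x≡y y)
    (Subset.x∈p∪q⁻ ⁅ x ⁆ ⁅ y ⁆ (subst (_ ∈_) d≡ i∈d))

  x∈d : x ∈ d
  x∈d = subst (x ∈_) (sym d≡) (Subset.p⊆p∪q ⁅ y ⁆ (Subset.x∈⁅x⁆ x))

  y∈d : y ∈ d
  y∈d = subst (y ∈_) (sym d≡) (Subset.q⊆p∪q ⁅ x ⁆ ⁅ y ⁆ (Subset.x∈⁅x⁆ y))

  -- The squares x and y′ are distinct and have the same colour.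
  domino-≢⊤ : ∀ {D} → Domino 𝒟 D → D ≢ ⊤
  domino-≢⊤ (k , l , kl , refl) full = clash (member x) (member y′)
    where
    member : ∀ i → i ≡ k ⊎ i ≡ l
    member i = Sum.map (Subset.x∈⁅y⁆⇒x≡y k) (Subset.x∈⁅y⁆⇒x≡y l)
      (Subset.x∈p∪q⁻ ⁅ k ⁆ ⁅ l ⁆ (subst (i ∈_) (sym full) Subset.∈⊤))
    x≢y′ : x ≢ y′
    x≢y′ refl = y′∉d x∈d
    same : lookup W x ≡ lookup W y′
    same = trans (adjacent-white xy) (sym (adjacent-white y′y))
    clash : x ≡ k ⊎ x ≡ l → y′ ≡ k ⊎ y′ ≡ l → Empty.⊥
    clash (inj₁ refl) (inj₁ refl) = x≢y′ refl
    clash (inj₁ refl) (inj₂ refl) = Bool.not-¬ same (adjacent-white kl)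
    clash (inj₂ refl) (inj₁ refl) = Bool.not-¬ (sym same) (adjacent-white kl)
    clash (inj₂ refl) (inj₂ refl) = x≢y′ refl

  stepValue : Region 𝒟 → Plug 𝒟 → Word
  stepValue D p = restrict (d ∈ᵗ? (D ∷ [])) (weight p)

  stepValue-≢ : ∀ {D} p → D ≢ d → stepValue D p ≡ 1ʷ
  stepValue-≢ {D} p D≢d = restrict-no (d ∈ᵗ? (D ∷ [])) λ { (here eq) → contradiction (sym eq) D≢d }

  stepValue-≡ : ∀ p → stepValue d p ≡ weight p
  stepValue-≡ p = restrict-cong (d ∈ᵗ? (d ∷ [])) (yes (refl {x = d})) (λ _ → refl)
    (λ _ → here refl) (λ _ → refl)

  -- Through the complement of p ∪ D, a domino D can be added to or removed from a plug.
  module _ {p p′ : Plug 𝒟} {D : Region 𝒟} (D-domino : Domino 𝒟 D) (D#p : Disjoint 𝒟 D (squares p))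
    (p′≡ : squares p′ ≡ squares p ∪ D) where
    private
      r : Plug 𝒟
      r = complement p′

      p⊆p′ : squares p ⊆ squares p′
      p⊆p′ i∈p = subst (_ ∈_) (sym p′≡) (Subset.p⊆p∪q D i∈p)

      D⊆p′ : D ⊆ squares p′
      D⊆p′ i∈D = subst (_ ∈_) (sym p′≡) (Subset.q⊆p∪q (squares p) D i∈D)

      covers′ : ∀ {i} → i ∈ squares p′ → i ∈ squares p ⊎ i ∈ D
      covers′ i∈p′ = Subset.x∈p∪q⁻ (squares p) D (subst (_ ∈_) p′≡ i∈p′)

      -- Were `p` the complement of `p′`, which contains `p`, it would be empty and `D` would be the
      -- whole disk. Distinct ends are required by `join`.
      p≢r : p ≢ r
      p≢r eq = domino-≢⊤ D-domino (Subset.⊆-antisym Subset.⊆⊤ λ {i} _ → everything i)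
        where
        p-empty : ∀ i → i ∉ squares p
        p-empty i i∈p = Subset.x∈∁p⇒x∉p (subst (λ q → i ∈ squares q) eq i∈p) (p⊆p′ i∈p)
        everything : ∀ i → i ∈ D
        everything i = [ (λ i∈p → contradiction i∈p (p-empty i)) , id ]′
          (covers′ (Subset.x∉∁p⇒x∈p λ i∈r → p-empty i (subst (λ q → i ∈ squares q) (sym eq) i∈r)))

      r≢p′ : r ≢ p′
      r≢p′ eq = Subset.x∈∁p⇒x∉p (subst (λ q → i ∈ squares q) (sym eq) i∈p′) i∈p′
        where
        i = proj₁ (domino-nonempty D-domino)
        i∈p′ = D⊆p′ (proj₂ (domino-nonempty D-domino))

      tiled : D ≡ ∁ (squares p ∪ ∁ (squares p′))
      tiled = Subset.⊆-antisym
        (λ i∈D → Subset.x∉p⇒x∈∁p λ i∈ → [ (λ i∈p → D#p (_ , Subset.x∈p∩q⁺ (i∈D , i∈p))) ,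
          (λ i∈r → Subset.x∈∁p⇒x∉p i∈r (D⊆p′ i∈D)) ]′ (Subset.x∈p∪q⁻ (squares p) _ i∈))
        (λ i∈ → [ (λ i∈p → contradiction (Subset.x∈p∪q⁺ (inj₁ i∈p)) (Subset.x∈∁p⇒x∉p i∈)) , id ]′
          (covers′ (Subset.x∉∁p⇒x∈p λ i∈r → Subset.x∈∁p⇒x∉p i∈ (Subset.x∈p∪q⁺ (inj₂ i∈r)))))

      untiled : ⊥ ≡ ∁ (∁ (squares p′) ∪ squares p′)
      untiled = Subset.⊆-antisym Subset.⊥⊆ λ i∈ → contradiction
        (Subset.x∈p∪q⁺ (inj₁ (Subset.x∉p⇒x∈∁p λ i∈p′ →
          Subset.x∈∁p⇒x∉p i∈ (Subset.x∈p∪q⁺ (inj₂ i∈p′)))))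
        (Subset.x∈∁p⇒x∉p i∈)

      across : Edge p r
      across = join p≢r (λ (_ , i∈) → let (i∈p , i∈r) = Subset.x∈p∩q⁻ (squares p) _ i∈ in
          Subset.x∈∁p⇒x∉p i∈r (p⊆p′ i∈p))
        record { dominoes = D ∷ [] ; domino = D-domino ∷ [] ; disjoint = [] ∷ []
               ; covers = trans (Subset.∪-identityʳ D) tiled }

      up : Edge r p′
      up = join r≢p′ (λ (_ , i∈) → let (i∈r , i∈p′) = Subset.x∈p∩q⁻ _ (squares p′) i∈ in
          Subset.x∈∁p⇒x∉p i∈r i∈p′)
        record { dominoes = [] ; domino = [] ; disjoint = [] ; covers = untiled }

    add : Linked p p′ (stepValue D p)
    add = across ◅ up ◅ ε , refl , ≡⇒≈ʷ (List.++-identityʳ (stepValue D p))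

    remove : Linked p′ p (stepValue D p ⁻¹)
    -- Here `p` is the even end at the close of the path, so its weight is read again, now inverted.
    remove = reversed 𝒟 up ◅ reversed 𝒟 across ◅ ε , refl ,
      ≡⇒≈ʷ (List.++-identityʳ (stepValue D p ⁻¹))

  _~_ : Configuration → Configuration → Set
  c ~ c′ = Linked (plugOf c) (plugOf c′) 1ʷ

  ~-refl : ∀ {c} → c ~ c
  ~-refl = ε , refl , F₂.refl

  ~-trans : ∀ {c c′ c″} → c ~ c′ → c′ ~ c″ → c ~ c″
  ~-trans = link-trans

  ≡⇒~ : ∀ {c c′} → c ≡ c′ → c ~ c′
  ≡⇒~ {c} refl = ~-refl {c}

  module _ (c : Configuration) {i j} (ij : Adj i j) (hi : c ! i ≡ true) (lo : c ! j ≡ false) where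
    private
      c′ = exchange c i j hi lo
      D = ⁅ i ⁆ ∪ ⁅ j ⁆
      i≢j = adjacent-distinct ij

      off : ∀ c k → c ! k ≡ lookup W k → k ∉ squares (plugOf c)
      off c k eq = false⇒∉ (trans (lookup-plugOf c k)
        (trans (cong (_xor lookup W k) eq) (Bool.xor-same (lookup W k))))

      D-disjoint : ∀ c → c ! i ≡ lookup W i → c ! j ≡ lookup W j → Disjoint 𝒟 D (squares (plugOf c))
      D-disjoint c eqi eqj (k , k∈) with Subset.x∈p∩q⁻ D (squares (plugOf c)) k∈
      ... | k∈D , k∈c with Subset.x∈p∪q⁻ ⁅ i ⁆ ⁅ j ⁆ k∈D
      ...   | inj₁ k∈i with refl ← Subset.x∈⁅y⁆⇒x≡y i k∈i = off c k eqi k∈c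
      ...   | inj₂ k∈j with refl ← Subset.x∈⁅y⁆⇒x≡y j k∈j = off c k eqj k∈c

      exchanged-i : c′ ! i ≡ false
      exchanged-i = trans (exchange-! c i j hi lo i) (lemma (i Fin.≟ j) (i Fin.≟ i))
        where
        lemma : (a : Dec (i ≡ j)) (b : Dec (i ≡ i)) →
          (Bool.if does a then true else Bool.if does b then false else (c ! i)) ≡ false
        lemma (yes eq) _       = contradiction eq i≢j
        lemma (no _) (yes _)   = refl
        lemma (no _) (no i≢i)  = contradiction refl i≢i

      exchanged-j : c′ ! j ≡ true
      exchanged-j = trans (exchange-! c i j hi lo j) (lemma (j Fin.≟ j))
        where
        lemma : (a : Dec (j ≡ j)) →
          (Bool.if does a then true else Bool.if does (j Fin.≟ i) then false else (c ! j)) ≡ true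
        lemma (yes _)   = refl
        lemma (no j≢j)  = contradiction refl j≢j

      union : ∀ (c₀ c₁ : Configuration) → c₀ ! i ≡ lookup W i → c₀ ! j ≡ lookup W j →
              (c₁ ! i ≡ not (lookup W i)) → (c₁ ! j ≡ not (lookup W j)) →
              (∀ k → k ≢ i → k ≢ j → c₁ ! k ≡ c₀ ! k) →
              squares (plugOf c₁) ≡ squares (plugOf c₀) ∪ D
      union c₀ c₁ i₀ j₀ i₁ j₁ rest = lookup-ext λ k → trans (lookup-plugOf c₁ k) (sym
          (trans (Vec.lookup-zipWith Bool._∨_ k (squares (plugOf c₀)) D)
            (trans (cong₂ Bool._∨_ (lookup-plugOf c₀ k)
              (trans (Vec.lookup-zipWith Bool._∨_ k ⁅ i ⁆ ⁅ j ⁆)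
              (cong₂ Bool._∨_ (lookup-⁅⁆ i k) (lookup-⁅⁆ j k)))) (at k (k Fin.≟ i) (k Fin.≟ j)))))
        where
        not-xor : ∀ b → not b xor b ≡ true
        not-xor true  = refl
        not-xor false = refl
        at : ∀ k (a : Dec (k ≡ i)) (b : Dec (k ≡ j)) →
             ((c₀ ! k) xor lookup W k) Bool.∨ (does a Bool.∨ does b) ≡ (c₁ ! k) xor lookup W k
        at k (yes refl) _ = trans (Bool.∨-zeroʳ _)
          (sym (trans (cong (_xor lookup W k) i₁) (not-xor (lookup W k))))
        at k (no _) (yes refl) =
          trans (Bool.∨-zeroʳ _) (sym (trans (cong (_xor lookup W k) j₁) (not-xor (lookup W k))))
        at k (no k≢i) (no k≢j) =
          trans (Bool.∨-identityʳ _) (sym (cong (_xor lookup W k) (rest k k≢i k≢j)))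

      unchanged : ∀ k → k ≢ i → k ≢ j → c′ ! k ≡ c ! k
      unchanged k k≢i k≢j = trans (exchange-! c i j hi lo k) (lemma (k Fin.≟ j) (k Fin.≟ i))
        where
        lemma : (a : Dec (k ≡ j)) (b : Dec (k ≡ i)) →
          (Bool.if does a then true else Bool.if does b then false else (c ! k)) ≡ c ! k
        lemma (yes eq) _       = contradiction eq k≢j
        lemma (no _) (yes eq)  = contradiction eq k≢i
        lemma (no _) (no _)    = refl

    white-exchange : lookup W i ≡ true → Linked (plugOf c) (plugOf c′) (stepValue D (plugOf c)) ×
                                         Linked (plugOf c′) (plugOf c) (stepValue D (plugOf c) ⁻¹)
    white-exchange i-white = add (i , j , ij , refl) D#c c′≡ , remove (i , j , ij , refl) D#c c′≡
      where
      j-black : lookup W j ≡ false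
      j-black = trans (adjacent-white (adjacent-sym ij)) (cong not i-white)
      eqi = trans hi (sym i-white)
      eqj = trans lo (sym j-black)
      D#c = D-disjoint c eqi eqj
      c′≡ = union c c′ eqi eqj (trans exchanged-i (sym (cong not i-white)))
        (trans exchanged-j (sym (cong not j-black))) unchanged

    -- For white `i` both squares lie outside the plug and the exchange adds the domino; for black
    -- `i` both lie inside and the exchange removes it.
    exchange-edge : D ≢ d → c ~ c′
    exchange-edge D≢d with lookup W i in colour
    ... | true  = subst (Linked (plugOf c) (plugOf c′)) (stepValue-≢ (plugOf c) D≢d)
          (proj₁ (white-exchange colour))
    ... | false = subst (Linked (plugOf c) (plugOf c′)) (cong _⁻¹ (stepValue-≢ (plugOf c′) D≢d))
          (remove (i , j , ij , refl) (D-disjoint c′ eqi eqj)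
            (union c′ c eqi eqj (trans hi (sym (cong not colour)))
              (trans lo (sym (cong not j-white)))
              (λ k k≢i k≢j → sym (unchanged k k≢i k≢j))))
      where
      j-white : lookup W j ≡ true
      j-white = trans (adjacent-white (adjacent-sym ij)) (cong not colour)
      eqi = trans exchanged-i (sym colour)
      eqj = trans exchanged-j (sym j-white)

  Adj° : Fin size → Fin size → Set
  Adj° i j = Adj i j × ⁅ i ⁆ ∪ ⁅ j ⁆ ≢ d

  exchanged-same : ∀ (f g : Fin size → Bool) i j k → f k ≡ g k →
    exchanged f i j k ≡ exchanged g i j k
  exchanged-same f g i j k eq with k Fin.≟ j | k Fin.≟ i
  ... | yes _ | _     = refl
  ... | no _  | yes _ = refl
  ... | no _  | no _  = eq

  -- If the intermediate square m has the value false, the pair of values at i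
  -- and j is exchanged by moving the value true from i to m and then from m
  -- to j; if it has the value true, the two moves are made in the other order.
  exchange-via-false : ∀ (f : Fin size → Bool) i m j → f m ≡ false → i ≢ m → ∀ k →
                       exchanged (exchanged f i m) m j k ≡ exchanged f i j k
  exchange-via-false f i m j lo i≢m k with k Fin.≟ j | k Fin.≟ m | k Fin.≟ i
  ... | yes _ | _        | _        = refl
  ... | no _  | yes refl | yes refl = refl
  ... | no _  | yes refl | no _     = sym lo
  ... | no _  | no _     | _        = refl

  exchange-via-true : ∀ (f : Fin size → Bool) i m j → f m ≡ true → i ≢ m → m ≢ j → ∀ k → i ≢ j →
                      exchanged (exchanged f m j) i m k ≡ exchanged f i j k
  exchange-via-true f i m j hi i≢m m≢j k i≢j with k Fin.≟ j | k Fin.≟ m | k Fin.≟ i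
  ... | yes refl | yes refl | _        = refl
  ... | yes refl | no _     | yes refl = contradiction refl i≢j
  ... | yes refl | no _     | no _     = refl
  ... | no _     | yes refl | yes refl = contradiction refl i≢m
  ... | no _     | yes refl | no _     = sym hi
  ... | no _     | no _     | yes _    = refl
  ... | no _     | no _     | no _     = refl

  exchanged-target : ∀ (f : Fin size → Bool) i j → exchanged f i j j ≡ true
  exchanged-target f i j with j Fin.≟ j
  ... | yes _  = refl
  ... | no j≢j = contradiction refl j≢j

  exchanged-source : ∀ (f : Fin size → Bool) i j → i ≢ j → exchanged f i j i ≡ false
  exchanged-source f i j i≢j with i Fin.≟ j | i Fin.≟ i
  ... | yes eq | _      = contradiction eq i≢j
  ... | no _   | yes _  = refl
  ... | no _   | no i≢i = contradiction refl i≢i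

  exchanged-other : ∀ (f : Fin size → Bool) i j k → k ≢ i → k ≢ j → exchanged f i j k ≡ f k
  exchanged-other f i j k k≢i k≢j with k Fin.≟ j | k Fin.≟ i
  ... | yes eq | _      = contradiction eq k≢j
  ... | no _   | yes eq = contradiction eq k≢i
  ... | no _   | no _   = refl

  hi≢lo : ∀ c {i j} → c ! i ≡ true → c ! j ≡ false → i ≢ j
  hi≢lo c hi lo refl = contradiction (trans (sym hi) lo) λ ()

  exchange-along : ∀ {i j} → Star Adj° i j → ∀ c (hi : c ! i ≡ true) (lo : c ! j ≡ false) →
                   c ~ exchange c i j hi lo
  exchange-along ε c hi lo = contradiction refl (hi≢lo c hi lo)
  exchange-along {i} {j} (_◅_ {j = m} (im , ≢d) path) c hi lo with c ! m in value-m
  ... | false = via (m Fin.≟ j)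
    where
    c₁ = exchange c i m hi value-m
    i≢m = adjacent-distinct im
    via : Dec (m ≡ j) → c ~ exchange c i j hi lo
    -- If `m` is already `j`, one exchange suffices and the remaining closed path is dropped.
    via (yes refl) = exchange-edge c im hi lo ≢d
    via (no m≢j) = ~-trans {c} {c₁} {exchange c i j hi lo} (exchange-edge c im hi value-m ≢d)
      (subst (c₁ ~_) (configuration-≡ {exchange c₁ m j hi₁ lo₁} {exchange c i j hi lo} λ k →
        trans (exchange-! c₁ m j hi₁ lo₁ k)
        (trans (exchanged-same (c₁ !_) (exchanged (c !_) i m) m j k (exchange-! c i m hi value-m k))
          (trans (exchange-via-false (c !_) i m j value-m i≢m k) (sym (exchange-! c i j hi lo k)))))
        (exchange-along path c₁ hi₁ lo₁))
      where
      hi₁ : c₁ ! m ≡ true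
      hi₁ = trans (exchange-! c i m hi value-m m) (exchanged-target (c !_) i m)
      lo₁ : c₁ ! j ≡ false
      lo₁ = trans (exchange-! c i m hi value-m j)
        (trans (exchanged-other (c !_) i m j (≢-sym (hi≢lo c hi lo)) (≢-sym m≢j)) lo)
  ... | true = ~-trans {c} {c₁} {exchange c i j hi lo} (exchange-along path c value-m lo)
      (subst (c₁ ~_) (configuration-≡ {exchange c₁ i m hi₁ lo₁} {exchange c i j hi lo} λ k →
        trans (exchange-! c₁ i m hi₁ lo₁ k)
        (trans (exchanged-same (c₁ !_) (exchanged (c !_) m j) i m k (exchange-! c m j value-m lo k))
          (trans (exchange-via-true (c !_) i m j value-m i≢m m≢j k i≢j)
            (sym (exchange-! c i j hi lo k)))))
        (exchange-edge c₁ im hi₁ lo₁ ≢d))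
    where
    c₁ = exchange c m j value-m lo
    i≢m = adjacent-distinct im
    i≢j = hi≢lo c hi lo
    m≢j = hi≢lo c value-m lo
    hi₁ : c₁ ! i ≡ true
    hi₁ = trans (exchange-! c m j value-m lo i) (trans (exchanged-other (c !_) m j i i≢m i≢j) hi)
    lo₁ : c₁ ! m ≡ false
    lo₁ = trans (exchange-! c m j value-m lo m) (exchanged-source (c !_) m j m≢j)

  off-d : ∀ {i j z} → z ∈ ⁅ i ⁆ ∪ ⁅ j ⁆ → z ∉ d → ⁅ i ⁆ ∪ ⁅ j ⁆ ≢ d
  off-d z∈ z∉d refl = z∉d z∈

  detour : Star Adj° x y
  detour = (xx′ , off-d (Subset.q⊆p∪q ⁅ x ⁆ ⁅ x′ ⁆ (Subset.x∈⁅x⁆ x′)) x′∉d)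
         ◅ (x′y′ , off-d (Subset.p⊆p∪q ⁅ y′ ⁆ (Subset.x∈⁅x⁆ x′)) x′∉d)
         ◅ (y′y , off-d (Subset.p⊆p∪q ⁅ y ⁆ (Subset.x∈⁅x⁆ y′)) y′∉d) ◅ ε

  Adj°-sym : ∀ {i j} → Adj° i j → Adj° j i
  Adj°-sym {i} {j} (ij , ≢d) = adjacent-sym ij , λ eq → ≢d (trans (Subset.∪-comm ⁅ i ⁆ ⁅ j ⁆) eq)

  connected° : ∀ i j → Star Adj° i j
  connected° i j = Star.concat (Star.map replace (disk-connected i j))
    where
    replace : ∀ {k l} → Adj k l → Star Adj° k l
    replace {k} {l} kl with Vec.≡-dec Bool._≟_ (⁅ k ⁆ ∪ ⁅ l ⁆) d
    ... | no ≢d = (kl , ≢d) ◅ ε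
    ... | yes eq with d⊆ (subst (k ∈_) eq (Subset.p⊆p∪q ⁅ l ⁆ (Subset.x∈⁅x⁆ k)))
                    | d⊆ (subst (l ∈_) eq (Subset.q⊆p∪q ⁅ k ⁆ ⁅ l ⁆ (Subset.x∈⁅x⁆ l)))
    ...   | inj₁ refl | inj₁ refl = contradiction refl (adjacent-distinct kl)
    ...   | inj₁ refl | inj₂ refl = detour
    ...   | inj₂ refl | inj₁ refl = Star.reverse Adj°-sym detour
    ...   | inj₂ refl | inj₂ refl = contradiction refl (adjacent-distinct kl)

  equal-by-count : ∀ {n} {R S : Subset n} → R ⊆ S → ∣ S ∣ ℕ.≤ ∣ R ∣ → S ⊆ R
  equal-by-count {R = R} R⊆S S≤R {i} i∈S = decidable-stable (i Subset.∈? R)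
    λ i∉R → ℕ.<⇒≱ (Subset.p⊂q⇒∣p∣<∣q∣ (R⊆S , i , i∈S , i∉R)) S≤R

  bits-count : ∀ c → ∣ bits c ∣ ≡ ∣ W ∣
  bits-count (configuration c eq) = recompute (∣ c ∣ ℕ.≟ ∣ W ∣) eq

  -- Induction on the number of squares of `c` outside `c′`. As the sizes agree, a square `i` to be
  -- vacated comes with a square `j` to be filled, and `connected°` joins them without crossing `d`.
  all-linked : ∀ c c′ → c ~ c′
  all-linked c c′ = go ∣ bits c ∩ ∁ (bits c′) ∣ c ℕ.≤-refl
    where
    go : ∀ fuel c → ∣ bits c ∩ ∁ (bits c′) ∣ ℕ.≤ fuel → c ~ c′
    go fuel c bound with Fin.any? (λ i → (i Subset.∈? bits c) ×-dec ¬? (i Subset.∈? bits c′))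
    ... | no none = ≡⇒~ {c} {c′}
          (configuration-≡ {c} {c′} λ k → cong (λ R → lookup R k) (Subset.⊆-antisym c⊆c′
            (equal-by-count c⊆c′ (ℕ.≤-reflexive (trans (bits-count c′) (sym (bits-count c)))))))
      where
      c⊆c′ : bits c ⊆ bits c′
      c⊆c′ {i} i∈c = decidable-stable (i Subset.∈? bits c′) λ i∉c′ → none (i , i∈c , i∉c′)
    ... | yes (i , i∈c , i∉c′) with Fin.any?
          (λ j → (j Subset.∈? bits c′) ×-dec ¬? (j Subset.∈? bits c))
    ...   | no none = contradiction
            (equal-by-count c′⊆c (ℕ.≤-reflexive (trans (bits-count c) (sym (bits-count c′)))) i∈c)
              i∉c′
      where
      c′⊆c : bits c′ ⊆ bits c
      c′⊆c {j} j∈c′ = decidable-stable (j Subset.∈? bits c) λ j∉c → none (j , j∈c′ , j∉c)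
    ...   | yes (j , j∈c′ , j∉c) = descend fuel bound
      where
      hi = ∈⇒true i∈c
      lo = ∉⇒false j∉c
      c₁ = exchange c i j hi lo
      back : ∀ k → k ∈ bits c₁ → k ∉ bits c′ → k ∈ bits c × k ≢ i
      back k k∈c₁ k∉c′ = true⇒∈
        (trans (sym (trans (exchange-! c i j hi lo k) (exchanged-other (c !_) i j k k≢i k≢j)))
          (∈⇒true k∈c₁)) , k≢i
        where
        k≢j : k ≢ j
        k≢j refl = k∉c′ j∈c′
        k≢i : k ≢ i
        k≢i refl = false⇒∉ (trans (exchange-! c i j hi lo i)
          (exchanged-source (c !_) i j (hi≢lo c hi lo))) k∈c₁
      closer : ∣ bits c₁ ∩ ∁ (bits c′) ∣ ℕ.< ∣ bits c ∩ ∁ (bits c′) ∣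
      closer = Subset.p⊂q⇒∣p∣<∣q∣
        ( (λ {k} k∈ → let (k∈c₁ , k∈∁c′) = Subset.x∈p∩q⁻ (bits c₁) _ k∈ in
            Subset.x∈p∩q⁺ (proj₁ (back k k∈c₁ (Subset.x∈∁p⇒x∉p k∈∁c′)) , k∈∁c′))
        , i , Subset.x∈p∩q⁺ (i∈c , Subset.x∉p⇒x∈∁p i∉c′)
        , λ i∈ → proj₂ (back i (proj₁ (Subset.x∈p∩q⁻ (bits c₁) _ i∈)) i∉c′) refl )
      descend : ∀ fuel → ∣ bits c ∩ ∁ (bits c′) ∣ ℕ.≤ fuel → c ~ c′
      descend zero bound = contradiction (ℕ.<-≤-trans closer bound) λ ()
      descend (suc fuel) bound = ~-trans {c} {c₁} {c′} (exchange-along (connected° i j) c hi lo)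
        (go fuel c₁ (ℕ.s≤s⁻¹ (ℕ.<-≤-trans closer bound)))

  Saturates : Region 𝒟 → Bool → Configuration → Set
  Saturates X b c = ∀ i → i ∈ X → c ! i ≡ b

  -- The set and its complement both have `∣ W ∣` squares, so the strict bounds leave room for `x`
  -- beside `X` and for `y` beside `Y`. The values at `x` and `y` are those that let `d` be
  -- exchanged.
  extreme-configuration : ∀ X Y → X ⊆ ∁ d → Y ⊆ ∁ d → (∀ {i} → i ∈ X → i ∉ Y) →
    ∣ X ∣ ℕ.< ∣ W ∣ → ∣ Y ∣ ℕ.< ∣ W ∣ →
    ∃[ c ] (Saturates X true c × Saturates Y false c × c ! x ≡ true × c ! y ≡ false)
  extreme-configuration X Y X⊆ Y⊆ X#Y X< Y< with interpolate (X ∪ ⁅ x ⁆)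
    (∁ (Y ∪ ⁅ y ⁆)) ∣ W ∣ separated low high
    where
    with-square : ∀ R z → ∣ R ∣ ℕ.< ∣ W ∣ → ∣ R ∪ ⁅ z ⁆ ∣ ℕ.≤ ∣ W ∣
    with-square R z R< = ℕ.≤-trans (∪-count R ⁅ z ⁆)
      (subst (ℕ._≤ ∣ W ∣) (sym (trans (cong (∣ R ∣ ℕ.+_) (Subset.∣⁅x⁆∣≡1 z)) (ℕ.+-comm ∣ R ∣ 1)))
        R<)
    low = with-square X x X<
    high : ∣ W ∣ ℕ.≤ ∣ ∁ (Y ∪ ⁅ y ⁆) ∣
    high = subst₂ ℕ._≤_ (sym (trans ∣W∣≡∣∁W∣ (Subset.∣∁p∣≡n∸∣p∣ W)))
      (sym (Subset.∣∁p∣≡n∸∣p∣ (Y ∪ ⁅ y ⁆)))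
      (ℕ.∸-monoʳ-≤ size (with-square Y y Y<))
    separated : X ∪ ⁅ x ⁆ ⊆ ∁ (Y ∪ ⁅ y ⁆)
    separated i∈ = Subset.x∉p⇒x∈∁p λ i∈′ →
      apart (Subset.x∈p∪q⁻ X ⁅ x ⁆ i∈) (Subset.x∈p∪q⁻ Y ⁅ y ⁆ i∈′)
      where
      apart : ∀ {i} → i ∈ X ⊎ i ∈ ⁅ x ⁆ → i ∈ Y ⊎ i ∈ ⁅ y ⁆ → Empty.⊥
      apart (inj₁ i∈X) (inj₁ i∈Y) = X#Y i∈X i∈Y
      apart (inj₁ i∈X) (inj₂ i∈y) with refl ← Subset.x∈⁅y⁆⇒x≡y y i∈y = Subset.x∈∁p⇒x∉p (X⊆ i∈X) y∈d
      apart (inj₂ i∈x) (inj₁ i∈Y) with refl ← Subset.x∈⁅y⁆⇒x≡y x i∈x = Subset.x∈∁p⇒x∉p (Y⊆ i∈Y) x∈d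
      apart (inj₂ i∈x) (inj₂ i∈y) = adjacent-distinct xy
        (trans (sym (Subset.x∈⁅y⁆⇒x≡y x i∈x)) (Subset.x∈⁅y⁆⇒x≡y y i∈y))
  ... | c , S⊆c , c⊆T , eq = configuration c eq ,
    (λ i i∈X → ∈⇒true (S⊆c (Subset.p⊆p∪q ⁅ x ⁆ i∈X))) ,
    (λ i i∈Y → ∉⇒false λ i∈c → Subset.x∈∁p⇒x∉p (c⊆T i∈c) (Subset.p⊆p∪q ⁅ y ⁆ i∈Y)) ,
    ∈⇒true (S⊆c (Subset.q⊆p∪q X ⁅ x ⁆ (Subset.x∈⁅x⁆ x))) ,
    ∉⇒false λ y∈c → Subset.x∈∁p⇒x∉p (c⊆T y∈c) (Subset.q⊆p∪q Y ⁅ y ⁆ (Subset.x∈⁅x⁆ y))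

  saturates⇒constant : ∀ {X b} c → Saturates X b c → Constant X b (plugOf c)
  saturates⇒constant c sat i i∈X = trans (config-plugOf c i) (sat i i∈X)

  base : Configuration
  base = configuration W refl

  -- `all-linked` provides the way to the crossing and back with trivial word, so only the crossing
  -- of `d` contributes.
  around : ∀ c → c ! x ≡ true → c ! y ≡ false →
           Linked (plugOf base) (plugOf base) (weight (plugOf c)) ×
           Linked (plugOf base) (plugOf base) (weight (plugOf c) ⁻¹)
  around c hi lo =
    conjugate (all-linked base c) (proj₁ crossing) (all-linked c′ base) ,
    conjugate (all-linked base c′) (proj₂ crossing) (all-linked c base)
    where
    c′ = exchange c x y hi lo
    crossing : Linked (plugOf c) (plugOf c′) (weight (plugOf c)) × Linked (plugOf c′) (plugOf c)
      (weight (plugOf c) ⁻¹)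
    crossing = subst (λ w → Linked (plugOf c) (plugOf c′) w × Linked (plugOf c′) (plugOf c) (w ⁻¹))
      (trans (cong (λ D → stepValue D (plugOf c)) (sym d≡)) (stepValue-≡ (plugOf c)))
      (white-exchange c xy hi lo x-white)
    conjugate : ∀ {p q r s w} → Linked p q 1ʷ → Linked q r w → Linked r s 1ʷ → Linked p s w
    conjugate {w = w} a b c with link-trans a (link-trans b c)
    ... | γ , even , eq = γ , even , F₂.trans eq (F₂.identityʳ w)

  letter-loop : ∀ (l : Letter) → Linked (plugOf base) (plugOf base) (l ∷ [])
  letter-loop (s , Fin.zero) with extreme-configuration C₁ C₂ C₁⊆∁d C₂⊆∁d C₁#C₂ small₁ small₂
  ... | c , sat₁ , sat₂ , hi , lo = signed s
    where
    weight-c : weight (plugOf c) ≡ generator Fin.zero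
    weight-c = pick-first (extreme? C₁ C₂ (plugOf c)) (extreme? C₂ C₁ (plugOf c))
      (saturates⇒constant c sat₁ , saturates⇒constant c sat₂)
    signed : ∀ s → Linked (plugOf base) (plugOf base) ((s , Fin.zero) ∷ [])
    signed Sign.+ = subst (Linked _ _) weight-c (proj₁ (around c hi lo))
    signed Sign.- = subst (λ w → Linked _ _ (w ⁻¹)) weight-c (proj₂ (around c hi lo))
  letter-loop (s , Fin.suc Fin.zero) with extreme-configuration C₂ C₁ C₂⊆∁d C₁⊆∁d
    (λ i∈C₂ i∈C₁ → C₁#C₂ i∈C₁ i∈C₂) small₂ small₁
  ... | c , sat₂ , sat₁ , hi , lo = signed s
    where
    weight-c : weight (plugOf c) ≡ generator (Fin.suc Fin.zero)
    weight-c = pick-second (extreme? C₁ C₂ (plugOf c)) (extreme? C₂ C₁ (plugOf c))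
      -- On the nonempty `C₁` the values cannot be both true and false, so the two ways of being
      -- extreme exclude each other.
      (λ (one , _) → contradiction
        (trans (sym (one _ (proj₂ C₁-nonempty))) (saturates⇒constant c sat₁ _ (proj₂ C₁-nonempty)))
          λ ())
      (saturates⇒constant c sat₂ , saturates⇒constant c sat₁)
    signed : ∀ s → Linked (plugOf base) (plugOf base) ((s , Fin.suc Fin.zero) ∷ [])
    signed Sign.+ = subst (Linked _ _) weight-c (proj₁ (around c hi lo))
    signed Sign.- = subst (λ w → Linked _ _ (w ⁻¹)) weight-c (proj₂ (around c hi lo))

  word-loop : ∀ w → Linked (plugOf base) (plugOf base) w
  word-loop []      = ε , refl , F₂.refl
  word-loop (l ∷ w) = link-trans (letter-loop l) (word-loop w)

  strongly-irregular : StronglyIrregular 𝒟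
  strongly-irregular = (λ g → eval 0ℙ (proj₁ g)) , eval-hom , λ w →
    let (γ , even , eq) = subst (λ p → Linked p p w) (sym p∘-plugOf) (word-loop w) in
    (γ , even) , λ γ≃ → F₂.trans (eval-cong 0ℙ γ≃) eq

-- The 2 × 2 squares around a domino

shifted-flip : ∀ a ι → ℤ.∣ shifted a ι ℤ.- shifted a (not ι) ∣ ≡ 1
shifted-flip a false = trans (ℤ.∣i-j∣≡∣j-i∣ a (ℤ.suc a)) (∣suc-∣ a)
shifted-flip a true  = ∣suc-∣ a

shifted-injective : ∀ a {ι η} → shifted a ι ≡ shifted a η → ι ≡ η
shifted-injective a {false} {false} _  = refl
shifted-injective a {false} {true}  eq = contradiction eq ℤ.i≢suc[i]
shifted-injective a {true}  {false} eq = contradiction (sym eq) ℤ.i≢suc[i]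
shifted-injective a {true}  {true}  _  = refl

-- In the direction of the domino, the two coordinates of its squares determine the corner of the
-- `2 × 2` square; in the other direction `unshift` leaves two choices.
shifted-⊓ : ∀ a {ι η} → ι ≢ η → a ≡ shifted a ι ℤ.⊓ shifted a η
shifted-⊓ a {false} {false} ≢ = contradiction refl ≢
shifted-⊓ a {false} {true}  _ = sym (ℤ.i≤j⇒i⊓j≡i (ℤ.i≤suc[i] a))
shifted-⊓ a {true}  {false} _ = sym (ℤ.i≥j⇒i⊓j≡j (ℤ.i≤suc[i] a))
shifted-⊓ a {true}  {true}  ≢ = contradiction refl ≢

unshift : ∀ a ι → a ≡ shifted a ι ⊎ a ≡ ℤ.pred (shifted a ι)
unshift a false = inj₁ refl
unshift a true  = inj₂ (sym (ℤ.pred-suc a))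

∣a-a∣≢1 : ∀ a → ℤ.∣ a ℤ.- a ∣ ≢ 1
∣a-a∣≢1 a one = contradiction (trans (sym one) (cong ℤ.∣_∣ (ℤ.+-inverseʳ a))) λ ()

module Squares (𝒟 : QuadriculatedDisk) where
  open QuadriculatedDisk 𝒟 using (size; cell; distinct)
  open Graph 𝒟

  -- The cells are indexed by two bits so that neighbours arise by negating one of them. The eight
  -- positions of an ordered domino thereby reduce to its two directions.
  record Square (κ : Cell) (Q : Region 𝒟) : Set where
    field
      at    : Bool → Bool → Fin size
      cells : ∀ ι ι′ → cell (at ι ι′) ≡ (shifted (proj₁ κ) ι , shifted (proj₂ κ) ι′)
      at∈   : ∀ ι ι′ → at ι ι′ ∈ Q
      ∈⇒at  : ∀ {i} → i ∈ Q → ∃₂ λ ι ι′ → i ≡ at ι ι′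

    at-injective : ∀ {ι ι′ η η′} → at ι ι′ ≡ at η η′ → ι ≡ η × ι′ ≡ η′
    at-injective {ι} {ι′} {η} {η′} eq =
      shifted-injective _ (cong proj₁ same) , shifted-injective _ (cong proj₂ same)
      where same = trans (sym (cells ι ι′)) (trans (cong cell eq) (cells η η′))

    horizontal : ∀ ι ι′ → Adj (at ι ι′) (at (not ι) ι′)
    horizontal ι ι′ = subst₂ Adjacent (sym (cells ι ι′)) (sym (cells (not ι) ι′))
      (inj₁ (shifted-flip _ ι , refl))

    vertical : ∀ ι ι′ → Adj (at ι ι′) (at ι (not ι′))
    vertical ι ι′ = subst₂ Adjacent (sym (cells ι ι′)) (sym (cells ι (not ι′)))
      (inj₂ (refl , shifted-flip _ ι′))

    aligned : ∀ {ι ι′ η η′} → Adj (at ι ι′) (at η η′) → ι ≢ η × ι′ ≡ η′ ⊎ ι ≡ η × ι′ ≢ η′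
    aligned {ι} {ι′} {η} {η′} adj with subst₂ Adjacent (cells ι ι′) (cells η η′) adj
    ... | inj₁ (one , eq) =
          inj₁ ((λ { refl → ∣a-a∣≢1 (shifted (proj₁ κ) ι) one }) , shifted-injective _ eq)
    ... | inj₂ (eq , one) =
          inj₂ (shifted-injective _ eq , λ { refl → ∣a-a∣≢1 (shifted (proj₂ κ) ι′) one })

  open Square

  square : ∀ (κ : Cell) {i j k l : Fin size} → let (a , b) = κ in
           cell i ≡ (a , b) → cell j ≡ (ℤ.suc a , b) → cell k ≡ (a , ℤ.suc b) →
             cell l ≡ (ℤ.suc a , ℤ.suc b) →
           Square κ ((⁅ i ⁆ ∪ ⁅ j ⁆) ∪ (⁅ k ⁆ ∪ ⁅ l ⁆))
  square κ {i} {j} {k} {l} i≡ j≡ k≡ l≡ =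
    record { at = at′ ; cells = cells′ ; at∈ = at∈′ ; ∈⇒at = ∈⇒at′ }
    where
    at′ : Bool → Bool → Fin size
    at′ false false = i
    at′ true  false = j
    at′ false true  = k
    at′ true  true  = l
    cells′ : ∀ ι ι′ → cell (at′ ι ι′) ≡ (shifted (proj₁ κ) ι , shifted (proj₂ κ) ι′)
    cells′ false false = i≡
    cells′ true  false = j≡
    cells′ false true  = k≡
    cells′ true  true  = l≡
    at∈′ : ∀ ι ι′ → at′ ι ι′ ∈ (⁅ i ⁆ ∪ ⁅ j ⁆) ∪ (⁅ k ⁆ ∪ ⁅ l ⁆)
    at∈′ false false = Subset.x∈p∪q⁺ (inj₁ (Subset.x∈p∪q⁺ (inj₁ (Subset.x∈⁅x⁆ i))))
    at∈′ true  false = Subset.x∈p∪q⁺ (inj₁ (Subset.x∈p∪q⁺ {p = ⁅ i ⁆} (inj₂ (Subset.x∈⁅x⁆ j))))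
    at∈′ false true  = Subset.x∈p∪q⁺ {p = ⁅ i ⁆ ∪ ⁅ j ⁆}
      (inj₂ (Subset.x∈p∪q⁺ (inj₁ (Subset.x∈⁅x⁆ k))))
    at∈′ true  true  = Subset.x∈p∪q⁺ {p = ⁅ i ⁆ ∪ ⁅ j ⁆}
      (inj₂ (Subset.x∈p∪q⁺ {p = ⁅ k ⁆} (inj₂ (Subset.x∈⁅x⁆ l))))
    ∈⇒at′ : ∀ {z} → z ∈ (⁅ i ⁆ ∪ ⁅ j ⁆) ∪ (⁅ k ⁆ ∪ ⁅ l ⁆) → ∃₂ λ ι ι′ → z ≡ at′ ι ι′
    ∈⇒at′ z∈ with Subset.x∈p∪q⁻ (⁅ i ⁆ ∪ ⁅ j ⁆) (⁅ k ⁆ ∪ ⁅ l ⁆) z∈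
    ... | inj₁ z∈ with Subset.x∈p∪q⁻ ⁅ i ⁆ ⁅ j ⁆ z∈
    ...   | inj₁ z∈ = false , false , Subset.x∈⁅y⁆⇒x≡y i z∈
    ...   | inj₂ z∈ = true , false , Subset.x∈⁅y⁆⇒x≡y j z∈
    ∈⇒at′ z∈ | inj₂ z∈′ with Subset.x∈p∪q⁻ ⁅ k ⁆ ⁅ l ⁆ z∈′
    ...   | inj₁ z∈ = false , true , Subset.x∈⁅y⁆⇒x≡y k z∈
    ...   | inj₂ z∈ = true , true , Subset.x∈⁅y⁆⇒x≡y l z∈

  twoByTwo⇒square : ∀ {Q} → TwoByTwo 𝒟 Q → ∃[ κ ] Square κ Q
  twoByTwo⇒square (a , b , i , j , k , l , i≡ , j≡ , k≡ , l≡ , refl) =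
    (a , b) , square (a , b) i≡ j≡ k≡ l≡

  square-unique : ∀ {κ Q Q′} → Square κ Q → Square κ Q′ → Q ⊆ Q′
  square-unique S S′ i∈Q with ∈⇒at S i∈Q
  ... | ι , ι′ , refl =
        subst (_∈ _) (distinct (trans (cells S′ ι ι′) (sym (cells S ι ι′)))) (at∈ S′ ι ι′)

  find-square : ∀ κ → (∃[ Q ] (TwoByTwo 𝒟 Q × Square κ Q)) ⊎ (∀ {Q} → ¬ Square κ Q)
  find-square (a , b) with find-cell (a , b) | find-cell (ℤ.suc a , b) | find-cell
    (a , ℤ.suc b) | find-cell (ℤ.suc a , ℤ.suc b)
    where
    find-cell : ∀ c → Dec (∃[ i ] cell i ≡ c)
    find-cell (u , v) = Fin.any? λ i →
      map′ (λ (p , q) → cong₂ _,_ p q) (λ eq → cong proj₁ eq , cong proj₂ eq)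
      ((proj₁ (cell i) ℤ.≟ u) ×-dec (proj₂ (cell i) ℤ.≟ v))
  ... | yes (i , i≡) | yes (j , j≡) | yes (k , k≡) | yes (l , l≡) =
    inj₁ (_ , (a , b , i , j , k , l , i≡ , j≡ , k≡ , l≡ , refl) , square (a , b) i≡ j≡ k≡ l≡)
  ... | no none | _ | _ | _ = inj₂ λ S → none (_ , cells S false false)
  ... | yes _ | no none | _ | _ = inj₂ λ S → none (_ , cells S true false)
  ... | yes _ | yes _ | no none | _ = inj₂ λ S → none (_ , cells S false true)
  ... | yes _ | yes _ | yes _ | no none = inj₂ λ S → none (_ , cells S true true)

  module Around {x y : Fin size} (xy : Adj x y) where

    -- Along the domino the corner is the minimum of the coordinates; across it, it is the common
    -- coordinate or one less.
    two-corners : ∃₂ λ κ₁ κ₂ → ∀ {κ Q} → Square κ Q → x ∈ Q → y ∈ Q → κ ≡ κ₁ ⊎ κ ≡ κ₂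
    two-corners = by-direction xy
      where
      u = proj₁ (cell x)
      v = proj₂ (cell x)
      u′ = proj₁ (cell y)
      v′ = proj₂ (cell y)
      by-direction : Adj x y → ∃₂ λ κ₁ κ₂ → ∀ {κ Q} → Square κ Q → x ∈ Q → y ∈ Q → κ ≡ κ₁ ⊎ κ ≡ κ₂
      by-direction (inj₁ (one , _)) = (u ℤ.⊓ u′ , v) , (u ℤ.⊓ u′ , ℤ.pred v) , corner
        where
        corner : ∀ {κ Q} → Square κ Q → x ∈ Q → y ∈ Q →
          κ ≡ (u ℤ.⊓ u′ , v) ⊎ κ ≡ (u ℤ.⊓ u′ , ℤ.pred v)
        corner {a , b} S x∈ y∈ with ∈⇒at S x∈ | ∈⇒at S y∈
        ... | ι , ι′ , refl | η , η′ , refl rewrite cells S ι ι′ | cells S η η′ =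
          Sum.map (cong₂ _,_ min) (cong₂ _,_ min) (unshift b ι′)
          where min = shifted-⊓ a {ι} {η} λ { refl → ∣a-a∣≢1 (shifted a ι) one }
      by-direction (inj₂ (_ , one)) = (u , v ℤ.⊓ v′) , (ℤ.pred u , v ℤ.⊓ v′) , corner
        where
        corner : ∀ {κ Q} → Square κ Q → x ∈ Q → y ∈ Q →
          κ ≡ (u , v ℤ.⊓ v′) ⊎ κ ≡ (ℤ.pred u , v ℤ.⊓ v′)
        corner {a , b} S x∈ y∈ with ∈⇒at S x∈ | ∈⇒at S y∈
        ... | ι , ι′ , refl | η , η′ , refl rewrite cells S ι ι′ | cells S η η′ =
          Sum.map (λ eq → cong₂ _,_ eq min) (λ eq → cong₂ _,_ eq min) (unshift a ι)
          where min = shifted-⊓ b {ι′} {η′} λ { refl → ∣a-a∣≢1 (shifted b ι′) one }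

    record Opposite (Q : Region 𝒟) : Set where
      field
        x′ y′   : Fin size
        xx′     : Adj x x′
        x′y′    : Adj x′ y′
        y′y     : Adj y′ y
        x′≢     : x′ ≢ x × x′ ≢ y
        y′≢     : y′ ≢ x × y′ ≢ y
        x′∈     : x′ ∈ Q
        only    : ∀ {i} → i ∈ Q → i ≢ x → i ≢ y → i ≡ x′ ⊎ i ≡ y′

    opposite : ∀ {κ Q} → Square κ Q → x ∈ Q → y ∈ Q → Opposite Q
    opposite S x∈ y∈ with ∈⇒at S x∈ | ∈⇒at S y∈
    ... | ι , ι′ , refl | η , η′ , refl with aligned S {ι} {ι′} {η} {η′} xy
    ...   | inj₁ (ι≢η , refl) with refl ← Bool.¬-not (≢-sym ι≢η) = record
      { x′ = at S ι (not ι′) ; y′ = at S (not ι) (not ι′)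
      ; xx′ = vertical S ι ι′ ; x′y′ = horizontal S ι (not ι′) ; y′y =
        adjacent-sym (vertical S (not ι) ι′)
      ; x′≢ = (λ eq → flipped (proj₂ (at-injective S eq))) ,
        (λ eq → flipped (proj₂ (at-injective S eq)))
      ; y′≢ = (λ eq → flipped (proj₂ (at-injective S eq))) ,
        (λ eq → flipped (proj₂ (at-injective S eq)))
      ; x′∈ = at∈ S ι (not ι′) ; only = only′ }
      where
      flipped : ∀ {b} → not b ≢ b
      flipped eq = Bool.not-¬ refl (sym eq)
      only′ : ∀ {i} → i ∈ _ → i ≢ at S ι ι′ → i ≢ at S (not ι) ι′ →
        i ≡ at S ι (not ι′) ⊎ i ≡ at S (not ι) (not ι′)
      only′ i∈ ≢x ≢y with ∈⇒at S i∈
      ... | ζ , ζ′ , refl with ζ Bool.≟ ι | ζ′ Bool.≟ ι′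
      ...   | yes refl | yes refl = contradiction refl ≢x
      ...   | yes refl | no ne with refl ← Bool.¬-not ne = inj₁ refl
      ...   | no ne | yes refl with refl ← Bool.¬-not ne = contradiction refl ≢y
      ...   | no ne | no ne′ with refl ← Bool.¬-not ne | refl ← Bool.¬-not ne′ = inj₂ refl
    opposite S x∈ y∈ | ι , ι′ , refl | η , η′ , refl | inj₂ (refl , ι′≢η′) with refl ← Bool.¬-not
      (≢-sym ι′≢η′) = record
      { x′ = at S (not ι) ι′ ; y′ = at S (not ι) (not ι′)
      ; xx′ = horizontal S ι ι′ ; x′y′ = vertical S (not ι) ι′ ; y′y =
        adjacent-sym (horizontal S ι (not ι′))
      ; x′≢ = (λ eq → flipped (proj₁ (at-injective S eq))) ,
        (λ eq → flipped (proj₁ (at-injective S eq)))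
      ; y′≢ = (λ eq → flipped (proj₁ (at-injective S eq))) ,
        (λ eq → flipped (proj₁ (at-injective S eq)))
      ; x′∈ = at∈ S (not ι) ι′ ; only = only′ }
      where
      flipped : ∀ {b} → not b ≢ b
      flipped eq = Bool.not-¬ refl (sym eq)
      only′ : ∀ {i} → i ∈ _ → i ≢ at S ι ι′ → i ≢ at S ι (not ι′) →
        i ≡ at S (not ι) ι′ ⊎ i ≡ at S (not ι) (not ι′)
      only′ i∈ ≢x ≢y with ∈⇒at S i∈
      ... | ζ , ζ′ , refl with ζ Bool.≟ ι | ζ′ Bool.≟ ι′
      ...   | yes refl | yes refl = contradiction refl ≢x
      ...   | yes refl | no ne with refl ← Bool.¬-not ne = contradiction refl ≢y
      ...   | no ne | yes refl with refl ← Bool.¬-not ne = inj₁ refl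
      ...   | no ne | no ne′ with refl ← Bool.¬-not ne | refl ← Bool.¬-not ne′ = inj₂ refl

    -- The two sides of the domino and the size bound

    module Sides (d : Region 𝒟) (d≡ : d ≡ ⁅ x ⁆ ∪ ⁅ y ⁆)
      (small : ∀ C → Component 𝒟 (∁ d) C → (∃[ Q ] (TwoByTwo 𝒟 Q × d ⊆ Q × Nonempty (C ∩ Q))) →
               ∣ C ∣ ℕ.≤ (size ∸ 2) / 2) where

      x∈d : x ∈ d
      x∈d = subst (x ∈_) (sym d≡) (Subset.x∈p∪q⁺ (inj₁ (Subset.x∈⁅x⁆ x)))

      y∈d : y ∈ d
      y∈d = subst (y ∈_) (sym d≡) (Subset.x∈p∪q⁺ {p = ⁅ x ⁆} (inj₂ (Subset.x∈⁅x⁆ y)))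

      ∉d : ∀ {z} → z ≢ x × z ≢ y → z ∉ d
      ∉d (≢x , ≢y) z∈d with Subset.x∈p∪q⁻ ⁅ x ⁆ ⁅ y ⁆ (subst (_ ∈_) d≡ z∈d)
      ... | inj₁ z∈x = ≢x (Subset.x∈⁅y⁆⇒x≡y x z∈x)
      ... | inj₂ z∈y = ≢y (Subset.x∈⁅y⁆⇒x≡y y z∈y)

      -- `C` is the component that meets the `2 × 2` square at `κ`, or empty if the disk has no such
      -- square around `d`; both cases satisfy the same conditions.
      record Side (κ : Cell) : Set where
        field
          C         : Region 𝒟
          C⊆∁d      : C ⊆ ∁ d
          connected : Connected 𝒟 C
          closed    : Closed (∁ d) C
          ∣C∣≤      : ∣ C ∣ ℕ.≤ (size ∸ 2) / 2
          flank     : ∀ {Q} → Square κ Q → d ⊆ Q → ∀ {i} → i ∈ Q → i ∉ d → i ∈ C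

      no-side : ∀ κ → (∀ {Q} → Square κ Q → ¬ d ⊆ Q) → Side κ
      no-side κ none = record
        { C = ⊥ ; C⊆∁d = Subset.⊥⊆ ; connected = λ i∈ → contradiction i∈ Subset.∉⊥
        ; closed = λ i∈ → contradiction i∈ Subset.∉⊥
        ; ∣C∣≤ = subst (ℕ._≤ (size ∸ 2) / 2) (sym (Subset.∣⊥∣≡0 size)) ℕ.z≤n
        ; flank = λ S d⊆Q → Empty.⊥-elim (none S d⊆Q) }

      side : ∀ κ → Side κ
      side κ with find-square κ
      ... | inj₂ none = no-side κ λ S _ → none S
      ... | inj₁ (Q , two , S) with d Subset.⊆? Q
      ...   | no d⊈Q = no-side κ λ S′ d⊆Q′ → d⊈Q λ z∈d → square-unique S′ S (d⊆Q′ z∈d)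
      ...   | yes d⊆Q with component-of (∁ d)
            (Subset.x∉p⇒x∈∁p (∉d (Opposite.x′≢ (opposite S (d⊆Q x∈d) (d⊆Q y∈d)))))
      ...     | C , x′∈C , component@(_ , C⊆ , conn , _) , closed = record
        { C = C ; C⊆∁d = C⊆ ; connected = conn ; closed = closed
        ; ∣C∣≤ = small C component (Q , two , d⊆Q , x′ , Subset.x∈p∩q⁺ (x′∈C , x′∈))
        ; flank = λ S′ d⊆Q′ i∈Q′ i∉d → inside-C (square-unique S′ S i∈Q′) i∉d }
        where
        open Opposite (opposite S (d⊆Q x∈d) (d⊆Q y∈d))
        inside-C : ∀ {i} → i ∈ Q → i ∉ d → i ∈ C
        inside-C i∈Q i∉d with only i∈Q (λ { refl → i∉d x∈d }) (λ { refl → i∉d y∈d })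
        ... | inj₁ refl = x′∈C
        ... | inj₂ refl = closed x′∈C (Subset.x∉p⇒x∈∁p i∉d) x′y′

      module _ (balanced : Balanced 𝒟 ⊤) (x-white : lookup W x ≡ true) where

        size≡ : size ≡ ∣ W ∣ ℕ.+ ∣ W ∣
        size≡ = trans (sym (ℕ.m+[n∸m]≡n (Subset.∣p∣≤n W))) (cong (∣ W ∣ ℕ.+_)
          (trans (sym (Subset.∣∁p∣≡n∸∣p∣ W)) (sym (Configurations.∣W∣≡∣∁W∣ 𝒟 balanced))))

        -- `(2 n - 2) / 2 = n - 1`, so the hypothesis amounts to a size strictly below half of the
        -- disk. Positivity of `n` guards against truncated subtraction.
        half-size : ∀ n s → 0 ℕ.< n → s ≡ n ℕ.+ n → suc ((s ∸ 2) / 2) ≡ n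
        half-size (suc n) .(suc n ℕ.+ suc n) _ refl = cong suc
          (trans (cong (λ m → (m ∸ 1) / 2) (ℕ.+-suc n n))
            (trans (cong (_/ 2) n+n≡n*2) (ℕ.m*n/n≡m n 2)))
          where
          n+n≡n*2 : n ℕ.+ n ≡ n ℕ.* 2
          n+n≡n*2 = trans (cong (n ℕ.+_) (sym (ℕ.+-identityʳ n))) (ℕ.*-comm 2 n)

        smaller : ∀ {m} → m ℕ.≤ (size ∸ 2) / 2 → m ℕ.< ∣ W ∣
        smaller m≤ = ℕ.≤-trans (ℕ.s≤s m≤) (ℕ.≤-reflexive (half-size ∣ W ∣ size W-nonempty size≡))
          where
          W-nonempty : 0 ℕ.< ∣ W ∣
          W-nonempty = subst (ℕ._< ∣ W ∣) (Subset.∣⊥∣≡0 size)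
            (Subset.p⊂q⇒∣p∣<∣q∣ {q = W} (Subset.⊥⊆ , x , true⇒∈ {R = W} x-white , Subset.∉⊥))

        -- A square around `d` exists at `κ`, which makes `C₁` nonempty; at `κ′` there may be none.
        -- If the two sides meet, the second lies in the first, and `C₂` is taken to be empty to
        -- keep the regions disjoint.
        bottleneck-from : ∀ {κ κ′ Q} → Square κ Q → d ⊆ Q →
          (∀ {κ″ Q′} → Square κ″ Q′ → d ⊆ Q′ → κ″ ≡ κ ⊎ κ″ ≡ κ′) → Bottleneck 𝒟 d
        bottleneck-from {κ} {κ′} {Q} S d⊆Q either with side κ | side κ′
        ... | s₁ | s₂ with Subset.nonempty? (Side.C s₁ ∩ Side.C s₂)
        ...   | yes (z , z∈) = record
          { xy = xy ; xx′ = xx′ ; x′y′ = x′y′ ; y′y = y′y ; d≡ = d≡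
          ; x′∉d = ∉d x′≢ ; y′∉d = ∉d y′≢ ; x-white = x-white
          ; C₁ = S₁.C ; C₂ = ⊥ ; C₁⊆∁d = S₁.C⊆∁d ; C₂⊆∁d = Subset.⊥⊆ ; closed₁ = S₁.closed
          ; closed₂ = λ i∈ → contradiction i∈ Subset.∉⊥
          ; C₁-nonempty = x′ , S₁.flank S d⊆Q x′∈ (∉d x′≢)
          ; C₁#C₂ = λ _ → Subset.∉⊥
          ; flanks = λ two d⊆Q′ i∈ i∉d → inj₁ (flanked (proj₂ (twoByTwo⇒square two)) d⊆Q′ i∈ i∉d)
          ; small₁ = smaller S₁.∣C∣≤
          ; small₂ = smaller (subst (ℕ._≤ (size ∸ 2) / 2) (sym (Subset.∣⊥∣≡0 size)) ℕ.z≤n) }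
          where
          module S₁ = Side s₁
          module S₂ = Side s₂
          open Opposite (opposite S (d⊆Q x∈d) (d⊆Q y∈d))
          S₂⊆S₁ : S₂.C ⊆ S₁.C
          S₂⊆S₁ i∈ = closed-path S₁.closed (proj₁ (Subset.x∈p∩q⁻ S₁.C S₂.C z∈))
            (Star.map (λ (k∈ , l∈ , adj) → S₂.C⊆∁d k∈ , S₂.C⊆∁d l∈ , adj)
              (S₂.connected (proj₂ (Subset.x∈p∩q⁻ S₁.C S₂.C z∈)) i∈))
          flanked : ∀ {κ″ Q′} → Square κ″ Q′ → d ⊆ Q′ → ∀ {i} → i ∈ Q′ → i ∉ d → i ∈ S₁.C
          flanked S′ d⊆Q′ with either S′ d⊆Q′
          ... | inj₁ refl = S₁.flank S′ d⊆Q′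
          ... | inj₂ refl = λ i∈ i∉d → S₂⊆S₁ (S₂.flank S′ d⊆Q′ i∈ i∉d)
        ...   | no disjoint = record
          { xy = xy ; xx′ = xx′ ; x′y′ = x′y′ ; y′y = y′y ; d≡ = d≡
          ; x′∉d = ∉d x′≢ ; y′∉d = ∉d y′≢ ; x-white = x-white
          ; C₁ = S₁.C ; C₂ = S₂.C ; C₁⊆∁d = S₁.C⊆∁d ; C₂⊆∁d = S₂.C⊆∁d ; closed₁ = S₁.closed
          ; closed₂ = S₂.closed ; C₁-nonempty = x′ , S₁.flank S d⊆Q x′∈ (∉d x′≢)
          ; C₁#C₂ = λ i∈₁ i∈₂ → disjoint (_ , Subset.x∈p∩q⁺ (i∈₁ , i∈₂))
          ; flanks = λ two d⊆Q′ → flanked (proj₂ (twoByTwo⇒square two)) d⊆Q′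
          ; small₁ = smaller S₁.∣C∣≤ ; small₂ = smaller S₂.∣C∣≤ }
          where
          module S₁ = Side s₁
          module S₂ = Side s₂
          open Opposite (opposite S (d⊆Q x∈d) (d⊆Q y∈d))
          flanked : ∀ {κ″ Q′} → Square κ″ Q′ → d ⊆ Q′ → ∀ {i} → i ∈ Q′ → i ∉ d → i ∈ S₁.C ⊎ i ∈ S₂.C
          flanked S′ d⊆Q′ i∈ i∉d with either S′ d⊆Q′
          ... | inj₁ refl = inj₁ (S₁.flank S′ d⊆Q′ i∈ i∉d)
          ... | inj₂ refl = inj₂ (S₂.flank S′ d⊆Q′ i∈ i∉d)

        bottleneck : ∀ {Q} → TwoByTwo 𝒟 Q → d ⊆ Q → Bottleneck 𝒟 d
        bottleneck two d⊆Q with twoByTwo⇒square two | two-corners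
        ... | κ , S | κ₁ , κ₂ , corner with corner S (d⊆Q x∈d) (d⊆Q y∈d)
        ...   | inj₁ refl = bottleneck-from S d⊆Q λ S′ d⊆Q′ → corner S′ (d⊆Q′ x∈d) (d⊆Q′ y∈d)
        ...   | inj₂ refl = bottleneck-from S d⊆Q λ S′ d⊆Q′ →
              Sum.swap (corner S′ (d⊆Q′ x∈d) (d⊆Q′ y∈d))

theorem4 : (𝒟 : QuadriculatedDisk) → Balanced 𝒟 ⊤ →
    ∀ d → Domino 𝒟 d → ¬ Connected 𝒟 (∁ d) →
    (∃[ Q ] (TwoByTwo 𝒟 Q × d ⊆ Q)) →
    (∀ C → Component 𝒟 (∁ d) C →
    (∃[ Q ] (TwoByTwo 𝒟 Q × d ⊆ Q × Nonempty (C ∩ Q))) →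
    ∣ C ∣ ≤ (QuadriculatedDisk.size 𝒟 ∸ 2) / 2) →
    StronglyIrregular 𝒟
theorem4 𝒟 balanced d (i , j , ij , d≡) _ (Q , two , d⊆Q) small =
  Surjectivity.strongly-irregular 𝒟 balanced oriented
  where
  open Graph 𝒟
  open Squares 𝒟
  -- The squares of `d` are ordered so that `x` is the white one; then the exchange across `d` adds
  -- the domino and its word is the weight of the starting plug.
  oriented : Bottleneck 𝒟 d
  oriented with lookup W i in colour
  ... | true  = Around.Sides.bottleneck ij d d≡ small balanced colour two d⊆Q
  ... | false = Around.Sides.bottleneck (adjacent-sym ij) d
        (trans d≡ (Subset.∪-comm ⁅ i ⁆ ⁅ j ⁆)) small balanced
    (trans (adjacent-white (adjacent-sym ij)) (cong not colour)) two d⊆Q
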